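{- Let $x,y,z_1,z_2,z_3,z_4$ be indeterminates. For every integer $n\ge 3$ (and also for $n=2$, if $Z_0(x,y)$ is taken to be $1$), the quadruply-refined ASM generating function satisfies $$\begin{aligned} &y(z_4-z_2)(z_1-z_3)\,Z^{\mathrm{quad}}_n(x,y;z_1,z_2,z_3,z_4)\,Z_{n-2}(x,y)=\\ &\bigl((z_1-1)(z_2-1)-yz_1z_2\bigr)\bigl((z_3-1)(z_4-1)-yz_3z_4\bigr)\,Z^{\mathrm{adj}}_{n-1}(x,y;z_4,z_1)\,Z^{\mathrm{adj}}_{n-1}(x,y;z_2,z_3)\\ &-\bigl(x(z_4-1)(z_1-1)-y\bigr)\bigl(x(z_2-1)(z_3-1)-y\bigr)\,z_1z_2z_3z_4\,\widetilde{Z}^{\mathrm{adj}}_{n-1}(x,y;z_1,z_2)\,\widetilde{Z}^{\mathrm{adj}}_{n-1}(x,y;z_3,z_4)\\ &-(z_2-1)(z_3-1)\bigl((z_4-1)(z_1-1)-yz_4z_1\bigr)\,Z^{\mathrm{adj}}_{n-1}(x,y;z_4,z_1)\,Z_{n-2}(x,y)\\ &+(z_3-1)(z_4-1)\bigl(x(z_1-1)(z_2-1)-y\bigr)\,z_1z_2\,(xz_3z_4)^{n-1}\,\widetilde{Z}^{\mathrm{adj}}_{n-1}(x,y;z_1,z_2)\,Z_{n-2}(x,y)\\ &-(z_4-1)(z_1-1)\bigl((z_2-1)(z_3-1)-yz_2z_3\bigr)\,Z^{\mathrm{adj}}_{n-1}(x,y;z_2,z_3)\,Z_{n-2}(x,y)\\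 &+(z_1-1)(z_2-1)\bigl(x(z_3-1)(z_4-1)-y\bigr)\,z_3z_4\,(xz_1z_2)^{n-1}\,\widetilde{Z}^{\mathrm{adj}}_{n-1}(x,y;z_3,z_4)\,Z_{n-2}(x,y)\\ &+(z_1-1)(z_2-1)(z_3-1)(z_4-1)\bigl(1-(x^2z_1z_2z_3z_4)^{n-1}\bigr)\,Z_{n-2}(x,y)^2. \end{aligned}$$
   Context: An alternating sign matrix (ASM) is a square matrix with entries in $\{0,1,-1\}$ such that along each row and each column the nonzero entries alternate in sign and sum to $1$. $\mathrm{ASM}(n)$ is the set of $n\times n$ ASMs. The first and last rows and columns of an ASM each contain exactly one $1$, all other entries there being $0$. For $A\in\mathrm{ASM}(n)$ define: $\nu(A)=\sum_{1\le i<i'\le n,\;1\le j'\le j\le n}A_{ij}A_{i'j'}$ (a nonnegative integer); $\mu(A)=$ number of $-1$'s in $A$; $\rho_{\mathrm T}(A)=$ number of $0$'s to the left of the $1$ in the top row; $\rho_{\mathrm R}(A)=$ number of $0$'s below the $1$ in the right-most column; $\rho_{\mathrm B}(A)=$ number of $0$'s to the right of the $1$ in the bottom row; $\rho_{\mathrm L}(A)=$ number of $0$'s above the $1$ in the left-most column. Generating functions (for $n\ge1$): $Z^{\mathrm{quad}}_n(x,y;z_1,z_2,z_3,z_4)=\sum_{A\in\mathrm{ASM}(n)}x^{\nu(A)}y^{\mu(A)}z_1^{\rho_{\mathrm T}(A)}z_2^{\rho_{\mathrm R}(A)}z_3^{\rho_{\mathrm B}(A)}z_4^{\rho_{\mathrm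 L}(A)}$; $Z^{\mathrm{adj}}_n(x,y;z_1,z_2)=Z^{\mathrm{quad}}_n(x,y;z_1,1,1,z_2)$; $\widetilde{Z}^{\mathrm{adj}}_n(x,y;z_1,z_2)=Z^{\mathrm{quad}}_n(x,y;z_1,z_2,1,1)$; $Z_n(x,y)=Z^{\mathrm{quad}}_n(x,y;1,1,1,1)$. -}

module Defs where

open import Algebra.Bundles using (CommutativeRing)
import Algebra.Properties.Semiring.Exp
open import Data.Bool.Base using (if_then_else_)
open import Data.Fin.Base using (Fin; _<_; _≤_)
open import Data.Fin.Properties using (_<?_; _≤?_)
open import Data.Integer.Base using (ℤ; 0ℤ; 1ℤ; -1ℤ; ∣_∣; sign; _*_)
open import Data.Integer.Properties using (_≟_; +-0-commutativeMonoid)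
open import Algebra.Properties.CommutativeMonoid.Sum +-0-commutativeMonoid
  using (sum; sum-syntax)
open import Data.List.Base as List
  using (List; []; _∷_; filter; takeWhile; length; cartesianProductWith)
open import Data.List.Relation.Unary.Linked using (Linked; linked?)
open import Data.List.Membership.DecPropositional _≟_ using (_∈_; _∈?_)
open import Data.Nat.Base using (ℕ; zero; suc; NonZero)
open import Data.Product.Base using (_×_)
import Data.Sign.Properties as Sign
open import Data.Vec.Base as Vec
  using (Vec; []; _∷_; lookup; transpose; concat; count; toList; head; last; reverse)
open import Data.Vec.Relation.Unary.All using (All; all?)
open import Relation.Binary.PropositionalEquality.Core using (_≡_; _≢_)
open import Relation.Nullary.Decidable using (Dec; does; ¬?; _×-dec_)

------------------------------------------------------------------------
-- Alternating sign matrices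

-- A matrix is the vector of its rows, from top to bottom.
Matrix : ℕ → Set
Matrix n = Vec (Vec ℤ n) n

entry : ∀ {n} → Matrix n → Fin n → Fin n → ℤ
entry A i j = lookup (lookup A i) j

nonzeros : ∀ {n} → Vec ℤ n → List ℤ
nonzeros v = filter (λ a → ¬? (a ≟ 0ℤ)) (toList v)

Alternating : ∀ {n} → Vec ℤ n → Set
Alternating v = Linked (λ a b → sign a ≢ sign b) (nonzeros v) × sum (lookup v) ≡ 1ℤ

alternating? : ∀ {n} (v : Vec ℤ n) → Dec (Alternating v)
alternating? v =
  linked? (λ a b → ¬? (sign a Sign.≟ sign b)) (nonzeros v) ×-dec sum (lookup v) ≟ 1ℤ

entries : List ℤ
entries = 0ℤ ∷ 1ℤ ∷ -1ℤ ∷ []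

IsASM : ∀ {n} → Matrix n → Set
IsASM A = All (All (_∈ entries)) A × All Alternating A × All Alternating (transpose A)

isASM? : ∀ {n} (A : Matrix n) → Dec (IsASM A)
isASM? A =
  all? (all? (_∈? entries)) A ×-dec all? alternating? A ×-dec all? alternating? (transpose A)

-- All vectors of length n with components in xs, each once if xs has no
-- repetitions.
vectors : ∀ {A : Set} → List A → (n : ℕ) → List (Vec A n)
vectors xs zero    = [] ∷ []
vectors xs (suc n) = cartesianProductWith _∷_ xs (vectors xs n)

ASM : (n : ℕ) → List (Matrix n)
ASM n = filter isASM? (vectors (vectors entries n) n)

------------------------------------------------------------------------
-- Statistics

-- On an ASM the sum is nonnegative, so that ∣_∣ merely reads it as a natural
-- number: it equals the sum over all i′, j of
-- (∑_{i<i′} Aᵢⱼ) (∑_{j′≤j} Aᵢ′ⱼ′), and these partial sums lie in {0,1}.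
ν : ∀ {n} → Matrix n → ℕ
ν {n} A = ∣ ∑[ i < n ] (∑[ i′ < n ] (∑[ j < n ] (∑[ j′ < n ]
  (if does (i <? i′ ×-dec j′ ≤? j) then entry A i j * entry A i′ j′ else 0ℤ)))) ∣

μ : ∀ {n} → Matrix n → ℕ
μ A = count (_≟ -1ℤ) (concat A)

zerosBefore1 : ∀ {n} → Vec ℤ n → ℕ
zerosBefore1 v = length (filter (_≟ 0ℤ) (takeWhile (λ a → ¬? (a ≟ 1ℤ)) (toList v)))

-- Each boundary line is read so that the zeros to be counted precede its 1.
ρT ρR ρB ρL : ∀ {n} → Matrix (suc n) → ℕ
ρT A = zerosBefore1 (head A)
ρR A = zerosBefore1 (reverse (last (transpose A)))
ρB A = zerosBefore1 (reverse (last A))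
ρL A = zerosBefore1 (head (transpose A))

------------------------------------------------------------------------
-- Generating functions, evaluated at elements of a commutative ring

-- An identity between polynomials with integer coefficients in indeterminates
-- is an identity between their values in every commutative ring.
module GeneratingFunctions {c ℓ} (R : CommutativeRing c ℓ) where

  open CommutativeRing R using (Carrier; 0#; 1#; semiring)
    renaming (_+_ to _⊕_; _*_ to _⊗_)
  open Algebra.Properties.Semiring.Exp semiring using (_^_) public

  Zquad : (n : ℕ) .{{_ : NonZero n}} → (x y z₁ z₂ z₃ z₄ : Carrier) → Carrier
  Zquad n@(suc _) x y z₁ z₂ z₃ z₄ = List.foldr _⊕_ 0# (List.map weight (ASM n))
    where
    weight : Matrix n → Carrier
    weight A =
      x ^ ν A ⊗ y ^ μ A ⊗ z₁ ^ ρT A ⊗ z₂ ^ ρR A ⊗ z₃ ^ ρB A ⊗ z₄ ^ ρL A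

  Zadj : (n : ℕ) .{{_ : NonZero n}} → (x y z₁ z₂ : Carrier) → Carrier
  Zadj n x y z₁ z₂ = Zquad n x y z₁ 1# 1# z₂

  Z̃adj : (n : ℕ) .{{_ : NonZero n}} → (x y z₁ z₂ : Carrier) → Carrier
  Z̃adj n x y z₁ z₂ = Zquad n x y z₁ z₂ 1# 1#

  Z : (n : ℕ) → (x y : Carrier) → Carrier
  Z zero      x y = 1#
  Z n@(suc _) x y = Zquad n x y 1# 1# 1# 1#

-- An alternating sign matrix is a configuration of the six-vertex model with
-- domain wall boundary conditions. Attach a parameter to each row and each column,
-- normalised so that 0 is the homogeneous value and a refinement variable is
-- z = 1 + y p. The partition function W(P; V) with parameters P of the rows and V of
-- the columns is symmetric in V by the Yang-Baxter equation and satisfies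
-- W(P; V) = W(V; P). A polynomial in the parameter p of the top row is determined by
-- the zeros of its corner weights, where a corner entry is forced to be 1; this gives
-- an expansion of W(p, M; V) in terms of W(M; V ∖ w), which is the Laplace expansion
-- behind the Izergin-Korepin determinant. Evaluating one double sum with the row
-- expansion and with the column expansion yields the Desnanot-Jacobi identity for W
-- without determinants. At the homogeneous point, W differs from the generating
-- functions of the theorem only in the weights of the corner vertices, and changing
-- these one at a time turns the bilinear identity for W into the theorem, over ℚ and
-- away from a hypersurface; as both sides are polynomials with integer coefficients,
-- it then holds in every commutative ring.

module Submission where

open import Algebra.Bundles using (CommutativeRing)
open import Data.Bool.Base using (Bool; true; false)
open import Data.Empty using (⊥-elim)
open import Data.Fin.Base using (Fin; zero; suc)
open import Data.Nat.Base as ℕ using (ℕ; zero; suc)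
import Data.Nat.Properties as ℕ
open import Data.Vec.Base using (Vec; []; _∷_; _∷ʳ_; lookup; replicate)
open import Defs
open import Function.Base using (_∘_)
open import Level using (Level; _⊔_)
import Relation.Binary.PropositionalEquality as ≡
open ≡ using (_≡_; _≢_)
open import Relation.Nullary using (Dec; yes; no; ¬_)

-- The obstacle is that the theorem lives where all inner parameters are 0, whereas the expansions
-- behind the bilinear identity divide by differences of parameters. The identity is therefore
-- proved for distinct parameters over a field of characteristic 0 and then carried to repeated ones
-- along a line, which only takes that a state sum is a polynomial function of the position on the
-- line. The weights (1+yp)(1+yv) - ypv and 1 - xypv of the vertices are exact refinement weights as
-- soon as p or v is 0, hence the correction at the four corners alone. A partition function is
-- affine in the weight of a corner. Its constant term collects the configurations with entry 1 in
-- that corner, where a row and a column are frozen, and is a monomial times a smaller partition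
-- function. This is where the terms with a factor Z of order n-2 on the right-hand side and the
-- powers of xz₁z₂ and xz₃z₄ come from. Corners are changed without division, so the identity first
-- appears multiplied by the product of the four new corner weights, which is cancelled away from
-- its zeros.

module IntSolver {c ℓ} (R : CommutativeRing c ℓ) where

  open CommutativeRing R hiding (zero)
  open import Algebra.Properties.Ring ring
  open import Algebra.Properties.AbelianGroup +-abelianGroup using (⁻¹-∙-comm)
  open import Algebra.Properties.Semiring.Mult semiring
    using (_×_; ×-homo-+; ×1-homo-*)
  open import Algebra.Solver.Ring.AlmostCommutativeRing
  open import Data.Integer.Base as ℤ using (ℤ; +_; -[1+_]; _⊖_)
  import Data.Integer.Properties as ℤ
  open import Data.Maybe.Base using (Maybe; just; nothing)
  open import Relation.Binary.Reasoning.Setoid setoid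

  fromℕ : ℕ → Carrier
  fromℕ n = n × 1#

  fromℤ : ℤ → Carrier
  fromℤ (+ n)    = fromℕ n
  fromℤ -[1+ n ] = - fromℕ (suc n)

  private
    cancel : ∀ a b u → (u + a) - (u + b) ≈ a - b
    cancel a b u = begin
      (u + a) - (u + b)       ≈⟨ +-cong (+-comm a u) (⁻¹-∙-comm u b) ⟨
      (a + u) + (- u - b)     ≈⟨ +-assoc a u _ ⟩
      a + (u + (- u - b))     ≈⟨ +-congˡ (+-assoc u (- u) (- b)) ⟨
      a + ((u - u) - b)       ≈⟨ +-congˡ (+-congʳ (-‿inverseʳ u)) ⟩
      a + (0# - b)            ≈⟨ +-congˡ (+-identityˡ (- b)) ⟩
      a - b                   ∎

  fromℤ-⊖ : ∀ m n → fromℤ (m ⊖ n) ≈ fromℕ m - fromℕ n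
  fromℤ-⊖ m       zero    = sym (trans (+-congˡ -0#≈0#) (+-identityʳ _))
  fromℤ-⊖ zero    (suc n) = sym (+-identityˡ _)
  fromℤ-⊖ (suc m) (suc n) = begin
    fromℤ (suc m ⊖ suc n)           ≡⟨ ≡.cong fromℤ (ℤ.[1+m]⊖[1+n]≡m⊖n m n) ⟩
    fromℤ (m ⊖ n)                   ≈⟨ fromℤ-⊖ m n ⟩
    fromℕ m - fromℕ n               ≈⟨ cancel (fromℕ m) (fromℕ n) 1# ⟨
    fromℕ (suc m) - fromℕ (suc n)   ∎

  fromℤ-+ : ∀ i j → fromℤ (i ℤ.+ j) ≈ fromℤ i + fromℤ j
  fromℤ-+ (+ m)    (+ n)    = ×-homo-+ 1# m n
  fromℤ-+ (+ m)    -[1+ n ] = fromℤ-⊖ m (suc n)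
  fromℤ-+ -[1+ m ] (+ n)    = trans (fromℤ-⊖ n (suc m)) (+-comm _ _)
  fromℤ-+ -[1+ m ] -[1+ n ] = begin
    - fromℕ (suc (suc (m ℕ.+ n)))       ≡⟨ ≡.cong (λ k → - fromℕ k) (≡.sym (ℕ.+-suc (suc m) n)) ⟩
    - fromℕ (suc m ℕ.+ suc n)           ≈⟨ -‿cong (×-homo-+ 1# (suc m) (suc n)) ⟩
    - (fromℕ (suc m) + fromℕ (suc n))   ≈⟨ ⁻¹-∙-comm _ _ ⟨
    - fromℕ (suc m) - fromℕ (suc n)     ∎

  fromℤ-neg : ∀ i → fromℤ (ℤ.- i) ≈ - fromℤ i
  fromℤ-neg (+ zero)  = sym -0#≈0#
  fromℤ-neg (+ suc n) = refl
  fromℤ-neg -[1+ n ]  = sym (-‿involutive _)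

  private
    fromℤ-+*+ : ∀ m n → fromℤ (+ m ℤ.* + n) ≈ fromℕ m * fromℕ n
    fromℤ-+*+ m n = trans (reflexive (≡.cong fromℤ (≡.sym (ℤ.pos-* m n)))) (×1-homo-* m n)

    fromℤ-+* : ∀ m j → fromℤ (+ m ℤ.* j) ≈ fromℕ m * fromℤ j
    fromℤ-+* m (+ n)    = fromℤ-+*+ m n
    fromℤ-+* m -[1+ n ] = begin
      fromℤ (+ m ℤ.* -[1+ n ])         ≡⟨ ≡.cong fromℤ (≡.sym (ℤ.neg-distribʳ-* (+ m) (+ suc n))) ⟩
      fromℤ (ℤ.- (+ m ℤ.* + suc n))    ≈⟨ fromℤ-neg (+ m ℤ.* + suc n) ⟩
      - fromℤ (+ m ℤ.* + suc n)        ≈⟨ -‿cong (fromℤ-+*+ m (suc n)) ⟩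
      - (fromℕ m * fromℕ (suc n))      ≈⟨ -‿distribʳ-* _ _ ⟩
      fromℕ m * - fromℕ (suc n)        ∎

  fromℤ-* : ∀ i j → fromℤ (i ℤ.* j) ≈ fromℤ i * fromℤ j
  fromℤ-* (+ m)    j = fromℤ-+* m j
  fromℤ-* -[1+ m ] j = begin
    fromℤ (-[1+ m ] ℤ.* j)           ≡⟨ ≡.cong fromℤ (≡.sym (ℤ.neg-distribˡ-* (+ suc m) j)) ⟩
    fromℤ (ℤ.- (+ suc m ℤ.* j))      ≈⟨ fromℤ-neg (+ suc m ℤ.* j) ⟩
    - fromℤ (+ suc m ℤ.* j)          ≈⟨ -‿cong (fromℤ-+* (suc m) j) ⟩
    - (fromℕ (suc m) * fromℤ j)      ≈⟨ -‿distribˡ-* _ _ ⟩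
    - fromℕ (suc m) * fromℤ j        ∎

  private
    -- Sends 1 to 1# on the nose, which fromℤ does not.
    ⟦_⟧ : ℤ → Carrier
    ⟦ + 1 ⟧ = 1#
    ⟦ i ⟧   = fromℤ i

    ⟦⟧≈ : ∀ i → ⟦ i ⟧ ≈ fromℤ i
    ⟦⟧≈ (+ 0)           = refl
    ⟦⟧≈ (+ 1)           = sym (+-identityʳ 1#)
    ⟦⟧≈ (+ suc (suc n)) = refl
    ⟦⟧≈ -[1+ n ]        = refl

    ℤ⟶R : ℤ.+-*-rawRing -Raw-AlmostCommutative⟶ fromCommutativeRing R
    ℤ⟶R = record
      { ⟦_⟧    = ⟦_⟧
      ; +-homo = λ i j → trans (⟦⟧≈ (i ℤ.+ j)) (trans (fromℤ-+ i j) (sym (+-cong (⟦⟧≈ i) (⟦⟧≈ j))))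
      ; *-homo = λ i j → trans (⟦⟧≈ (i ℤ.* j)) (trans (fromℤ-* i j) (sym (*-cong (⟦⟧≈ i) (⟦⟧≈ j))))
      ; -‿homo = λ i → trans (⟦⟧≈ (ℤ.- i)) (trans (fromℤ-neg i) (sym (-‿cong (⟦⟧≈ i))))
      ; 0-homo = refl
      ; 1-homo = refl
      }

    -- Coefficients are compared in ℤ, so the solver can normalise expressions over rings whose
    -- equality is not decidable.
    _coeff≟_ : ∀ i j → Maybe (⟦ i ⟧ ≈ ⟦ j ⟧)
    i coeff≟ j with i ℤ.≟ j
    ... | yes i≡j = just (reflexive (≡.cong ⟦_⟧ i≡j))
    ... | no  _   = nothing

  open import Algebra.Solver.Ring ℤ.+-*-rawRing (fromCommutativeRing R) ℤ⟶R _coeff≟_ public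
    using (Polynomial; solve; _:=_; con; var; _:+_; _:*_; _:-_; :-_; _:^_)

  :0 :1 : ∀ {n} → Polynomial n
  :0 = con (+ 0)
  :1 = con (+ 1)

open import Data.Product.Base using (_×_; _,_; proj₁; proj₂; Σ-syntax; ∃-syntax)

-- Fields of characteristic 0

module Field where

  -- `inv` is total so that denominators can be written down before they are known to be nonzero.
  -- Decidable equality and characteristic 0 serve the polynomial arguments: splitting on whether a
  -- value vanishes, and having as many distinct points as a degree demands.
  record IsField₀ {c ℓ} (K : CommutativeRing c ℓ) : Set (c ⊔ ℓ) where
    open CommutativeRing K
    open IntSolver K using (fromℕ)
    field
      _≟_      : ∀ x y → Dec (x ≈ y)
      inv      : Carrier → Carrier
      inverseʳ : ∀ x → ¬ x ≈ 0# → x * inv x ≈ 1#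
      char0    : ∀ n → ¬ fromℕ (suc n) ≈ 0#

open Field using (IsField₀)

-- Polynomial functions of one variable and generic conditions on a line

module Poly {c ℓ} (K : CommutativeRing c ℓ) (F : IsField₀ K) where

  open CommutativeRing K hiding (zero)
  open IsField₀ F public
  open import Algebra.Properties.Ring ring using (+-cancelˡ)
  open import Algebra.Properties.Semiring.Mult semiring using (×-homo-+)
  open IntSolver K
  open import Data.Fin.Base using (toℕ)
  open import Data.Fin.Properties using (toℕ-injective)
  open import Data.List.Base as List using (List; _∷_; length)
  open import Data.List.Properties using (length-tabulate)
  open import Data.List.Relation.Unary.All as All using (All; _∷_)
  import Data.List.Relation.Unary.All.Properties as All
  open import Data.List.Relation.Unary.AllPairs as AllPairs using (AllPairs; _∷_)
  import Data.List.Relation.Unary.AllPairs.Properties as AllPairs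
  open import Data.Nat.Base using (s≤s; z≤n)
  open import Relation.Binary.Definitions using (tri<; tri≈; tri>)
  open import Relation.Binary.Reasoning.Setoid setoid

  x-y≈0⇒x≈y : ∀ x y → x - y ≈ 0# → x ≈ y
  x-y≈0⇒x≈y x y e = begin
    x             ≈⟨ solve 2 (λ x y → x := (x :- y) :+ y) refl x y ⟩
    (x - y) + y   ≈⟨ +-congʳ e ⟩
    0# + y        ≈⟨ +-identityˡ y ⟩
    y             ∎

  x*y≈0⇒y≈0 : ∀ {x y} → x ≉ 0# → x * y ≈ 0# → y ≈ 0#
  x*y≈0⇒y≈0 {x} {y} x≉0 xy≈0 = begin
    y                  ≈⟨ *-identityˡ y ⟨
    1# * y             ≈⟨ *-congʳ (inverseʳ x x≉0) ⟨
    x * inv x * y      ≈⟨ solve 3 (λ x i y → x :* i :* y := i :* (x :* y)) refl x (inv x) y ⟩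
    inv x * (x * y)    ≈⟨ *-congˡ xy≈0 ⟩
    inv x * 0#         ≈⟨ zeroʳ _ ⟩
    0#                 ∎

  x*y≉0 : ∀ {x y} → x ≉ 0# → y ≉ 0# → x * y ≉ 0#
  x*y≉0 x≉0 y≉0 xy≈0 = y≉0 (x*y≈0⇒y≈0 x≉0 xy≈0)

  *-cancelˡ : ∀ {x y z} → x ≉ 0# → x * y ≈ x * z → y ≈ z
  *-cancelˡ {x} {y} {z} x≉0 xy≈xz = x-y≈0⇒x≈y y z (x*y≈0⇒y≈0 x≉0 (begin
    x * (y - z)     ≈⟨ solve 3 (λ x y z → x :* (y :- z) := x :* y :- x :* z) refl x y z ⟩
    x * y - x * z   ≈⟨ +-congʳ xy≈xz ⟩
    x * z - x * z   ≈⟨ -‿inverseʳ _ ⟩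
    0#              ∎))

  x≉y⇒x-y≉0 : ∀ {x y} → x ≉ y → x - y ≉ 0#
  x≉y⇒x-y≉0 x≉y x-y≈0 = x≉y (x-y≈0⇒x≈y _ _ x-y≈0)

  fromℕ-< : ∀ {m n} → m ℕ.< n → fromℕ m ≉ fromℕ n
  fromℕ-< {m} {n} m<n e = char0 k (+-cancelˡ (fromℕ m) _ _ (begin
    fromℕ m + fromℕ (suc k)   ≈⟨ ×-homo-+ 1# m (suc k) ⟨
    fromℕ (m ℕ.+ suc k)       ≡⟨ ≡.cong fromℕ (≡.trans (ℕ.+-suc m k) (ℕ.m+[n∸m]≡n m<n)) ⟩
    fromℕ n                   ≈⟨ e ⟨
    fromℕ m                   ≈⟨ +-identityʳ _ ⟨
    fromℕ m + 0#              ∎))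
    where
    k : ℕ
    k = n ℕ.∸ suc m

  fromℕ-injective : ∀ {m n} → fromℕ m ≈ fromℕ n → m ≡ n
  fromℕ-injective {m} {n} e with ℕ.<-cmp m n
  ... | tri≈ _ m≡n _ = m≡n
  ... | tri< m<n _ _ = ⊥-elim (fromℕ-< m<n e)
  ... | tri> _ _ n<m = ⊥-elim (fromℕ-< n<m (sym e))

  -- A polynomial is the function it defines together with a chain of Horner steps, so that state
  -- sums count as polynomials without a syntax of their own. The index is only an upper bound,
  -- since leading coefficients may be 0.
  data Degree≤ : ℕ → (Carrier → Carrier) → Set (c ⊔ ℓ) where
    const : ∀ {f} a → (∀ s → f s ≈ a) → Degree≤ 0 f
    step  : ∀ {d f g} a → Degree≤ d g → (∀ s → f s ≈ a + s * g s) → Degree≤ (suc d) f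

  private
    variable
      d e : ℕ
      f g : Carrier → Carrier

  Degree-resp : (∀ s → g s ≈ f s) → Degree≤ d f → Degree≤ d g
  Degree-resp g≈f (const a f≈)  = const a λ s → trans (g≈f s) (f≈ s)
  Degree-resp g≈f (step a p f≈) = step a p λ s → trans (g≈f s) (f≈ s)

  Degree-const : ∀ d a → Degree≤ d (λ _ → a)
  Degree-const zero    a = const a λ _ → refl
  Degree-const (suc d) a = step a (Degree-const d 0#) λ s →
    sym (trans (+-congˡ (zeroʳ s)) (+-identityʳ a))

  Degree-suc : Degree≤ d f → Degree≤ (suc d) f
  Degree-suc (const a f≈)  = Degree-resp f≈ (Degree-const 1 a)
  Degree-suc (step a p f≈) = step a (Degree-suc p) f≈

  Degree-≤ : d ℕ.≤ e → Degree≤ d f → Degree≤ e f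
  Degree-≤ {e = zero}  z≤n     p = p
  Degree-≤ {e = suc e} z≤n     p = Degree-suc (Degree-≤ z≤n p)
  Degree-≤             (s≤s l) (step a p f≈) = step a (Degree-≤ l p) f≈

  Degree-+ : Degree≤ d f → Degree≤ d g → Degree≤ d (λ s → f s + g s)
  Degree-+ (const a f≈)  (const b g≈)  = const (a + b) λ s → +-cong (f≈ s) (g≈ s)
  Degree-+ (step a p f≈) (step b q g≈) = step (a + b) (Degree-+ p q) λ s →
    trans (+-cong (f≈ s) (g≈ s))
          (solve 5 (λ a b s x y → (a :+ s :* x) :+ (b :+ s :* y) := (a :+ b) :+ s :* (x :+ y)) refl a b s _ _)

  Degree-scale : ∀ r → Degree≤ d f → Degree≤ d (λ s → r * f s)
  Degree-scale r (const a f≈)  = const (r * a) λ s → *-congˡ (f≈ s)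
  Degree-scale r (step a p f≈) = step (r * a) (Degree-scale r p) λ s →
    trans (*-congˡ (f≈ s)) (solve 4 (λ r a s x → r :* (a :+ s :* x) := r :* a :+ s :* (r :* x)) refl r a s _)

  Degree-* : Degree≤ d f → Degree≤ e g → Degree≤ (d ℕ.+ e) (λ s → f s * g s)
  Degree-* {e = e} (const a f≈) q = Degree-resp (λ s → *-congʳ (f≈ s)) (Degree-scale a q)
  Degree-* {g = g} (step {d = d} {g = f′} a p f≈) q = Degree-resp
    (λ s → trans (*-congʳ (f≈ s))
      (trans (solve 4 (λ a s x y → (a :+ s :* x) :* y := a :* y :+ (:0 :+ s :* (x :* y))) refl a s _ _) refl))
    (Degree-+ (Degree-≤ (ℕ.m≤n+m _ _) (Degree-scale a q)) (step 0# (Degree-* p q) λ s → refl))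

  Degree-linear : ∀ a b → Degree≤ 1 (λ s → a * s + b)
  Degree-linear a b = step b (Degree-const 0 a) λ s → trans (+-comm _ _) (+-congˡ (*-comm a s))

  -- Synthetic division: g(s) = g(a) + (s - a) h(s) gives s g(s) = a g(a) + (s - a)(g(a) + s h(s)).
  -- Degree 1 is a separate case because there g is constant and is itself the quotient.
  factor : Degree≤ (suc d) f → ∀ a → ∃[ g ] Degree≤ d g × (∀ s → f s ≈ f a + (s - a) * g s)
  factor {f = f} (step {g = g} b (const r g≈) f≈) a = (λ _ → r) , Degree-const 0 r , λ s → begin
    f s                       ≈⟨ f≈ s ⟩
    b + s * g s               ≈⟨ +-congˡ (*-congˡ (g≈ s)) ⟩
    b + s * r                 ≈⟨ solve 4 (λ b s r a → b :+ s :* r := (b :+ a :* r) :+ (s :- a) :* r) refl b s r a ⟩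
    (b + a * r) + (s - a) * r ≈⟨ +-congʳ (trans (f≈ a) (+-congˡ (*-congˡ (g≈ a)))) ⟨
    f a + (s - a) * r         ∎
  factor {f = f} (step {g = g} b p@(step _ _ _) f≈) a with h , q , g≈ ← factor p a =
    (λ s → g a + s * h s) , step (g a) q (λ _ → refl) , λ s → begin
    f s                                         ≈⟨ f≈ s ⟩
    b + s * g s                                 ≈⟨ +-congˡ (*-congˡ (g≈ s)) ⟩
    b + s * (g a + (s - a) * h s)               ≈⟨ solve 5 (λ b s x a y →
        b :+ s :* (x :+ (s :- a) :* y) := (b :+ a :* x) :+ (s :- a) :* (x :+ s :* y)) refl b s (g a) a (h s) ⟩
    (b + a * g a) + (s - a) * (g a + s * h s)   ≈⟨ +-congʳ (f≈ a) ⟨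
    f a + (s - a) * (g a + s * h s)             ∎

  -- Dividing by s - a keeps the other roots, as that factor does not vanish at them, and lowers the
  -- degree by one.
  manyRoots : Degree≤ d f → ∀ as → AllPairs _≉_ as → All (λ a → f a ≈ 0#) as →
              d ℕ.< length as → ∀ s → f s ≈ 0#
  manyRoots (const b f≈) (a ∷ _) _ (fa≈0 ∷ _) _ s = trans (f≈ s) (trans (sym (f≈ a)) fa≈0)
  manyRoots {f = f} p@(step _ _ _) (a ∷ as) (a≉as ∷ as≉) (fa≈0 ∷ fas≈0) (s≤s d<as) s
    with g , q , f≈ ← factor p a = begin
    f s                  ≈⟨ f≈′ s ⟩
    (s - a) * g s        ≈⟨ *-congˡ (manyRoots q as as≉ (All.map root (All.zip (a≉as , fas≈0))) d<as s) ⟩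
    (s - a) * 0#         ≈⟨ zeroʳ _ ⟩
    0#                   ∎
    where
    f≈′ : ∀ s → f s ≈ (s - a) * g s
    f≈′ s = trans (f≈ s) (trans (+-congʳ fa≈0) (+-identityˡ _))
    root : ∀ {b} → a ≉ b × f b ≈ 0# → g b ≈ 0#
    root {b} (a≉b , fb≈0) =
      x*y≈0⇒y≈0 (x≉y⇒x-y≉0 λ b≈a → a≉b (sym b≈a)) (trans (sym (f≈′ b)) fb≈0)

  -- In characteristic 0 the numbers 1, ..., d+1 are distinct and nonzero, one root more than the
  -- degree allows.
  zeroAwayFrom0 : Degree≤ d f → (∀ s → s ≉ 0# → f s ≈ 0#) → ∀ s → f s ≈ 0#
  zeroAwayFrom0 {d = d} {f = f} p f≈0 = manyRoots p
    (List.tabulate point)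
    (AllPairs.tabulate⁺ λ i≢j e → i≢j (toℕ-injective (ℕ.suc-injective (fromℕ-injective e))))
    (All.tabulate⁺ λ i → f≈0 _ (char0 (toℕ i)))
    (ℕ.≤-reflexive (≡.sym (length-tabulate point)))
    where
    point : Fin (suc d) → Carrier
    point i = fromℕ (suc (toℕ i))

  -- The absence of zero divisors among polynomials, seen through values: g(0) ≠ 0 forces f(0) = 0,
  -- so f(s) = s f′(s), and g f′ vanishes away from 0, hence everywhere. The induction continues
  -- with f′.
  zeroFactor : Degree≤ d f → Degree≤ e g → g 0# ≉ 0# → (∀ s → g s * f s ≈ 0#) → ∀ s → f s ≈ 0#
  zeroFactor {g = g} (const a f≈) q g0≉0 gf≈0 s =
    trans (f≈ s) (trans (sym (f≈ 0#)) (x*y≈0⇒y≈0 g0≉0 (gf≈0 0#)))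
  zeroFactor {f = f} {g = g} (step {g = f′} a p f≈) q g0≉0 gf≈0 s =
    trans (f≈sf′ s) (trans (*-congˡ (zeroFactor p q g0≉0 gf′≈0 s)) (zeroʳ s))
    where
    a≈0 : a ≈ 0#
    a≈0 = begin
      a                 ≈⟨ solve 2 (λ a x → a :+ :0 :* x := a) refl a (f′ 0#) ⟨
      a + 0# * f′ 0#    ≈⟨ f≈ 0# ⟨
      f 0#              ≈⟨ x*y≈0⇒y≈0 g0≉0 (gf≈0 0#) ⟩
      0#                ∎
    f≈sf′ : ∀ s → f s ≈ s * f′ s
    f≈sf′ s = trans (f≈ s) (trans (+-congʳ a≈0) (+-identityˡ _))
    gf′≈0 : ∀ s → g s * f′ s ≈ 0#
    gf′≈0 = zeroAwayFrom0 (Degree-* q p) λ s s≉0 → x*y≈0⇒y≈0 s≉0 (begin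
      s * (g s * f′ s)   ≈⟨ solve 3 (λ s x y → s :* (x :* y) := x :* (s :* y)) refl s (g s) (f′ s) ⟩
      g s * (s * f′ s)   ≈⟨ *-congˡ (f≈sf′ s) ⟨
      g s * f s          ≈⟨ gf≈0 s ⟩
      0#                 ∎)

  IsPolynomial : (Carrier → Carrier) → Set (c ⊔ ℓ)
  IsPolynomial f = ∃[ d ] Degree≤ d f

  poly-resp : (∀ s → g s ≈ f s) → IsPolynomial f → IsPolynomial g
  poly-resp g≈f (d , p) = d , Degree-resp g≈f p

  poly-const : ∀ a → IsPolynomial (λ _ → a)
  poly-const a = 0 , Degree-const 0 a

  poly-id : IsPolynomial (λ s → s)
  poly-id = 1 , Degree-resp (λ s → solve 1 (λ s → s := :1 :* s :+ :0) refl s) (Degree-linear 1# 0#)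

  poly-+ : IsPolynomial f → IsPolynomial g → IsPolynomial (λ s → f s + g s)
  poly-+ (d , p) (e , q) = d ℕ.⊔ e ,
    Degree-+ (Degree-≤ (ℕ.m≤m⊔n d e) p) (Degree-≤ (ℕ.m≤n⊔m d e) q)

  poly-* : IsPolynomial f → IsPolynomial g → IsPolynomial (λ s → f s * g s)
  poly-* (d , p) (e , q) = d ℕ.+ e , Degree-* p q

  poly-neg : IsPolynomial f → IsPolynomial (λ s → - f s)
  poly-neg (d , p) = d , Degree-resp (λ s → solve 1 (λ a → :- a := (:- :1) :* a) refl _) (Degree-scale (- 1#) p)

  -- A Zariski-open condition on the line that holds at 0. Asking for a witness that is nonzero at
  -- this fixed point, rather than somewhere, lets conjunctions be witnessed by products.
  Generically : ∀ {p} → (Carrier → Set p) → Set (c ⊔ ℓ ⊔ p)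
  Generically Φ = ∃[ g ] IsPolynomial g × g 0# ≉ 0# × (∀ s → g s ≉ 0# → Φ s)

  private
    variable
      p q : Level
      Φ : Carrier → Set p
      Ψ : Carrier → Set q

  1≉0 : 1# ≉ 0#
  1≉0 e = char0 0 (trans (+-identityʳ 1#) e)

  generically-≉0 : IsPolynomial f → f 0# ≉ 0# → Generically (λ s → f s ≉ 0#)
  generically-≉0 {f} p f0≉0 = f , p , f0≉0 , λ s fs≉0 → fs≉0

  generically-always : (∀ s → Φ s) → Generically Φ
  generically-always h = (λ _ → 1#) , poly-const 1# , 1≉0 , λ s _ → h s

  generically-× : Generically Φ → Generically Ψ → Generically (λ s → Φ s × Ψ s)
  generically-× (f , p , f0 , h) (g , q , g0 , k) =
    (λ s → f s * g s) , poly-* p q , x*y≉0 f0 g0 ,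
    λ s fg≉0 → h s (λ e → fg≉0 (trans (*-congʳ e) (zeroˡ _))) , k s (λ e → fg≉0 (trans (*-congˡ e) (zeroʳ _)))

  generically-map : (∀ s → Φ s → Ψ s) → Generically Φ → Generically Ψ
  generically-map h (g , p , g0 , k) = g , p , g0 , λ s gs≉0 → h s (k s gs≉0)

  generically-∀ : ∀ {n} {Φ : Fin n → Carrier → Set p} → (∀ i → Generically (Φ i)) →
                  Generically (λ s → ∀ i → Φ i s)
  generically-∀ {n = zero}  h = generically-always λ s ()
  generically-∀ {n = suc n} h = generically-map
    (λ { s (a , b) zero → a ; s (a , b) (suc i) → b i })
    (generically-× (h zero) (generically-∀ λ i → h (suc i)))

  generically-≈0 : IsPolynomial f → Generically (λ s → f s ≈ 0#) → ∀ s → f s ≈ 0#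
  generically-≈0 {f} (d , p) (g , (e , q) , g0≉0 , h) = zeroFactor p q g0≉0 gf≈0
    where
    gf≈0 : ∀ s → g s * f s ≈ 0#
    gf≈0 s with g s ≟ 0#
    ... | yes gs≈0 = trans (*-congʳ gs≈0) (zeroˡ _)
    ... | no  gs≉0 = trans (*-congˡ (h s gs≉0)) (zeroʳ _)

-- State sums of the six-vertex model and transposition

module SixVertex {c ℓ} (R : CommutativeRing c ℓ) where

  open CommutativeRing R hiding (zero)
  open IntSolver R
  open import Relation.Binary.Reasoning.Setoid setoid

  private
    variable
      α β α′ β′ : Level
      I : Set α
      J : Set β
      I′ : Set α′
      J′ : Set β′
      m n : ℕ

  -- The weights of a vertex, classified by the partial sums of its row and of its
  -- column before the vertex: a₁ if both are 1, a₂ if both are 0, b if they differ,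
  -- as long as the entry is 0. An entry 1 has weight 1 and an entry -1 has weight c₋.
  record Weights : Set c where
    constructor weights
    field
      a₁ a₂ b c₋ : Carrier

  open Weights public

  infix 4 _≈ʷ_

  _≈ʷ_ : Weights → Weights → Set ℓ
  v ≈ʷ w = a₁ v ≈ a₁ w × a₂ v ≈ a₂ w × b v ≈ b w × c₋ v ≈ c₋ w

  -- The state sums are written in continuation-passing style: k is the weight of
  -- the rest of the matrix, as a function of the partial sums after the part read.
  vertex : Weights → Bool → Bool → (Bool → Bool → Carrier) → Carrier
  vertex w false false k = a₂ w * k false false + k true true
  vertex w false true  k = b w * k false true
  vertex w true  false k = b w * k true false
  vertex w true  true  k = a₁ w * k true true + c₋ w * k false false

  row : (J → Weights) → Vec J n → Bool → Vec Bool n → (Bool → Vec Bool n → Carrier) → Carrier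
  row ω []       h []       k = k h []
  row ω (j ∷ js) h (s ∷ ss) k =
    vertex (ω j) h s λ h′ s′ → row ω js h′ ss λ h″ ss′ → k h″ (s′ ∷ ss′)

  whenTrue : {A : Set α} → (A → Carrier) → Bool → A → Carrier
  whenTrue k true  s = k s
  whenTrue k false s = 0#

  rows : (I → J → Weights) → Vec I m → Vec J n → Vec Bool n → (Vec Bool n → Carrier) → Carrier
  rows ω []       js s k = k s
  rows ω (i ∷ is) js s k = row (ω i) js false s (whenTrue λ s′ → rows ω is js s′ k)

  allTrue : Vec Bool n → Carrier
  allTrue []          = 1#
  allTrue (true ∷ s)  = allTrue s
  allTrue (false ∷ s) = 0#

  falses : ∀ n → Vec Bool n
  falses n = replicate n false

  partition : (I → J → Weights) → Vec I m → Vec J n → Carrier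
  partition {n = n} ω is js = rows ω is js (falses n) allTrue

  ∏ : (J → Carrier) → Vec J n → Carrier
  ∏ f []       = 1#
  ∏ f (j ∷ js) = f j * ∏ f js

  vertex-cong : ∀ {v w} → v ≈ʷ w → ∀ h s {k l} → (∀ h s → k h s ≈ l h s) →
                vertex v h s k ≈ vertex w h s l
  vertex-cong (p , q , r , t) false false e = +-cong (*-cong q (e _ _)) (e _ _)
  vertex-cong (p , q , r , t) false true  e = *-cong r (e _ _)
  vertex-cong (p , q , r , t) true  false e = *-cong r (e _ _)
  vertex-cong (p , q , r , t) true  true  e = +-cong (*-cong p (e _ _)) (*-cong t (e _ _))

  ≈ʷ-refl : ∀ {w} → w ≈ʷ w
  ≈ʷ-refl = refl , refl , refl , refl

  vertex-congʳ : ∀ w h s {k l} → (∀ h s → k h s ≈ l h s) → vertex w h s k ≈ vertex w h s l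
  vertex-congʳ w = vertex-cong ≈ʷ-refl

  row-cong : ∀ {ω : J → Weights} {ω′ : J′ → Weights} (js : Vec J n) (js′ : Vec J′ n) →
             (∀ q → ω (lookup js q) ≈ʷ ω′ (lookup js′ q)) →
             ∀ h s {k l} → (∀ h s → k h s ≈ l h s) → row ω js h s k ≈ row ω′ js′ h s l
  row-cong []       []         _   h []       e = e h []
  row-cong (j ∷ js) (j′ ∷ js′) ω≈ω′ h (s ∷ ss) e =
    vertex-cong (ω≈ω′ zero) h s λ h′ s′ →
      row-cong js js′ (λ q → ω≈ω′ (suc q)) h′ ss λ h″ ss′ → e h″ (s′ ∷ ss′)

  row-congʳ : ∀ {ω : J → Weights} (js : Vec J n) h s {k l} → (∀ h s → k h s ≈ l h s) →
              row ω js h s k ≈ row ω js h s l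
  row-congʳ js = row-cong js js λ _ → ≈ʷ-refl

  whenTrue-cong : {A : Set α} {k l : A → Carrier} → (∀ s → k s ≈ l s) →
                  ∀ h s → whenTrue k h s ≈ whenTrue l h s
  whenTrue-cong e true  s = e s
  whenTrue-cong e false s = refl

  rows-cong : ∀ {ω : I → J → Weights} {ω′ : I′ → J′ → Weights}
              (is : Vec I m) (is′ : Vec I′ m) (js : Vec J n) (js′ : Vec J′ n) →
              (∀ p q → ω (lookup is p) (lookup js q) ≈ʷ ω′ (lookup is′ p) (lookup js′ q)) →
              ∀ s {k l} → (∀ s → k s ≈ l s) → rows ω is js s k ≈ rows ω′ is′ js′ s l
  rows-cong []       []         js js′ _    s e = e s
  rows-cong (i ∷ is) (i′ ∷ is′) js js′ ω≈ω′ s e =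
    row-cong js js′ (ω≈ω′ zero) false s (whenTrue-cong λ s′ →
      rows-cong is is′ js js′ (λ p → ω≈ω′ (suc p)) s′ e)

  rows-congʳ : ∀ {ω : I → J → Weights} (is : Vec I m) (js : Vec J n) s {k l} →
               (∀ s → k s ≈ l s) → rows ω is js s k ≈ rows ω is js s l
  rows-congʳ is js = rows-cong is is js js λ _ _ → ≈ʷ-refl

  partition-cong : ∀ {ω : I → J → Weights} {ω′ : I′ → J′ → Weights}
                   (is : Vec I m) (is′ : Vec I′ m) (js : Vec J n) (js′ : Vec J′ n) →
                   (∀ p q → ω (lookup is p) (lookup js q) ≈ʷ ω′ (lookup is′ p) (lookup js′ q)) →
                   partition ω is js ≈ partition ω′ is′ js′
  partition-cong is is′ js js′ e = rows-cong is is′ js js′ e _ λ _ → refl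

  ∏-cong : ∀ {f : J → Carrier} {g : J′ → Carrier} (js : Vec J n) (js′ : Vec J′ n) →
           (∀ q → f (lookup js q) ≈ g (lookup js′ q)) → ∏ f js ≈ ∏ g js′
  ∏-cong []       []         e = refl
  ∏-cong (j ∷ js) (j′ ∷ js′) e = *-cong (e zero) (∏-cong js js′ λ q → e (suc q))

  private
    distrib₂ : ∀ a b x y u v → a * (x + u) + b * (y + v) ≈ (a * x + b * y) + (a * u + b * v)
    distrib₂ = solve 6 (λ a b x y u v →
      a :* (x :+ u) :+ b :* (y :+ v) := (a :* x :+ b :* y) :+ (a :* u :+ b :* v)) refl

    distrib₁ : ∀ a x y u v → a * (x + u) + (y + v) ≈ (a * x + y) + (a * u + v)
    distrib₁ = solve 5 (λ a x y u v →
      a :* (x :+ u) :+ (y :+ v) := (a :* x :+ y) :+ (a :* u :+ v)) refl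

    scale₂ : ∀ a b x y r → a * (r * x) + b * (r * y) ≈ r * (a * x + b * y)
    scale₂ = solve 5 (λ a b x y r →
      a :* (r :* x) :+ b :* (r :* y) := r :* (a :* x :+ b :* y)) refl

    scale₁ : ∀ a x y r → a * (r * x) + r * y ≈ r * (a * x + y)
    scale₁ = solve 4 (λ a x y r → a :* (r :* x) :+ r :* y := r :* (a :* x :+ y)) refl

    scale₀ : ∀ a x r → a * (r * x) ≈ r * (a * x)
    scale₀ = solve 3 (λ a x r → a :* (r :* x) := r :* (a :* x)) refl

  vertex-+ : ∀ w h s k l →
             vertex w h s (λ h s → k h s + l h s) ≈ vertex w h s k + vertex w h s l
  vertex-+ w false false k l = distrib₁ _ _ _ _ _
  vertex-+ w false true  k l = distribˡ _ _ _
  vertex-+ w true  false k l = distribˡ _ _ _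
  vertex-+ w true  true  k l = distrib₂ _ _ _ _ _ _

  vertex-* : ∀ w h s r k → vertex w h s (λ h s → r * k h s) ≈ r * vertex w h s k
  vertex-* w false false r k = scale₁ _ _ _ _
  vertex-* w false true  r k = scale₀ _ _ _
  vertex-* w true  false r k = scale₀ _ _ _
  vertex-* w true  true  r k = scale₂ _ _ _ _ _

  row-+ : ∀ (ω : J → Weights) (js : Vec J n) h s k l →
          row ω js h s (λ h s → k h s + l h s) ≈ row ω js h s k + row ω js h s l
  row-+ ω []       h []       k l = refl
  row-+ ω (j ∷ js) h (s ∷ ss) k l = trans
    (vertex-congʳ (ω j) h s λ h′ s′ → row-+ ω js h′ ss _ _)
    (vertex-+ (ω j) h s _ _)

  row-* : ∀ (ω : J → Weights) (js : Vec J n) h s r k →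
          row ω js h s (λ h s → r * k h s) ≈ r * row ω js h s k
  row-* ω []       h []       r k = refl
  row-* ω (j ∷ js) h (s ∷ ss) r k = trans
    (vertex-congʳ (ω j) h s λ h′ s′ → row-* ω js h′ ss r _)
    (vertex-* (ω j) h s r _)

  row-0 : ∀ {ω : J → Weights} (js : Vec J n) h s {k} → (∀ h s → k h s ≈ 0#) → row ω js h s k ≈ 0#
  row-0 {ω = ω} js h s {k} k≈0 = begin
    row ω js h s k                   ≈⟨ row-congʳ js h s (λ h s → trans (k≈0 h s) (sym (zeroˡ _))) ⟩
    row ω js h s (λ h s → 0# * k h s) ≈⟨ row-* ω js h s 0# k ⟩
    0# * row ω js h s k              ≈⟨ zeroˡ _ ⟩
    0#                               ∎

  flipʷ : (I → J → Weights) → J → I → Weights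
  flipʷ ω j i = ω i j

  -- Both mixed states carry the weight `b`, so a vertex does not distinguish its row from its
  -- column.
  vertex-transpose : ∀ w h s k → vertex w h s k ≈ vertex w s h (λ s h → k h s)
  vertex-transpose w false false k = refl
  vertex-transpose w false true  k = refl
  vertex-transpose w true  false k = refl
  vertex-transpose w true  true  k = refl

  -- A vertex is a fixed linear combination of values of its continuation and so commutes with every
  -- linear functional. Reading a row elsewhere in the lattice is such a functional, and so is the
  -- exchange of two columns.
  vertex-linear : ∀ {A : Set α} (L : (A → Carrier) → Carrier) →
                  (∀ k l → L (λ a → k a + l a) ≈ L k + L l) →
                  (∀ r k → L (λ a → r * k a) ≈ r * L k) →
                  ∀ w h s (k : Bool → Bool → A → Carrier) →
                  vertex w h s (λ h s → L (k h s)) ≈ L (λ a → vertex w h s (λ h s → k h s a))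
  vertex-linear L L-+ L-* w false false k = sym (trans (L-+ _ _) (+-congʳ (L-* _ _)))
  vertex-linear L L-+ L-* w false true  k = sym (L-* _ _)
  vertex-linear L L-+ L-* w true  false k = sym (L-* _ _)
  vertex-linear L L-+ L-* w true  true  k = sym (trans (L-+ _ _) (+-cong (L-* _ _) (L-* _ _)))

  vertex-comm-row : ∀ w h s (ω : J → Weights) (js : Vec J n) g t
                    (k : Bool → Bool → Bool → Vec Bool n → Carrier) →
    vertex w h s (λ h s → row ω js g t (k h s)) ≈
    row ω js g t (λ g t → vertex w h s (λ h s → k h s g t))
  vertex-comm-row w h s ω js g t k = vertex-linear
    (λ f → row ω js g t λ g t → f (g , t))
    (λ k l → row-+ ω js g t _ _) (λ r k → row-* ω js g t r _)
    w h s (λ h s (g , t) → k h s g t)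

  row-comm-row : ∀ (ω : J → Weights) (js : Vec J n) h s
                 (ω′ : J′ → Weights) (js′ : Vec J′ m) g t
                 (k : Bool → Vec Bool n → Bool → Vec Bool m → Carrier) →
    row ω js h s (λ h s → row ω′ js′ g t (k h s)) ≈
    row ω′ js′ g t (λ g t → row ω js h s (λ h s → k h s g t))
  row-comm-row ω []       h []       ω′ js′ g t k = refl
  row-comm-row ω (j ∷ js) h (s ∷ ss) ω′ js′ g t k = trans
    (vertex-congʳ (ω j) h s λ h′ s′ → row-comm-row ω js h′ ss ω′ js′ g t _)
    (vertex-comm-row (ω j) h s ω′ js′ g t _)

  -- The row sums at both ends stay arbitrary, as the column sums do. This symmetry, which `rows`
  -- lacks, lets an induction turn rows into columns.
  grid : (I → J → Weights) → Vec I m → Vec J n → Vec Bool m → Vec Bool n →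
         (Vec Bool m → Vec Bool n → Carrier) → Carrier
  grid ω []       js []      t k = k [] t
  grid ω (i ∷ is) js (h ∷ l) t k =
    row (ω i) js h t λ h′ t′ → grid ω is js l t′ λ r u → k (h′ ∷ r) u

  grid-cong : ∀ (ω : I → J → Weights) (is : Vec I m) (js : Vec J n) l t {k k′} →
              (∀ r u → k r u ≈ k′ r u) → grid ω is js l t k ≈ grid ω is js l t k′
  grid-cong ω []       js []      t e = e [] t
  grid-cong ω (i ∷ is) js (h ∷ l) t e =
    row-congʳ js h t λ h′ t′ → grid-cong ω is js l t′ λ r u → e (h′ ∷ r) u

  grid-0 : ∀ (ω : I → J → Weights) (is : Vec I m) (js : Vec J n) l t {k} →
           (∀ r u → k r u ≈ 0#) → grid ω is js l t k ≈ 0#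
  grid-0 ω []       js []      t e = e [] t
  grid-0 ω (i ∷ is) js (h ∷ l) t e =
    row-0 js h t λ h′ t′ → grid-0 ω is js l t′ λ r u → e (h′ ∷ r) u

  -- The rest of a row and the part of the first column below that row share no edge, so they may be
  -- read in either order.
  grid-column : ∀ (ω : I → J → Weights) (is : Vec I m) j (js : Vec J n) l s t k →
    grid ω is (j ∷ js) l (s ∷ t) k ≈
    row (flipʷ ω j) is s l (λ s′ l′ → grid ω is js l′ t (λ r u → k r (s′ ∷ u)))
  grid-column ω []       j js []      s t k = refl
  grid-column ω (i ∷ is) j js (h ∷ l) s t k = begin
    vertex (ω i j) h s (λ h′ s′ → row (ω i) js h′ t (λ h″ t′ →
      grid ω is (j ∷ js) l (s′ ∷ t′) (λ r u → k (h″ ∷ r) u)))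
        ≈⟨ vertex-congʳ (ω i j) h s (λ h′ s′ → row-congʳ js h′ t λ h″ t′ → grid-column ω is j js l s′ t′ _) ⟩
    vertex (ω i j) h s (λ h′ s′ → row (ω i) js h′ t (λ h″ t′ →
      row (flipʷ ω j) is s′ l (λ s″ l′ → grid ω is js l′ t′ (λ r u → k (h″ ∷ r) (s″ ∷ u)))))
        ≈⟨ vertex-congʳ (ω i j) h s (λ h′ s′ → row-comm-row (ω i) js h′ t (flipʷ ω j) is s′ l _) ⟩
    vertex (ω i j) h s (λ h′ s′ → row (flipʷ ω j) is s′ l (λ s″ l′ →
      row (ω i) js h′ t (λ h″ t′ → grid ω is js l′ t′ (λ r u → k (h″ ∷ r) (s″ ∷ u)))))
        ≈⟨ vertex-transpose (ω i j) h s _ ⟩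
    vertex (ω i j) s h (λ s′ h′ → row (flipʷ ω j) is s′ l (λ s″ l′ →
      row (ω i) js h′ t (λ h″ t′ → grid ω is js l′ t′ (λ r u → k (h″ ∷ r) (s″ ∷ u))))) ∎

  grid-noColumns : ∀ (ω : I → J → Weights) (is : Vec I m) l k → grid ω is [] l [] k ≈ k l []
  grid-noColumns ω []       []      k = refl
  grid-noColumns ω (i ∷ is) (h ∷ l) k = grid-noColumns ω is l λ r u → k (h ∷ r) u

  grid-transpose : ∀ (ω : I → J → Weights) (is : Vec I m) (js : Vec J n) l t k →
    grid ω is js l t k ≈ grid (flipʷ ω) js is t l (λ u r → k r u)
  grid-transpose ω is []       l []      k = grid-noColumns ω is l k
  grid-transpose ω is (j ∷ js) l (s ∷ t) k = trans (grid-column ω is j js l s t k)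
    (row-congʳ is s l λ s′ l′ → grid-transpose ω is js l′ t λ r u → k r (s′ ∷ u))

  rows-grid : ∀ (ω : I → J → Weights) (is : Vec I m) (js : Vec J n) s k →
    rows ω is js s k ≈ grid ω is js (falses m) s (λ r u → allTrue r * k u)
  rows-grid ω []       js s k = sym (*-identityˡ _)
  rows-grid ω (i ∷ is) js s k = row-congʳ js false s λ
    { true  s′ → rows-grid ω is js s′ k
    ; false s′ → sym (grid-0 ω is js _ s′ λ r u → zeroˡ _)
    }

  partition-transpose : ∀ (ω : I → J → Weights) (is : Vec I m) (js : Vec J n) →
    partition ω is js ≈ partition (flipʷ ω) js is
  partition-transpose {m = m} {n = n} ω is js = begin
    partition ω is js
      ≈⟨ rows-grid ω is js _ _ ⟩
    grid ω is js (falses m) (falses n) (λ r u → allTrue r * allTrue u)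
      ≈⟨ grid-transpose ω is js _ _ _ ⟩
    grid (flipʷ ω) js is (falses n) (falses m) (λ u r → allTrue r * allTrue u)
      ≈⟨ grid-cong (flipʷ ω) js is _ _ (λ u r → *-comm _ _) ⟩
    grid (flipʷ ω) js is (falses n) (falses m) (λ u r → allTrue u * allTrue r)
      ≈⟨ rows-grid (flipʷ ω) js is _ _ ⟨
    partition (flipʷ ω) js is ∎

-- Frozen lines, and the dependence on a corner weight

module Corners {c ℓ} (R : CommutativeRing c ℓ) where

  open CommutativeRing R hiding (zero)
  open IntSolver R
  open SixVertex R
  open import Data.Bool.Base using (not)
  open import Data.Vec.Base using (init; last; initLast)
  open import Data.Vec.Properties using (init-∷ʳ; last-∷ʳ)
  open import Relation.Binary.Reasoning.Setoid setoid

  private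
    variable
      α β α′ β′ : Level
      I : Set α
      J : Set β
      I′ : Set α′
      J′ : Set β′
      m n : ℕ

  rows-+ : ∀ (ω : I → J → Weights) (is : Vec I m) (js : Vec J n) s k l →
           rows ω is js s (λ s → k s + l s) ≈ rows ω is js s k + rows ω is js s l
  rows-+ ω []       js s k l = refl
  rows-+ ω (i ∷ is) js s k l = trans
    (row-congʳ js false s λ
      { true  s′ → rows-+ ω is js s′ k l
      ; false s′ → sym (+-identityˡ 0#) })
    (row-+ (ω i) js false s _ _)

  rows-* : ∀ (ω : I → J → Weights) (is : Vec I m) (js : Vec J n) s r k →
           rows ω is js s (λ s → r * k s) ≈ r * rows ω is js s k
  rows-* ω []       js s r k = refl
  rows-* ω (i ∷ is) js s r k = trans
    (row-congʳ js false s λ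
      { true  s′ → rows-* ω is js s′ r k
      ; false s′ → sym (zeroʳ r) })
    (row-* (ω i) js false s r _)

  rows-0 : ∀ {ω : I → J → Weights} (is : Vec I m) (js : Vec J n) s {k} → (∀ s → k s ≈ 0#) →
           rows ω is js s k ≈ 0#
  rows-0 []       js s k≈0 = k≈0 s
  rows-0 (i ∷ is) js s k≈0 = row-0 js false s λ
    { true  s′ → rows-0 is js s′ k≈0
    ; false s′ → refl }

  rows-∷ʳ : ∀ (ω : I → J → Weights) (is : Vec I m) i (js : Vec J n) s k →
            rows ω (is ∷ʳ i) js s k ≈
            rows ω is js s (λ s → row (ω i) js false s (whenTrue k))
  rows-∷ʳ ω []        i js s k = refl
  rows-∷ʳ ω (i′ ∷ is) i js s k = row-congʳ js false s (whenTrue-cong λ s′ → rows-∷ʳ ω is i js s′ k)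

  row-∷ʳ : ∀ (ω : J → Weights) (js : Vec J n) j h (s : Vec Bool n) t k →
           row ω (js ∷ʳ j) h (s ∷ʳ t) k ≈
           row ω js h s (λ h s → vertex (ω j) h t (λ h t → k h (s ∷ʳ t)))
  row-∷ʳ ω []        j h []       t k = refl
  row-∷ʳ ω (j′ ∷ js) j h (s ∷ ss) t k =
    vertex-congʳ (ω j′) h s λ h′ s′ → row-∷ʳ ω js j h′ ss t _

  falses-∷ʳ : ∀ n → falses (suc n) ≡ falses n ∷ʳ false
  falses-∷ʳ zero    = ≡.refl
  falses-∷ʳ (suc n) = ≡.cong (false ∷_) (falses-∷ʳ n)

  allTrue-∷ʳ-true : ∀ (s : Vec Bool n) → allTrue (s ∷ʳ true) ≈ allTrue s
  allTrue-∷ʳ-true []          = refl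
  allTrue-∷ʳ-true (true ∷ s)  = allTrue-∷ʳ-true s
  allTrue-∷ʳ-true (false ∷ s) = refl

  allTrue-∷ʳ-false : ∀ (s : Vec Bool n) → allTrue (s ∷ʳ false) ≈ 0#
  allTrue-∷ʳ-false []          = refl
  allTrue-∷ʳ-false (true ∷ s)  = allTrue-∷ʳ-false s
  allTrue-∷ʳ-false (false ∷ s) = refl

  private
    *0 : ∀ {x y} → y ≈ 0# → x * y ≈ 0#
    *0 y≈0 = trans (*-congˡ y≈0) (zeroʳ _)

    +0 : ∀ {x y} → y ≈ 0# → x + y ≈ x
    +0 y≈0 = trans (+-congˡ y≈0) (+-identityʳ _)

    0+ : ∀ {x y} → x ≈ 0# → x + y ≈ y
    0+ x≈0 = trans (+-congʳ x≈0) (+-identityˡ _)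

  -- An entry -1 needs a column sum of 1 and an entry 1 needs a row sum of 0, so only zeros of type
  -- `b` can follow.
  row-true-falses : ∀ (ω : J → Weights) (js : Vec J n) k →
                    row ω js true (falses n) k ≈ ∏ (λ j → b (ω j)) js * k true (falses n)
  row-true-falses ω []       k = sym (*-identityˡ _)
  row-true-falses ω (j ∷ js) k =
    trans (*-congˡ (row-true-falses ω js _)) (sym (*-assoc _ _ _))

  -- By the previous lemma an entry 1 could not be undone before the end of the row, where `k`
  -- vanishes.
  row-false-falses : ∀ (ω : J → Weights) (js : Vec J n) k → (∀ s → k true s ≈ 0#) →
                     row ω js false (falses n) k ≈ ∏ (λ j → a₂ (ω j)) js * k false (falses n)
  row-false-falses ω []       k k≈0 = sym (*-identityˡ _)
  row-false-falses {n = suc n} ω (j ∷ js) k k≈0 = begin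
    a₂ (ω j) * row ω js false (falses n) (λ h s → k h (false ∷ s))
      + row ω js true (falses n) (λ h s → k h (true ∷ s))
        ≈⟨ +0 (trans (row-true-falses ω js _) (*0 (k≈0 _))) ⟩
    a₂ (ω j) * row ω js false (falses n) (λ h s → k h (false ∷ s))
        ≈⟨ *-congˡ (row-false-falses ω js _ (λ s → k≈0 (false ∷ s))) ⟩
    a₂ (ω j) * (∏ (λ j → a₂ (ω j)) js * k false (false ∷ falses n))
        ≈⟨ *-assoc _ _ _ ⟨
    ∏ (λ j → a₂ (ω j)) (j ∷ js) * k false (falses (suc n)) ∎

  -- The row sum and the total of the column sums change by the same entries. A row sum that drops
  -- from 1 to 0 and leaves all n column sums equal to 1 would have to start from n+1 of them.
  row-true-allTrue : ∀ (ω : J → Weights) (js : Vec J n) s k →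
                     (∀ s → k true s ≈ 0#) → (∀ s → k false s ≈ allTrue s) →
                     row ω js true s k ≈ 0#
  row-true-allTrue ω []       []          k k≈0 k≈ = k≈0 []
  row-true-allTrue ω (j ∷ js) (false ∷ s) k k≈0 k≈ =
    *0 (row-0 js true s λ { true s → k≈0 _ ; false s → k≈ _ })
  row-true-allTrue ω (j ∷ js) (true ∷ s)  k k≈0 k≈ = trans
    (+-cong (*0 (row-true-allTrue ω js s _ (λ _ → k≈0 _) (λ _ → k≈ _)))
            (*0 (row-0 js false s λ { true s → k≈0 _ ; false s → k≈ _ })))
    (+-identityˡ 0#)

  -- By the same count all column sums are 1 beforehand, and then a row that starts with sum 0 meets
  -- only zeros of type `b`.
  row-false-allTrue : ∀ (ω : J → Weights) (js : Vec J n) s k →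
                      (∀ s → k true s ≈ 0#) → (∀ s → k false s ≈ allTrue s) →
                      row ω js false s k ≈ ∏ (λ j → b (ω j)) js * allTrue s
  row-false-allTrue ω []       []          k k≈0 k≈ = trans (k≈ []) (sym (*-identityˡ _))
  row-false-allTrue ω (j ∷ js) (true ∷ s)  k k≈0 k≈ = trans
    (*-congˡ (row-false-allTrue ω js s _ (λ _ → k≈0 _) (λ _ → k≈ _)))
    (sym (*-assoc _ _ _))
  row-false-allTrue ω (j ∷ js) (false ∷ s) k k≈0 k≈ = trans
    (+-cong (*0 (row-0 js false s λ { true s → k≈0 _ ; false s → k≈ _ }))
            (row-true-allTrue ω js s _ (λ _ → k≈0 _) (λ _ → k≈ _)))
    (trans (+-identityˡ 0#) (sym (zeroʳ _)))

  -- Every row starts with sum 0, and against it a column that has reached the sum 1 admits only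
  -- zeros of type `b`.
  rows-left-true : ∀ (ω : I → J → Weights) (is : Vec I m) j (js : Vec J n) s →
    rows ω is (j ∷ js) (true ∷ s) allTrue ≈
    ∏ (λ i → b (ω i j)) is * rows ω is js s allTrue
  rows-left-true ω []       j js s = sym (*-identityˡ _)
  rows-left-true ω (i ∷ is) j js s = begin
    b (ω i j) * row (ω i) js false s _
      ≈⟨ *-congˡ (row-congʳ js false s λ
           { true  s′ → rows-left-true ω is j js s′
           ; false s′ → sym (zeroʳ _) }) ⟩
    b (ω i j) * row (ω i) js false s (λ h s → _ * whenTrue (λ s → rows ω is js s allTrue) h s)
      ≈⟨ *-congˡ (row-* (ω i) js false s _ _) ⟩
    b (ω i j) * (_ * row (ω i) js false s (whenTrue λ s → rows ω is js s allTrue))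
      ≈⟨ *-assoc _ _ _ ⟨
    _ ∎

  -- Every row has to end with sum 1. Where the last column already has sum 1, this forces an entry
  -- 0 with both sums equal to 1.
  rows-right-true : ∀ (ω : I → J → Weights) (is : Vec I m) (js : Vec J n) j s k →
    rows ω is (js ∷ʳ j) (s ∷ʳ true) k ≈
    ∏ (λ i → a₁ (ω i j)) is * rows ω is js s (λ s → k (s ∷ʳ true))
  rows-right-true ω []       js j s k = sym (*-identityˡ _)
  rows-right-true ω (i ∷ is) js j s k = begin
    row (ω i) (js ∷ʳ j) false (s ∷ʳ true) _
      ≈⟨ row-∷ʳ (ω i) js j false s true _ ⟩
    row (ω i) js false s _
      ≈⟨ row-congʳ js false s (λ
           { true  s′ → trans (+0 (zeroʳ _))
                              (trans (*-congˡ (rows-right-true ω is js j s′ k)) (sym (*-assoc _ _ _)))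
           ; false s′ → trans (zeroʳ _) (sym (zeroʳ _)) }) ⟩
    row (ω i) js false s (λ h s → _ * whenTrue (λ s → rows ω is js s (λ s → k (s ∷ʳ true))) h s)
      ≈⟨ row-* (ω i) js false s _ _ ⟩
    _ ∎

  -- Once the last column has received an entry 1 its sum stays 1 by `rows-right-true`, and `k`
  -- annihilates it; until then its vertices are zeros of type `b`.
  rows-right-false : ∀ (ω : I → J → Weights) (is : Vec I m) (js : Vec J n) j s k →
    (∀ s → k (s ∷ʳ true) ≈ 0#) →
    rows ω is (js ∷ʳ j) (s ∷ʳ false) k ≈
    ∏ (λ i → b (ω i j)) is * rows ω is js s (λ s → k (s ∷ʳ false))
  rows-right-false ω []       js j s k k≈0 = sym (*-identityˡ _)
  rows-right-false ω (i ∷ is) js j s k k≈0 = begin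
    row (ω i) (js ∷ʳ j) false (s ∷ʳ false) _
      ≈⟨ row-∷ʳ (ω i) js j false s false _ ⟩
    row (ω i) js false s _
      ≈⟨ row-congʳ js false s (λ
           { true  s′ → trans (*-congˡ (rows-right-false ω is js j s′ k k≈0)) (sym (*-assoc _ _ _))
           ; false s′ → trans (0+ (zeroʳ _)) (trans (rows-right-true ω is js j s′ k)
                          (trans (*0 (rows-0 is js s′ k≈0)) (sym (zeroʳ _)))) }) ⟩
    row (ω i) js false s (λ h s → _ * whenTrue (λ s → rows ω is js s (λ s → k (s ∷ʳ false))) h s)
      ≈⟨ row-* (ω i) js false s _ _ ⟩
    _ ∎

  -- Each of the next three statements isolates the corner vertex: if its entry is 1,
  -- then its row and its column are determined.

  topLeft : (I → J → Weights) → I → Vec I m → J → Vec J n → Carrier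
  topLeft {n = n} ω i is j js = row (ω i) js false (falses n)
    λ h s → whenTrue (λ s → rows ω is (j ∷ js) s allTrue) h (false ∷ s)

  partition-topLeft : ∀ (ω : I → J → Weights) i (is : Vec I m) j (js : Vec J n) →
    partition ω (i ∷ is) (j ∷ js) ≈
    a₂ (ω i j) * topLeft ω i is j js
      + ∏ (λ j → b (ω i j)) js * (∏ (λ i → b (ω i j)) is * partition ω is js)
  partition-topLeft ω i is j js = +-congˡ (trans (row-true-falses (ω i) js _)
    (*-congˡ (rows-left-true ω is j js _)))

  topRight : (I → J → Weights) → I → Vec I m → Vec J n → J → Carrier
  topRight {n = n} ω i is js j = row (ω i) js false (falses n)
    (whenTrue λ s → rows ω is (js ∷ʳ j) (s ∷ʳ false) allTrue)

  partition-topRight : ∀ (ω : I → J → Weights) i (is : Vec I m) (js : Vec J n) j →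
    partition ω (i ∷ is) (js ∷ʳ j) ≈
    b (ω i j) * topRight ω i is js j
      + ∏ (λ j → a₂ (ω i j)) js * (∏ (λ i → a₁ (ω i j)) is * partition ω is js)
  partition-topRight {n = n} ω i is js j = begin
    row (ω i) (js ∷ʳ j) false (falses (suc n)) K
      ≡⟨ ≡.cong (λ s → row (ω i) (js ∷ʳ j) false s K) (falses-∷ʳ n) ⟩
    row (ω i) (js ∷ʳ j) false (falses n ∷ʳ false) K
      ≈⟨ row-∷ʳ (ω i) js j false _ false _ ⟩
    row (ω i) js false (falses n) (λ h s → vertex (ω i j) h false (λ h t → K h (s ∷ʳ t)))
      ≈⟨ row-congʳ js false _ (λ
           { true  s → sym (+0 refl)
           ; false s → trans (0+ (zeroʳ _)) (sym (0+ (zeroʳ _))) }) ⟩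
    row (ω i) js false (falses n) (λ h s → b (ω i j) * whenTrue k h s + L h s)
      ≈⟨ row-+ (ω i) js false _ _ _ ⟩
    row (ω i) js false (falses n) (λ h s → b (ω i j) * whenTrue k h s) + row (ω i) js false (falses n) L
      ≈⟨ +-cong (row-* (ω i) js false _ _ _)
                (trans (row-false-falses (ω i) js L (λ _ → refl))
                       (*-congˡ (trans (rows-right-true ω is js j _ _)
                                       (*-congˡ (rows-congʳ is js _ allTrue-∷ʳ-true))))) ⟩
    _ ∎
    where
    K : Bool → Vec Bool (suc n) → Carrier
    K = whenTrue λ s → rows ω is (js ∷ʳ j) s allTrue
    k : Vec Bool n → Carrier
    k s = rows ω is (js ∷ʳ j) (s ∷ʳ false) allTrue
    L : Bool → Vec Bool n → Carrier
    L true  s = 0#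
    L false s = rows ω is (js ∷ʳ j) (s ∷ʳ true) allTrue

  bottomRight : (I → J → Weights) → Vec I m → I → Vec J n → J → Carrier
  bottomRight {n = n} ω is i js j = rows ω is (js ∷ʳ j) (falses (suc n))
    λ s → whenTrue (λ s → row (ω i) js false (init s) (whenTrue allTrue)) (last s) s

  partition-bottomRight : ∀ (ω : I → J → Weights) (is : Vec I m) i (js : Vec J n) j →
    partition ω (is ∷ʳ i) (js ∷ʳ j) ≈
    a₁ (ω i j) * bottomRight ω is i js j
      + ∏ (λ j → b (ω i j)) js * (∏ (λ i → b (ω i j)) is * partition ω is js)
  partition-bottomRight {n = n} ω is i js j = begin
    rows ω (is ∷ʳ i) (js ∷ʳ j) (falses (suc n)) allTrue
      ≈⟨ rows-∷ʳ ω is i (js ∷ʳ j) _ _ ⟩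
    rows ω is (js ∷ʳ j) (falses (suc n)) (λ s → row (ω i) (js ∷ʳ j) false s (whenTrue allTrue))
      ≈⟨ rows-congʳ is (js ∷ʳ j) _ lastRow ⟩
    rows ω is (js ∷ʳ j) (falses (suc n)) (λ s → a₁ (ω i j) * U s + V s)
      ≈⟨ trans (rows-+ ω is (js ∷ʳ j) _ _ _) (+-congʳ (rows-* ω is (js ∷ʳ j) _ _ _)) ⟩
    a₁ (ω i j) * bottomRight ω is i js j + rows ω is (js ∷ʳ j) (falses (suc n)) V
      ≡⟨ ≡.cong (λ s → a₁ (ω i j) * bottomRight ω is i js j + rows ω is (js ∷ʳ j) s V) (falses-∷ʳ n) ⟩
    a₁ (ω i j) * bottomRight ω is i js j + rows ω is (js ∷ʳ j) (falses n ∷ʳ false) V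
      ≈⟨ +-congˡ (trans (rows-right-false ω is js j _ V V-true)
                        (trans (*-congˡ (trans (rows-congʳ is js _ V-false) (rows-* ω is js _ _ _)))
                               (swap _ _ _))) ⟩
    _ ∎
    where
    -- The last row is split by the sum of the last column above it: if that sum is 1, the corner is
    -- a zero of type `a₁` and gives `U`; if it is 0, the corner is an entry 1 and gives `V`.
    U V : Vec Bool (suc n) → Carrier
    U s = whenTrue (λ s → row (ω i) js false (init s) (whenTrue allTrue)) (last s) s
    V s = whenTrue (λ s → ∏ (λ j → b (ω i j)) js * allTrue (init s)) (not (last s)) s

    swap : ∀ x y z → x * (y * z) ≈ y * (x * z)
    swap = solve 3 (λ x y z → x :* (y :* z) := y :* (x :* z)) refl

    V-true : ∀ s → V (s ∷ʳ true) ≈ 0#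
    V-true s rewrite last-∷ʳ true s = refl

    V-false : ∀ s → V (s ∷ʳ false) ≈ ∏ (λ j → b (ω i j)) js * allTrue s
    V-false s rewrite last-∷ʳ false s | init-∷ʳ false s = refl

    lastRow-∷ʳ : ∀ s t → row (ω i) (js ∷ʳ j) false (s ∷ʳ t) (whenTrue allTrue) ≈
                         a₁ (ω i j) * U (s ∷ʳ t) + V (s ∷ʳ t)
    lastRow-∷ʳ s true rewrite last-∷ʳ true s | init-∷ʳ true s = begin
      row (ω i) (js ∷ʳ j) false (s ∷ʳ true) (whenTrue allTrue)
        ≈⟨ row-∷ʳ (ω i) js j false s true _ ⟩
      row (ω i) js false s _
        ≈⟨ row-congʳ js false s (λ
             { true  t → trans (+0 (zeroʳ _)) (*-congˡ (allTrue-∷ʳ-true t))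
             ; false t → trans (zeroʳ _) (sym (zeroʳ _)) }) ⟩
      row (ω i) js false s (λ h s → a₁ (ω i j) * whenTrue allTrue h s)
        ≈⟨ row-* (ω i) js false s _ _ ⟩
      a₁ (ω i j) * row (ω i) js false s (whenTrue allTrue)
        ≈⟨ +-identityʳ _ ⟨
      _ ∎
    lastRow-∷ʳ s false rewrite last-∷ʳ false s | init-∷ʳ false s = begin
      row (ω i) (js ∷ʳ j) false (s ∷ʳ false) (whenTrue allTrue)
        ≈⟨ row-∷ʳ (ω i) js j false s false _ ⟩
      row (ω i) js false s _
        ≈⟨ row-false-allTrue (ω i) js s _ (λ t → *0 (allTrue-∷ʳ-false t))
             (λ t → trans (0+ (zeroʳ _)) (allTrue-∷ʳ-true t)) ⟩
      ∏ (λ j → b (ω i j)) js * allTrue s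
        ≈⟨ 0+ (zeroʳ _) ⟨
      _ ∎

    lastRow : ∀ s → row (ω i) (js ∷ʳ j) false s (whenTrue allTrue) ≈ a₁ (ω i j) * U s + V s
    lastRow s = ≡.subst (λ s → row (ω i) (js ∷ʳ j) false s (whenTrue allTrue) ≈ a₁ (ω i j) * U s + V s)
      (≡.sym (proj₂ (proj₂ (initLast s)))) (lastRow-∷ʳ (init s) (last s))

  ∏-congʳ : ∀ {f g : J → Carrier} (js : Vec J n) → (∀ q → f (lookup js q) ≈ g (lookup js q)) → ∏ f js ≈ ∏ g js
  ∏-congʳ js = ∏-cong js js

  -- The corner weight enters only as the coefficient of `X`; both `X` and the remainder are made of
  -- weights on which the two families agree. Hence the two partition functions are values of one
  -- affine function.
  changeTopLeft : ∀ (ω ω′ : I → J → Weights) i (is : Vec I m) j (js : Vec J n) →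
    (∀ q → ω i (lookup js q) ≈ʷ ω′ i (lookup js q)) →
    (∀ p q → ω (lookup is p) (lookup (j ∷ js) q) ≈ʷ ω′ (lookup is p) (lookup (j ∷ js) q)) →
    let rest = ∏ (λ j → b (ω i j)) js * (∏ (λ i → b (ω i j)) is * partition ω is js)
    in Σ[ X ∈ Carrier ] partition ω  (i ∷ is) (j ∷ js) ≈ a₂ (ω  i j) * X + rest
                      × partition ω′ (i ∷ is) (j ∷ js) ≈ a₂ (ω′ i j) * X + rest
  changeTopLeft ω ω′ i is j js e f =
    topLeft ω i is j js , partition-topLeft ω i is j js ,
    trans (partition-topLeft ω′ i is j js) (sym (+-cong
      (*-congˡ (row-cong js js e false _ λ
        { true s → rows-cong is is (j ∷ js) (j ∷ js) f _ (λ _ → refl) ; false s → refl }))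
      (*-cong (∏-congʳ js λ q → b-cong (e q))
        (*-cong (∏-congʳ is λ p → b-cong (f p zero))
          (partition-cong is is js js λ p q → f p (suc q))))))
    where
    b-cong : ∀ {v w} → v ≈ʷ w → b v ≈ b w
    b-cong (_ , _ , r , _) = r

  lookup-∷ʳˡ : ∀ {A : Set α} (P : A → Set β) (xs : Vec A n) x →
               (∀ p → P (lookup (xs ∷ʳ x) p)) → ∀ p → P (lookup xs p)
  lookup-∷ʳˡ P (y ∷ xs) x h zero    = h zero
  lookup-∷ʳˡ P (y ∷ xs) x h (suc p) = lookup-∷ʳˡ P xs x (λ p → h (suc p)) p

  lookup-∷ʳʳ : ∀ {A : Set α} (P : A → Set β) (xs : Vec A n) x →
               (∀ p → P (lookup (xs ∷ʳ x) p)) → P x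
  lookup-∷ʳʳ P []       x h = h zero
  lookup-∷ʳʳ P (y ∷ xs) x h = lookup-∷ʳʳ P xs x λ p → h (suc p)

  changeTopRight : ∀ (ω ω′ : I → J → Weights) i (is : Vec I m) (js : Vec J n) j →
    (∀ q → ω i (lookup js q) ≈ʷ ω′ i (lookup js q)) →
    (∀ p q → ω (lookup is p) (lookup (js ∷ʳ j) q) ≈ʷ ω′ (lookup is p) (lookup (js ∷ʳ j) q)) →
    let rest = ∏ (λ j → a₂ (ω i j)) js * (∏ (λ i → a₁ (ω i j)) is * partition ω is js)
    in Σ[ X ∈ Carrier ] partition ω  (i ∷ is) (js ∷ʳ j) ≈ b (ω  i j) * X + rest
                      × partition ω′ (i ∷ is) (js ∷ʳ j) ≈ b (ω′ i j) * X + rest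
  changeTopRight ω ω′ i is js j e f =
    topRight ω i is js j , partition-topRight ω i is js j ,
    trans (partition-topRight ω′ i is js j) (sym (+-cong
      (*-congˡ (row-cong js js e false _ (whenTrue-cong λ s →
        rows-cong is is (js ∷ʳ j) (js ∷ʳ j) f _ λ _ → refl)))
      (*-cong (∏-congʳ js λ q → a₂-cong (e q))
        (*-cong (∏-congʳ is λ p → a₁-cong
                  (lookup-∷ʳʳ (λ j → ω (lookup is p) j ≈ʷ ω′ (lookup is p) j) js j (f p)))
          (partition-cong is is js js λ p →
            lookup-∷ʳˡ (λ j → ω (lookup is p) j ≈ʷ ω′ (lookup is p) j) js j (f p))))))
    where
    a₁-cong : ∀ {v w} → v ≈ʷ w → a₁ v ≈ a₁ w
    a₁-cong (p , _) = p
    a₂-cong : ∀ {v w} → v ≈ʷ w → a₂ v ≈ a₂ w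
    a₂-cong (_ , q , _) = q

  changeBottomRight : ∀ (ω ω′ : I → J → Weights) (is : Vec I m) i (js : Vec J n) j →
    (∀ q → ω i (lookup js q) ≈ʷ ω′ i (lookup js q)) →
    (∀ p q → ω (lookup is p) (lookup (js ∷ʳ j) q) ≈ʷ ω′ (lookup is p) (lookup (js ∷ʳ j) q)) →
    let rest = ∏ (λ j → b (ω i j)) js * (∏ (λ i → b (ω i j)) is * partition ω is js)
    in Σ[ X ∈ Carrier ] partition ω  (is ∷ʳ i) (js ∷ʳ j) ≈ a₁ (ω  i j) * X + rest
                      × partition ω′ (is ∷ʳ i) (js ∷ʳ j) ≈ a₁ (ω′ i j) * X + rest
  changeBottomRight ω ω′ is i js j e f =
    bottomRight ω is i js j , partition-bottomRight ω is i js j ,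
    trans (partition-bottomRight ω′ is i js j) (sym (+-cong
      (*-congˡ (rows-cong is is (js ∷ʳ j) (js ∷ʳ j) f _ λ s → lem (last s) s))
      (*-cong (∏-congʳ js λ q → b-cong (e q))
        (*-cong (∏-congʳ is λ p → b-cong
                  (lookup-∷ʳʳ (λ j → ω (lookup is p) j ≈ʷ ω′ (lookup is p) j) js j (f p)))
          (partition-cong is is js js λ p →
            lookup-∷ʳˡ (λ j → ω (lookup is p) j ≈ʷ ω′ (lookup is p) j) js j (f p))))))
    where
    b-cong : ∀ {v w} → v ≈ʷ w → b v ≈ b w
    b-cong (_ , _ , r , _) = r
    lem : ∀ t s → whenTrue (λ s → row (ω i) js false (init s) (whenTrue allTrue)) t s ≈
                  whenTrue (λ s → row (ω′ i) js false (init s) (whenTrue allTrue)) t s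
    lem true  s = row-cong js js e false (init s) λ _ _ → refl
    lem false s = refl

  -- A bottom left corner is a top right corner of the transposed lattice.
  changeBottomLeft : ∀ (ω ω′ : I → J → Weights) (is : Vec I m) i j (js : Vec J n) →
    (∀ p → ω (lookup is p) j ≈ʷ ω′ (lookup is p) j) →
    (∀ p q → ω (lookup (is ∷ʳ i) p) (lookup js q) ≈ʷ ω′ (lookup (is ∷ʳ i) p) (lookup js q)) →
    let rest = ∏ (λ i → a₂ (ω i j)) is * (∏ (λ j → a₁ (ω i j)) js * partition ω is js)
    in Σ[ X ∈ Carrier ] partition ω  (is ∷ʳ i) (j ∷ js) ≈ b (ω  i j) * X + rest
                      × partition ω′ (is ∷ʳ i) (j ∷ js) ≈ b (ω′ i j) * X + rest
  changeBottomLeft ω ω′ is i j js e f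
    with X , p , p′ ← changeTopRight (flipʷ ω) (flipʷ ω′) j js is i e (λ q p → f p q)
    = X ,
      trans (partition-transpose ω (is ∷ʳ i) (j ∷ js)) (trans p (+-congˡ restᵀ)) ,
      trans (partition-transpose ω′ (is ∷ʳ i) (j ∷ js)) (trans p′ (+-congˡ restᵀ))
    where
    restᵀ = *-congˡ (*-congˡ (sym (partition-transpose ω is js)))

-- The Yang-Baxter equation and the symmetry of the partition function

module Exchange {c ℓ} (R : CommutativeRing c ℓ) where

  open CommutativeRing R hiding (zero)
  open IntSolver R
  open SixVertex R
  open Corners R using (rows-*)
  open import Relation.Binary.Reasoning.Setoid setoid

  -- In the coordinates used here the homogeneous point is 0, and 1 + y p is the
  -- refinement variable attached to a row (or column) with parameter p.
  A B cross : (x y p w : Carrier) → Carrier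
  A x y p w = (1# + y * p) * (1# + y * w) - y * p * w
  B x y p w = 1# - x * y * p * w
  cross x y u v = 1# + (y - 1#) * u + x * v + x * y * u * v

  -- This is `cross` at u = v = p. With it xA² + B² - yκ(p)κ(w) = (x + 1 - y)AB, so the classical
  -- invariant of six-vertex weights has the same value at all vertices, as the Yang-Baxter equation
  -- demands.
  κ : (x y p : Carrier) → Carrier
  κ x y p = 1# + (x + y - 1#) * p + x * y * p * p

  :A :B :cross : ∀ {n} (x y p w : Polynomial n) → Polynomial n
  :A x y p w = (:1 :+ y :* p) :* (:1 :+ y :* w) :- y :* p :* w
  :B x y p w = :1 :- x :* y :* p :* w
  :cross x y u v = :1 :+ (y :- :1) :* u :+ x :* v :+ x :* y :* u :* v

  :κ : ∀ {n} (x y p : Polynomial n) → Polynomial n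
  :κ x y p = :1 :+ (x :+ y :- :1) :* p :+ x :* y :* p :* p

  -- At p = w = 0 the weights are x, 1, 1 and y, which are those of the unrefined generating
  -- function.
  six : (x y p w : Carrier) → Weights
  six x y p w = weights (x * A x y p w) (A x y p w) (B x y p w) (y * κ x y p * κ x y w)

  W : ∀ {m n} (x y : Carrier) → Vec Carrier m → Vec Carrier n → Carrier
  W x y = partition (six x y)

  A-comm : ∀ x y p w → A x y p w ≈ A x y w p
  A-comm = solve 4 (λ x y p w → :A x y p w := :A x y w p) refl

  B-comm : ∀ x y p w → B x y p w ≈ B x y w p
  B-comm = solve 4 (λ x y p w → :B x y p w := :B x y w p) refl

  W-transpose : ∀ {m n} x y (P : Vec Carrier m) (V : Vec Carrier n) → W x y P V ≈ W x y V P
  W-transpose x y P V = trans (partition-transpose (six x y) P V) (partition-cong V V P P λ p q →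
    let v = lookup V p ; u = lookup P q in
    *-congˡ (A-comm x y u v) , A-comm x y u v , B-comm x y u v ,
    trans (*-assoc _ _ _) (trans (*-congˡ (*-comm _ _)) (sym (*-assoc _ _ _))))

  private
    variable
      n : ℕ
      u v : Carrier

  data Swap (u v : Carrier) : Vec Carrier n → Vec Carrier n → Set c where
    here  : ∀ {js : Vec Carrier n} → Swap u v (u ∷ v ∷ js) (v ∷ u ∷ js)
    there : ∀ {j} {js js′ : Vec Carrier n} → Swap u v js js′ → Swap u v (j ∷ js) (j ∷ js′)

  module _ (x y : Carrier) where

    -- The R-matrix that intertwines two adjacent columns with parameters u and v.
    mix : (u v : Carrier) → Bool → Bool → (Bool → Bool → Carrier) → Carrier
    mix u v false false k = cross x y u v * k false false
    mix u v true  true  k = cross x y u v * k true true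
    mix u v false true  k = κ x y v * k false true + x * (v - u) * k true false
    mix u v true  false k = (v - u) * k false true + κ x y u * k true false

    exchange : ∀ {u v} {js js′ : Vec Carrier n} → Swap u v js js′ →
               (Vec Bool n → Carrier) → Vec Bool n → Carrier
    exchange {u = u} {v} here k (s ∷ t ∷ ss) = mix u v s t λ s t → k (s ∷ t ∷ ss)
    exchange (there sw) k (s ∷ ss)     = exchange sw (λ ss → k (s ∷ ss)) ss

    mix-cong : ∀ u v s t {k l} → (∀ s t → k s t ≈ l s t) → mix u v s t k ≈ mix u v s t l
    mix-cong u v false false e = *-congˡ (e _ _)
    mix-cong u v false true  e = +-cong (*-congˡ (e _ _)) (*-congˡ (e _ _))
    mix-cong u v true  false e = +-cong (*-congˡ (e _ _)) (*-congˡ (e _ _))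
    mix-cong u v true  true  e = *-congˡ (e _ _)

    mix-+ : ∀ u v s t k l → mix u v s t (λ s t → k s t + l s t) ≈ mix u v s t k + mix u v s t l
    mix-+ u v false false k l = distribˡ _ _ _
    mix-+ u v false true  k l = solve 6 (λ a b x y u v →
      a :* (x :+ u) :+ b :* (y :+ v) := (a :* x :+ b :* y) :+ (a :* u :+ b :* v)) refl _ _ _ _ _ _
    mix-+ u v true  false k l = solve 6 (λ a b x y u v →
      a :* (x :+ u) :+ b :* (y :+ v) := (a :* x :+ b :* y) :+ (a :* u :+ b :* v)) refl _ _ _ _ _ _
    mix-+ u v true  true  k l = distribˡ _ _ _

    mix-* : ∀ u v s t r k → mix u v s t (λ s t → r * k s t) ≈ r * mix u v s t k
    mix-* u v false false r k = solve 3 (λ a x r → a :* (r :* x) := r :* (a :* x)) refl _ _ _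
    mix-* u v false true  r k = solve 5 (λ a b x y r →
      a :* (r :* x) :+ b :* (r :* y) := r :* (a :* x :+ b :* y)) refl _ _ _ _ _
    mix-* u v true  false r k = solve 5 (λ a b x y r →
      a :* (r :* x) :+ b :* (r :* y) := r :* (a :* x :+ b :* y)) refl _ _ _ _ _
    mix-* u v true  true  r k = solve 3 (λ a x r → a :* (r :* x) := r :* (a :* x)) refl _ _ _

    exchange-cong : ∀ {js js′ : Vec Carrier n} (σ : Swap u v js js′) {k l} →
                    (∀ s → k s ≈ l s) → ∀ s → exchange σ k s ≈ exchange σ l s
    exchange-cong here      e (s ∷ t ∷ ss) = mix-cong _ _ s t λ s t → e _
    exchange-cong (there σ) e (s ∷ ss)     = exchange-cong σ (λ ss → e (s ∷ ss)) ss

    exchange-+ : ∀ {js js′ : Vec Carrier n} (σ : Swap u v js js′) k l s →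
                 exchange σ (λ s → k s + l s) s ≈ exchange σ k s + exchange σ l s
    exchange-+ here      k l (s ∷ t ∷ ss) = mix-+ _ _ s t _ _
    exchange-+ (there σ) k l (s ∷ ss)     = exchange-+ σ _ _ ss

    exchange-* : ∀ {js js′ : Vec Carrier n} (σ : Swap u v js js′) r k s →
                 exchange σ (λ s → r * k s) s ≈ r * exchange σ k s
    exchange-* here      r k (s ∷ t ∷ ss) = mix-* _ _ s t r _
    exchange-* (there σ) r k (s ∷ ss)     = exchange-* σ r _ ss

    exchange-0 : ∀ {js js′ : Vec Carrier n} (σ : Swap u v js js′) {k} → (∀ s → k s ≈ 0#) →
                 ∀ s → exchange σ k s ≈ 0#
    exchange-0 σ {k} k≈0 s = trans (exchange-cong σ (λ s → trans (k≈0 s) (sym (zeroˡ (k s)))) s)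
                               (trans (exchange-* σ 0# k s) (zeroˡ _))

    private
      mix-row : ∀ u v s t (ω : Carrier → Weights) (js : Vec Carrier n) h ss
                (k : Bool → Bool → Bool → Vec Bool n → Carrier) →
                mix u v s t (λ s t → row ω js h ss (k s t)) ≈
                row ω js h ss (λ h ss → mix u v s t (λ s t → k s t h ss))
      mix-row u v false false ω js h ss k = sym (row-* ω js h ss _ _)
      mix-row u v false true  ω js h ss k =
        sym (trans (row-+ ω js h ss _ _) (+-cong (row-* ω js h ss _ _) (row-* ω js h ss _ _)))
      mix-row u v true  false ω js h ss k =
        sym (trans (row-+ ω js h ss _ _) (+-cong (row-* ω js h ss _ _) (row-* ω js h ss _ _)))
      mix-row u v true  true  ω js h ss k = sym (row-* ω js h ss _ _)

      :vertex : ∀ {n} (x y p w : Polynomial n) → Bool → Bool → (Bool → Bool → Polynomial n) → Polynomial n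
      :vertex x y p w false false k = :A x y p w :* k false false :+ k true true
      :vertex x y p w false true  k = :B x y p w :* k false true
      :vertex x y p w true  false k = :B x y p w :* k true false
      :vertex x y p w true  true  k =
        (x :* :A x y p w) :* k true true :+ (y :* :κ x y p :* :κ x y w) :* k false false

      :mix : ∀ {n} (x y u v : Polynomial n) → Bool → Bool → (Bool → Bool → Polynomial n) → Polynomial n
      :mix x y u v false false k = :cross x y u v :* k false false
      :mix x y u v true  true  k = :cross x y u v :* k true true
      :mix x y u v false true  k = :κ x y v :* k false true :+ x :* (v :- u) :* k true false
      :mix x y u v true  false k = (v :- u) :* k false true :+ :κ x y u :* k true false

      -- The number of ones among s and t, minus h, is conserved, which leaves the
      -- following values of k.
      :k : ∀ {n} → Bool → Bool → Bool → (k₀ k₁ k₂ : Polynomial n) → Bool → Bool → Bool → Polynomial n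
      :k true  false false k₀ k₁ k₂ _     _     _     = k₀
      :k false true  true  k₀ k₁ k₂ _     _     _     = k₀
      :k false false false k₀ k₁ k₂ false _     _     = k₀
      :k false false false k₀ k₁ k₂ true  false _     = k₁
      :k false false false k₀ k₁ k₂ true  true  _     = k₂
      :k true  false true  k₀ k₁ k₂ false _     _     = k₀
      :k true  false true  k₀ k₁ k₂ true  false _     = k₁
      :k true  false true  k₀ k₁ k₂ true  true  _     = k₂
      :k true  true  false k₀ k₁ k₂ false _     _     = k₀
      :k true  true  false k₀ k₁ k₂ true  false _     = k₁
      :k true  true  false k₀ k₁ k₂ true  true  _     = k₂
      :k _     _     _     k₀ k₁ k₂ true  _     _     = k₀
      :k _     _     _     k₀ k₁ k₂ false false _     = k₁
      :k _     _     _     k₀ k₁ k₂ false true  _     = k₂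

      :lhs :rhs : ∀ {n} → Bool → Bool → Bool → (x y p u v k₀ k₁ k₂ : Polynomial n) → Polynomial n
      :lhs h s t x y p u v k₀ k₁ k₂ =
        :vertex x y p u h s λ h′ s′ → :vertex x y p v h′ t λ h″ t′ →
        :mix x y u v s′ t′ (:k h s t k₀ k₁ k₂ h″)
      :rhs h s t x y p u v k₀ k₁ k₂ =
        :mix x y u v s t λ s t → :vertex x y p v h s λ h′ s′ → :vertex x y p u h′ t λ h″ t′ →
        :k h₀ s₀ t₀ k₀ k₁ k₂ h″ s′ t′
        where h₀ = h ; s₀ = s ; t₀ = t

    -- For each incoming state both sides are linear in the at most three values of `k` that
    -- conservation allows, so each case is a polynomial identity in x, y, p, u, v and these values.
    yangBaxter : ∀ p u v h s t (k : Bool → Bool → Bool → Carrier) →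
      vertex (six x y p u) h s (λ h s → vertex (six x y p v) h t (λ h t → mix u v s t (k h))) ≈
      mix u v s t (λ s t → vertex (six x y p v) h s (λ h s → vertex (six x y p u) h t (λ h t → k h s t)))
    yangBaxter p u v false false false k = solve 8 (λ x y p u v a b c →
      :lhs false false false x y p u v a b c := :rhs false false false x y p u v a b c) refl
      x y p u v (k false false false) (k true false true) (k true true false)
    yangBaxter p u v false false true  k = solve 8 (λ x y p u v a b c →
      :lhs false false true x y p u v a b c := :rhs false false true x y p u v a b c) refl
      x y p u v (k true true true) (k false false true) (k false true false)
    yangBaxter p u v false true  false k = solve 8 (λ x y p u v a b c →
      :lhs false true false x y p u v a b c := :rhs false true false x y p u v a b c) refl
      x y p u v (k true true true) (k false false true) (k false true false)
    yangBaxter p u v false true  true  k = solve 8 (λ x y p u v a b c →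
      :lhs false true true x y p u v a b c := :rhs false true true x y p u v a b c) refl
      x y p u v (k false true true) 0# 0#
    yangBaxter p u v true  false false k = solve 8 (λ x y p u v a b c →
      :lhs true false false x y p u v a b c := :rhs true false false x y p u v a b c) refl
      x y p u v (k true false false) 0# 0#
    yangBaxter p u v true  false true  k = solve 8 (λ x y p u v a b c →
      :lhs true false true x y p u v a b c := :rhs true false true x y p u v a b c) refl
      x y p u v (k false false false) (k true false true) (k true true false)
    yangBaxter p u v true  true  false k = solve 8 (λ x y p u v a b c →
      :lhs true true false x y p u v a b c := :rhs true true false x y p u v a b c) refl
      x y p u v (k false false false) (k true false true) (k true true false)
    yangBaxter p u v true  true  true  k = solve 8 (λ x y p u v a b c →
      :lhs true true true x y p u v a b c := :rhs true true true x y p u v a b c) refl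
      x y p u v (k true true true) (k false false true) (k false true false)

    -- Only the two vertices in the swapped columns call for the Yang-Baxter equation; all other
    -- vertices of the row commute with the exchange by linearity.
    exchange-row : ∀ p {js js′ : Vec Carrier n} (σ : Swap u v js js′) h s k →
      row (six x y p) js h s (λ h s → exchange σ (k h) s) ≈
      exchange σ (λ s → row (six x y p) js′ h s k) s
    exchange-row {u = u} {v = v} p (here {js = js}) h (s ∷ t ∷ ss) k = begin
      vertex (six x y p u) h s (λ h s → vertex (six x y p v) h t (λ h t →
        row (six x y p) js h ss (λ h ss → mix u v s t (λ s t → k h (s ∷ t ∷ ss)))))
          ≈⟨ vertex-congʳ _ h s (λ h s → vertex-congʳ _ h t λ h t → mix-row u v s t _ js h ss _) ⟨
      vertex (six x y p u) h s (λ h s → vertex (six x y p v) h t (λ h t →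
        mix u v s t (λ s t → row (six x y p) js h ss (λ h ss → k h (s ∷ t ∷ ss)))))
          ≈⟨ yangBaxter p u v h s t _ ⟩
      _ ∎
    exchange-row p {j ∷ js} {_ ∷ js′} (there σ) h (s ∷ ss) k = begin
      vertex (six x y p j) h s (λ h s → row (six x y p) js h ss (λ h ss → exchange σ (λ ss → k h (s ∷ ss)) ss))
          ≈⟨ vertex-congʳ _ h s (λ h s → exchange-row p σ h ss _) ⟩
      vertex (six x y p j) h s (λ h s → exchange σ (λ ss → row (six x y p) js′ h ss (λ h ss → k h (s ∷ ss))) ss)
          ≈⟨ vertex-linear (λ f → exchange σ f ss) (λ k l → exchange-+ σ k l ss) (λ r k → exchange-* σ r k ss) _ h s _ ⟩
      exchange σ (λ ss → vertex (six x y p j) h s (λ h s → row (six x y p) js′ h ss (λ h ss → k h (s ∷ ss)))) ss ∎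

    exchange-rows : ∀ {m} (P : Vec Carrier m) {js js′ : Vec Carrier n} (σ : Swap u v js js′) s k →
      rows (six x y) P js s (exchange σ k) ≈ exchange σ (λ s → rows (six x y) P js′ s k) s
    exchange-rows []      σ s k = refl
    exchange-rows (p ∷ P) {js} {js′} σ s k = trans
      (row-congʳ js false s λ
        { true  s′ → exchange-rows P σ s′ k
        ; false s′ → sym (exchange-0 σ (λ _ → refl) s′) })
      (exchange-row p σ false s (whenTrue λ s → rows (six x y) P js′ s k))

    exchange-allTrue : ∀ {js js′ : Vec Carrier n} (σ : Swap u v js js′) s →
                       exchange σ allTrue s ≈ cross x y u v * allTrue s
    exchange-allTrue here      (true  ∷ true  ∷ ss) = refl
    exchange-allTrue here      (true  ∷ false ∷ ss) = solve 3 (λ a b c → a :* :0 :+ b :* :0 := c :* :0) refl _ _ _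
    exchange-allTrue here      (false ∷ true  ∷ ss) = solve 3 (λ a b c → a :* :0 :+ b :* :0 := c :* :0) refl _ _ _
    exchange-allTrue here      (false ∷ false ∷ ss) = refl
    exchange-allTrue (there σ) (true  ∷ ss) = exchange-allTrue σ ss
    exchange-allTrue (there σ) (false ∷ ss) = trans (exchange-0 σ (λ _ → refl) ss) (sym (zeroʳ _))

    exchange-falses : ∀ {js js′ : Vec Carrier n} (σ : Swap u v js js′) k →
                      exchange σ k (falses n) ≈ cross x y u v * k (falses n)
    exchange-falses here      k = refl
    exchange-falses (there σ) k = exchange-falses σ λ s → k (false ∷ s)

    -- Above the first row all column sums are 0 and below the last row all are 1; on both the
    -- exchange acts as the scalar `cross x y u v`. In a general ring this may be a zero divisor, so
    -- it is cancelled only later, over a field.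
    W-swap : ∀ {m} (P : Vec Carrier m) {js js′ : Vec Carrier n} → Swap u v js js′ →
             cross x y u v * W x y P js ≈ cross x y u v * W x y P js′
    W-swap {n = n} {u = u} {v = v} P {js} {js′} σ = begin
      cross x y u v * W x y P js
        ≈⟨ rows-* (six x y) P js _ _ _ ⟨
      rows (six x y) P js (falses n) (λ s → cross x y u v * allTrue s)
        ≈⟨ rows-congʳ P js _ (exchange-allTrue σ) ⟨
      rows (six x y) P js (falses n) (exchange σ allTrue)
        ≈⟨ exchange-rows P σ _ _ ⟩
      exchange σ (λ s → rows (six x y) P js′ s allTrue) (falses n)
        ≈⟨ exchange-falses σ _ ⟩
      cross x y u v * W x y P js′ ∎

-- Expansion of the partition function along its top row

module Star {c ℓ} (K : CommutativeRing c ℓ) (F : IsField₀ K) (x y : CommutativeRing.Carrier K) where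

  open CommutativeRing K hiding (zero)
  open IntSolver K
  open SixVertex K
  open Corners K
  open Exchange K
  open Poly K F
  open import Algebra.Properties.Semiring.Sum semiring using (sum)
  import Data.Fin.Base as Fin
  import Data.Fin.Properties as Fin
  open import Data.List.Base as List using (List; _++_)
  import Data.List.Properties as List
  import Data.List.Relation.Unary.All as ListAll
  import Data.List.Relation.Unary.All.Properties as ListAll
  import Data.List.Relation.Unary.AllPairs.Properties as AllPairs
  open import Data.Vec.Base using (removeAt)
  open import Data.Vec.Relation.Unary.All using (All; []; _∷_)
  import Data.Vec.Relation.Unary.All as All
  import Data.Vec.Relation.Unary.All.Properties as All using (lookup⁻)
  open import Relation.Binary.Reasoning.Setoid setoid

  private
    variable
      m n k : ℕ
      α : Level
      ξ η : Carrier
      X : Set α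

  data Pick {X : Set α} (w : X) : Vec X (suc n) → Vec X n → Set α where
    here  : ∀ {V : Vec X n} → Pick w (w ∷ V) V
    there : ∀ {v} {V : Vec X (suc n)} {V′} → Pick w V V′ → Pick w (v ∷ V) (v ∷ V′)

  pick : (V : Vec X (suc n)) (i : Fin (suc n)) → Pick (lookup V i) V (removeAt V i)
  pick (v ∷ V)         zero    = here
  pick (v ∷ V@(_ ∷ _)) (suc i) = there (pick V i)

  All-removeAt : ∀ {p} {P : X → Set p} (V : Vec X (suc n)) i →
                 (∀ j → i ≢ j → P (lookup V j)) → All P (removeAt V i)
  All-removeAt (v ∷ V)         zero    h = All.lookup⁻ λ j → h (suc j) λ ()
  All-removeAt (v ∷ V@(_ ∷ _)) (suc i) h =
    h zero (λ ()) ∷ All-removeAt V i λ j i≢j → h (suc j) (i≢j ∘ Fin.suc-injective)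

  ∏-* : ∀ (f g : X → Carrier) (V : Vec X n) → ∏ (λ v → f v * g v) V ≈ ∏ f V * ∏ g V
  ∏-* f g []      = sym (*-identityˡ 1#)
  ∏-* f g (v ∷ V) = trans (*-congˡ (∏-* f g V))
    (solve 4 (λ a b c d → (a :* b) :* (c :* d) := (a :* c) :* (b :* d)) refl _ _ _ _)

  ∏-pick : ∀ (f : X → Carrier) {V : Vec X (suc n)} {V′ w} → Pick w V V′ → ∏ f V ≈ f w * ∏ f V′
  ∏-pick f here      = refl
  ∏-pick f (there p) = trans (*-congˡ (∏-pick f p))
    (solve 3 (λ a b c → a :* (b :* c) := b :* (a :* c)) refl _ _ _)

  ∏-0 : ∀ (f : X → Carrier) (V : Vec X n) i → f (lookup V i) ≈ 0# → ∏ f V ≈ 0#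
  ∏-0 f (v ∷ V) zero    e = trans (*-congʳ e) (zeroˡ _)
  ∏-0 f (v ∷ V) (suc i) e = trans (*-congˡ (∏-0 f V i e)) (zeroʳ _)

  ∏-removeAt-0 : ∀ (f : X → Carrier) (V : Vec X (suc n)) {i j} → i ≢ j →
                 f (lookup V i) ≈ 0# → ∏ f (removeAt V j) ≈ 0#
  ∏-removeAt-0 f (v ∷ V)         {zero}  {zero}  i≢j e = ⊥-elim (i≢j ≡.refl)
  ∏-removeAt-0 f (v ∷ V)         {suc i} {zero}  i≢j e = ∏-0 f V i e
  ∏-removeAt-0 f (v ∷ V@(_ ∷ _)) {zero}  {suc j} i≢j e = trans (*-congʳ e) (zeroˡ _)
  ∏-removeAt-0 f (v ∷ V@(_ ∷ _)) {suc i} {suc j} i≢j e =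
    trans (*-congˡ (∏-removeAt-0 f V (i≢j ∘ ≡.cong suc) e)) (zeroʳ _)

  -- The product of f m and g v is the same for every v, so any matching of the two vectors will do,
  -- and the one by position is at hand. It combines products over row parameters with products over
  -- column parameters.
  ∏-pair : ∀ (f g h : X → Carrier) (M V : Vec X n) →
           All (λ v → ∀ m → f m * g v ≈ h m) V → ∏ f M * ∏ g V ≈ ∏ h M
  ∏-pair f g h []      []      []       = *-identityˡ 1#
  ∏-pair f g h (m ∷ M) (v ∷ V) (e ∷ es) = trans
    (solve 4 (λ a b c d → (a :* b) :* (c :* d) := (a :* c) :* (b :* d)) refl _ _ _ _)
    (*-cong (e m) (∏-pair f g h M V es))

  sum-0 : ∀ {n} (f : Fin n → Carrier) → (∀ i → f i ≈ 0#) → sum f ≈ 0#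
  sum-0 {zero}  f f≈0 = refl
  sum-0 {suc n} f f≈0 = trans (+-cong (f≈0 zero) (sum-0 (f ∘ suc) (f≈0 ∘ suc))) (+-identityˡ 0#)

  sum-single : ∀ {n} (f : Fin n → Carrier) i → (∀ j → i ≢ j → f j ≈ 0#) → sum f ≈ f i
  sum-single f zero    h = trans (+-congˡ (sum-0 (f ∘ suc) λ j → h (suc j) λ ())) (+-identityʳ _)
  sum-single f (suc i) h = trans
    (+-cong (h zero λ ()) (sum-single (f ∘ suc) i λ j i≢j → h (suc j) (i≢j ∘ Fin.suc-injective)))
    (+-identityˡ _)

  -- Each swap records that its `cross` is nonzero, so that `W-swap` can be cancelled along the way.
  data _⇝_ : Vec Carrier n → Vec Carrier n → Set (c ⊔ ℓ) where
    done  : ∀ {V : Vec Carrier n} → V ⇝ V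
    _,_◅_ : ∀ {V V′ V″ : Vec Carrier n} → Swap ξ η V V′ → cross x y ξ η ≉ 0# → V′ ⇝ V″ → V ⇝ V″

  ⇝-∷ : ∀ {V V′ : Vec Carrier n} → V ⇝ V′ → (ξ ∷ V) ⇝ (ξ ∷ V′)
  ⇝-∷ done         = done
  ⇝-∷ (σ , r ◅ p) = there σ , r ◅ ⇝-∷ p

  ⇝-trans : ∀ {V V′ V″ : Vec Carrier n} → V ⇝ V′ → V′ ⇝ V″ → V ⇝ V″
  ⇝-trans done         q = q
  ⇝-trans (σ , r ◅ p) q = σ , r ◅ ⇝-trans p q

  W-⇝ : ∀ (P : Vec Carrier m) {V V′ : Vec Carrier n} → V ⇝ V′ → W x y P V ≈ W x y P V′
  W-⇝ P done         = refl
  W-⇝ P (σ , r ◅ p) = trans (*-cancelˡ r (W-swap x y P σ)) (W-⇝ P p)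

  pick-front : ∀ {V : Vec Carrier (suc n)} {V′} → Pick ξ V V′ →
               All (λ v → cross x y v ξ ≉ 0#) V′ → V ⇝ (ξ ∷ V′)
  pick-front here      []       = done
  pick-front here      (_ ∷ _)  = done
  pick-front (there p) (r ∷ rs) = ⇝-trans (⇝-∷ (pick-front p rs)) (here , r ◅ done)

  ∷⇝∷ʳ : ∀ (V : Vec Carrier n) → All (λ v → cross x y ξ v ≉ 0#) V → (ξ ∷ V) ⇝ (V ∷ʳ ξ)
  ∷⇝∷ʳ []      []       = done
  ∷⇝∷ʳ (v ∷ V) (r ∷ rs) = here , r ◅ ⇝-∷ (∷⇝∷ʳ V rs)

  pick-back : ∀ {V : Vec Carrier (suc n)} {V′} → Pick ξ V V′ →
              All (λ v → cross x y ξ v ≉ 0#) V′ → V ⇝ (V′ ∷ʳ ξ)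
  pick-back {V′ = V′} here rs       = ∷⇝∷ʳ V′ rs
  pick-back (there p)      (r ∷ rs) = ⇝-∷ (pick-back p rs)

  Degree-∏ : ∀ d (f : X → Carrier → Carrier) (V : Vec X n) → (∀ v → Degree≤ d (f v)) →
             Degree≤ (n ℕ.* d) (λ p → ∏ (λ v → f v p) V)
  Degree-∏ d f []      h = const 1# λ _ → refl
  Degree-∏ d f (v ∷ V) h = Degree-* (h v) (Degree-∏ d f V h)

  Degree-sum : ∀ {n d} (f : Fin n → Carrier → Carrier) → (∀ i → Degree≤ d (f i)) →
               Degree≤ d (λ p → sum (λ i → f i p))
  Degree-sum {zero}  {d} f h = Degree-const d 0#
  Degree-sum {suc n}     f h = Degree-+ (h zero) (Degree-sum (f ∘ suc) (h ∘ suc))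

  Degree-A : ∀ w → Degree≤ 1 (λ p → A x y p w)
  Degree-A w = Degree-resp
    (λ p → solve 4 (λ x y p w → :A x y p w := (y :* (:1 :+ (y :- :1) :* w)) :* p :+ (:1 :+ y :* w)) refl x y p w)
    (Degree-linear (y * (1# + (y - 1#) * w)) (1# + y * w))

  Degree-B : ∀ w → Degree≤ 1 (λ p → B x y p w)
  Degree-B w = Degree-resp
    (λ p → solve 4 (λ x y p w → :B x y p w := (:- (x :* y :* w)) :* p :+ :1) refl x y p w)
    (Degree-linear (- (x * y * w)) 1#)

  -- In the top row only the weights A, B and 1 occur, and there is one entry 1.
  Degree-row-true : ∀ (V : Vec Carrier n) k →
                    Degree≤ n (λ p → row (six x y p) V true (falses n) k)
  Degree-row-true []      k = Degree-const 0 _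
  Degree-row-true (v ∷ V) k = Degree-* (Degree-B v) (Degree-row-true V λ h s → k h (false ∷ s))

  Degree-row-false : ∀ (V : Vec Carrier (suc n)) k → (∀ s → k false s ≈ 0#) →
                     Degree≤ n (λ p → row (six x y p) V false (falses (suc n)) k)
  Degree-row-false (v ∷ [])        k k≈0 = const _ λ p →
    trans (+-congʳ (trans (*-congˡ (k≈0 _)) (zeroʳ _))) (+-identityˡ _)
  Degree-row-false (v ∷ V@(_ ∷ _)) k k≈0 = Degree-+
    (Degree-* (Degree-A v) (Degree-row-false V (λ h s → k h (false ∷ s)) λ s → k≈0 (false ∷ s)))
    (Degree-row-true V λ h s → k h (true ∷ s))

  Degree-W : ∀ (M : Vec Carrier m) (V : Vec Carrier (suc n)) → Degree≤ n (λ p → W x y (p ∷ M) V)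
  Degree-W M V = Degree-row-false V _ λ _ → refl

  AB : Carrier → Carrier → Carrier
  AB p w = A x y p w * B x y p w

  -- With x and y nonzero, `≉0` and `slope≉0` give the affine functions `B` and `A` of the other
  -- parameter a zero. `distinct` permits division by differences and separates zeros of the same
  -- kind; `cross≉0` permits reordering and separates the zeros of `A` from those of `B`.
  record Generic (V : Vec Carrier n) : Set (c ⊔ ℓ) where
    field
      ≉0       : ∀ i → lookup V i ≉ 0#
      slope≉0  : ∀ i → 1# + (y - 1#) * lookup V i ≉ 0#
      distinct : ∀ i j → i ≢ j → lookup V i ≉ lookup V j
      cross≉0  : ∀ i j → cross x y (lookup V i) (lookup V j) ≉ 0#

  -- A term of the Laplace expansion, along the row of p, of the Izergin-Korepin determinant with
  -- entries 1/(AB), after its prefactors have been multiplied out.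
  rowExpansionTerm : Vec Carrier k → Vec Carrier (suc k) → Carrier → Fin (suc k) → Carrier
  rowExpansionTerm M V p i = let w = lookup V i ; V′ = removeAt V i in
    W x y M V′ * (∏ (λ m → AB m w) M * ∏ (λ v → AB p v * inv (w - v)) V′)

  module _ (x≉0 : x ≉ 0#) (y≉0 : y ≉ 0#) {k} (M : Vec Carrier k) (V : Vec Carrier (suc k))
           (V-generic : Generic V) where

    open Generic V-generic

    private
      lhs rhs f : Carrier → Carrier
      lhs p = ∏ (λ m → y * (p - m)) M * W x y (p ∷ M) V
      rhs p = sum (rowExpansionTerm M V p)
      f p = lhs p + - 1# * rhs p

      Degree-f : Degree≤ (k ℕ.+ k) f
      Degree-f = Degree-+
        (Degree-≤ (ℕ.≤-reflexive (≡.cong (ℕ._+ k) (ℕ.*-identityʳ k)))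
          (Degree-* (Degree-∏ 1 (λ m p → y * (p - m)) M λ m → Degree-resp
            (λ p → solve 3 (λ y p m → y :* (p :- m) := y :* p :+ (:- (y :* m))) refl y p m)
            (Degree-linear y (- (y * m)))) (Degree-W M V)))
        (Degree-scale (- 1#) (Degree-sum (λ i p → rowExpansionTerm M V p i) λ i →
          Degree-scale _ (Degree-scale _ (Degree-≤ (ℕ.≤-reflexive (k*2≡k+k k))
            (Degree-∏ 2 (λ v p → AB p v * inv (lookup V i - v)) (removeAt V i) λ v →
              Degree-resp (λ p → *-comm _ _)
                (Degree-scale _ (Degree-* (Degree-A v) (Degree-B v))))))))
        where
        k*2≡k+k : ∀ k → k ℕ.* 2 ≡ k ℕ.+ k
        k*2≡k+k k = ≡.trans (ℕ.*-comm k 2) (≡.cong (k ℕ.+_) (ℕ.+-identityʳ k))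

      -- Every term except that of w = `lookup V i` contains the factor `AB x y p w`.
      others≈0 : ∀ i p → AB p (lookup V i) ≈ 0# → rhs p ≈ rowExpansionTerm M V p i
      others≈0 i p e = sum-single (rowExpansionTerm M V p) i λ j i≢j →
        trans (*-congˡ (trans (*-congˡ (∏-removeAt-0 _ V i≢j (trans (*-congʳ e) (zeroˡ _)))) (zeroʳ _))) (zeroʳ _)

      f≈0 : ∀ {p} → lhs p ≈ rhs p → f p ≈ 0#
      f≈0 {p} e = trans (+-congʳ e) (solve 1 (λ a → a :+ (:- :1) :* a := :0) refl (rhs p))

      zeroOfA : ∀ i t → A x y t (lookup V i) ≈ 0# → f t ≈ 0#
      zeroOfA i t A≈0 = f≈0 (begin
        ∏ (λ m → y * (t - m)) M * W x y (t ∷ M) V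
          ≈⟨ *-congˡ (W-⇝ (t ∷ M) (pick-front (pick V i) (All-removeAt V i λ j _ → cross≉0 j i))) ⟩
        ∏ (λ m → y * (t - m)) M * W x y (t ∷ M) (w ∷ V′)
          ≈⟨ *-congˡ (partition-topLeft (six x y) t M w V′) ⟩
        ∏ (λ m → y * (t - m)) M * (A x y t w * topLeft (six x y) t M w V′
          + ∏ (B x y t) V′ * (∏ (λ m → B x y m w) M * W x y M V′))
          ≈⟨ *-cong (∏-pair _ _ _ M V′ (All-removeAt V i λ j i≢j m → pair m (lookup V j) (distinct i j i≢j)))
                    (+-congʳ (sym (trans (*-congʳ A≈0) (trans (zeroˡ _) (sym (zeroˡ _)))))) ⟨
        ∏ (λ m → A x y m w) M * ∏ (λ v → A x y t v * inv (w - v)) V′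
          * (0# * 0# + ∏ (B x y t) V′ * (∏ (λ m → B x y m w) M * W x y M V′))
          ≈⟨ solve 5 (λ a b c d e → a :* b :* (:0 :* :0 :+ c :* (d :* e)) := e :* ((a :* d) :* (b :* c))) refl _ _ _ _ _ ⟩
        W x y M V′ * (∏ (λ m → A x y m w) M * ∏ (λ m → B x y m w) M
          * (∏ (λ v → A x y t v * inv (w - v)) V′ * ∏ (B x y t) V′))
          ≈⟨ *-congˡ (*-cong (∏-* _ _ M) (trans (∏-cong V′ V′ λ q → assoc) (∏-* _ _ V′))) ⟨
        rowExpansionTerm M V t i
          ≈⟨ others≈0 i t (trans (*-congʳ A≈0) (zeroˡ _)) ⟨
        rhs t ∎)
        where
        w = lookup V i
        V′ = removeAt V i
        assoc : ∀ {a b c} → a * b * c ≈ a * c * b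
        assoc = solve 3 (λ a b c → a :* b :* c := a :* c :* b) refl _ _ _
        -- `A` is a bilinear form in (1, p) and (1, w) of determinant -y, hence A(m,w)A(t,v) -
        -- A(m,v)A(t,w) = y(t - m)(w - v), and here A(t,w) = 0.
        pair : ∀ m v → w ≉ v → A x y m w * (A x y t v * inv (w - v)) ≈ y * (t - m)
        pair m v w≉v = begin
          A x y m w * (A x y t v * inv (w - v))
            ≈⟨ solve 7 (λ x y m t v w i → :A x y m w :* (:A x y t v :* i) :=
                 y :* (t :- m) :* ((w :- v) :* i)
                   :+ :A x y t w :* (((m :- t) :* (y :* (:1 :+ (y :- :1) :* v)) :+ :A x y t v) :* i))
                 refl x y m t v w (inv (w - v)) ⟩
          y * (t - m) * ((w - v) * inv (w - v)) + A x y t w * _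
            ≈⟨ +-cong (*-congˡ (inverseʳ _ (x≉y⇒x-y≉0 w≉v))) (*-congʳ A≈0) ⟩
          y * (t - m) * 1# + 0# * _
            ≈⟨ solve 2 (λ a b → a :* :1 :+ :0 :* b := a) refl _ _ ⟩
          y * (t - m) ∎

      zeroOfB : ∀ i t → B x y t (lookup V i) ≈ 0# → f t ≈ 0#
      zeroOfB i t B≈0 = f≈0 (begin
        ∏ (λ m → y * (t - m)) M * W x y (t ∷ M) V
          ≈⟨ *-congˡ (W-⇝ (t ∷ M) (pick-back (pick V i) (All-removeAt V i λ j _ → cross≉0 i j))) ⟩
        ∏ (λ m → y * (t - m)) M * W x y (t ∷ M) (V′ ∷ʳ w)
          ≈⟨ *-congˡ (partition-topRight (six x y) t M V′ w) ⟩
        ∏ (λ m → y * (t - m)) M * (B x y t w * topRight (six x y) t M V′ w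
          + ∏ (A x y t) V′ * (∏ (λ m → x * A x y m w) M * W x y M V′))
          ≈⟨ *-congˡ (+-cong (trans (*-congʳ B≈0) (zeroˡ _)) (*-congˡ (*-congʳ (∏-* _ _ M)))) ⟩
        ∏ (λ m → y * (t - m)) M * (0#
          + ∏ (A x y t) V′ * (∏ (λ _ → x) M * ∏ (λ m → A x y m w) M * W x y M V′))
          ≈⟨ solve 5 (λ a b c d e → a :* (:0 :+ b :* (c :* d :* e)) := (a :* c) :* (b :* (d :* e))) refl _ _ _ _ _ ⟩
        ∏ (λ m → y * (t - m)) M * ∏ (λ _ → x) M
          * (∏ (A x y t) V′ * (∏ (λ m → A x y m w) M * W x y M V′))
          ≈⟨ *-congʳ (trans (∏-pair _ _ _ M V′ (All-removeAt V i λ j i≢j m → pair m (lookup V j) (distinct i j i≢j)))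
                       (∏-* _ _ M)) ⟨
        ∏ (λ m → B x y m w) M * ∏ (λ v → B x y t v * inv (w - v)) V′
          * (∏ (A x y t) V′ * (∏ (λ m → A x y m w) M * W x y M V′))
          ≈⟨ solve 5 (λ a b c d e → a :* b :* (c :* (d :* e)) := e :* ((d :* a) :* (c :* b))) refl _ _ _ _ _ ⟩
        W x y M V′ * (∏ (λ m → A x y m w) M * ∏ (λ m → B x y m w) M
          * (∏ (A x y t) V′ * ∏ (λ v → B x y t v * inv (w - v)) V′))
          ≈⟨ *-congˡ (*-cong (∏-* _ _ M) (trans (∏-cong V′ V′ λ q → *-assoc _ _ _) (∏-* _ _ V′))) ⟨
        rowExpansionTerm M V t i
          ≈⟨ others≈0 i t (trans (*-congˡ B≈0) (zeroʳ _)) ⟨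
        rhs t ∎)
        where
        w = lookup V i
        V′ = removeAt V i
        pair : ∀ m v → w ≉ v → B x y m w * (B x y t v * inv (w - v)) ≈ y * (t - m) * x
        pair m v w≉v = begin
          B x y m w * (B x y t v * inv (w - v))
            ≈⟨ solve 7 (λ x y m t v w i → :B x y m w :* (:B x y t v :* i) :=
                 y :* (t :- m) :* x :* ((w :- v) :* i)
                   :+ :B x y t w :* (((m :- t) :* (:- (x :* y :* v)) :+ :B x y t v) :* i))
                 refl x y m t v w (inv (w - v)) ⟩
          y * (t - m) * x * ((w - v) * inv (w - v)) + B x y t w * _
            ≈⟨ +-cong (*-congˡ (inverseʳ _ (x≉y⇒x-y≉0 w≉v))) (*-congʳ B≈0) ⟩
          y * (t - m) * x * 1# + 0# * _
            ≈⟨ solve 2 (λ a b → a :* :1 :+ :0 :* b := a) refl _ _ ⟩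
          y * (t - m) * x ∎

      slope : Carrier → Carrier
      slope w = y * (1# + (y - 1#) * w)

      tA tB : Fin (suc k) → Carrier
      tA i = - ((1# + y * lookup V i) * inv (slope (lookup V i)))
      tB i = inv (x * y * lookup V i)

      A-tA : ∀ i → A x y (tA i) (lookup V i) ≈ 0#
      A-tA i = begin
        A x y (tA i) w
          ≈⟨ solve 4 (λ x y w j → :A x y (:- ((:1 :+ y :* w) :* j)) w :=
               (:1 :+ y :* w) :* (:1 :- (y :* (:1 :+ (y :- :1) :* w)) :* j)) refl x y w _ ⟩
        (1# + y * w) * (1# - slope w * inv (slope w))
          ≈⟨ *-congˡ (+-congˡ (-‿cong (inverseʳ _ (x*y≉0 y≉0 (slope≉0 i))))) ⟩
        (1# + y * w) * (1# - 1#)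
          ≈⟨ solve 1 (λ a → a :* (:1 :- :1) := :0) refl _ ⟩
        0# ∎
        where w = lookup V i

      B-tB : ∀ i → B x y (tB i) (lookup V i) ≈ 0#
      B-tB i = begin
        B x y (tB i) w               ≈⟨ solve 4 (λ x y t w → :B x y t w := :1 :- (x :* y :* w) :* t) refl x y (tB i) w ⟩
        1# - (x * y * w) * tB i      ≈⟨ +-congˡ (-‿cong (inverseʳ _ (x*y≉0 (x*y≉0 x≉0 y≉0) (≉0 i)))) ⟩
        1# - 1#                      ≈⟨ -‿inverseʳ 1# ⟩
        0#                           ∎
        where w = lookup V i

      -0* : ∀ {a b c d} → b ≈ 0# → d ≈ 0# → a * b - c * d ≈ 0#
      -0* {a} {b} {c} {d} b≈0 d≈0 = trans
        (+-cong (*-congˡ b≈0) (-‿cong (*-congˡ d≈0)))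
        (solve 2 (λ a c → a :* :0 :- c :* :0 := :0) refl a c)

      A-congˡ : ∀ {s t w} → s ≈ t → A x y s w ≈ A x y t w
      A-congˡ s≈t = +-cong (*-congʳ (+-congˡ (*-congˡ s≈t))) (-‿cong (*-congʳ (*-congˡ s≈t)))

      B-congˡ : ∀ {s t w} → s ≈ t → B x y s w ≈ B x y t w
      B-congˡ s≈t = +-congˡ (-‿cong (*-congʳ (*-congˡ s≈t)))

      -- A common zero of two affine functions annihilates their resultant, which is y(v - w) here.
      -- In the next two lemmas it is xy(w - v) and y times `cross x y w v`.
      tA-distinct : ∀ {i j} → i ≢ j → tA i ≉ tA j
      tA-distinct {i} {j} i≢j e = x*y≉0 y≉0 (x≉y⇒x-y≉0 (distinct j i (i≢j ∘ ≡.sym))) (begin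
        y * (v - w)                             ≈⟨ solve 5 (λ x y t w v → y :* (v :- w) :=
          (y :* (:1 :+ (y :- :1) :* w)) :* :A x y t v :- (y :* (:1 :+ (y :- :1) :* v)) :* :A x y t w)
          refl x y (tA i) w v ⟩
        slope w * A x y (tA i) v - slope v * A x y (tA i) w
          ≈⟨ -0* (trans (A-congˡ e) (A-tA j)) (A-tA i) ⟩
        0#                                      ∎)
        where w = lookup V i ; v = lookup V j

      tB-distinct : ∀ {i j} → i ≢ j → tB i ≉ tB j
      tB-distinct {i} {j} i≢j e = x*y≉0 (x*y≉0 x≉0 y≉0) (x≉y⇒x-y≉0 (distinct i j i≢j)) (begin
        x * y * (w - v)                         ≈⟨ solve 5 (λ x y t w v → x :* y :* (w :- v) :=
          (x :* y :* w) :* :B x y t v :- (x :* y :* v) :* :B x y t w)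
          refl x y (tB i) w v ⟩
        (x * y * w) * B x y (tB i) v - (x * y * v) * B x y (tB i) w
          ≈⟨ -0* (trans (B-congˡ e) (B-tB j)) (B-tB i) ⟩
        0#                                      ∎)
        where w = lookup V i ; v = lookup V j

      tA≉tB : ∀ i j → tA i ≉ tB j
      tA≉tB i j e = x*y≉0 y≉0 (cross≉0 i j) (begin
        y * cross x y w v                       ≈⟨ solve 5 (λ x y t w v → y :* :cross x y w v :=
          (y :* (:1 :+ (y :- :1) :* w)) :* :B x y t v :- (:- (x :* y :* v)) :* :A x y t w)
          refl x y (tA i) w v ⟩
        slope w * B x y (tA i) v - (- (x * y * v)) * A x y (tA i) w
          ≈⟨ -0* (trans (B-congˡ e) (B-tB j)) (A-tA i) ⟩
        0#                                      ∎)
        where w = lookup V i ; v = lookup V j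

    -- Both sides are polynomials of degree 2k in p, and they agree at the 2k + 2
    -- zeros of A p v and B p v, where a corner entry of the top row is forced to be 1.
    rowExpansion : ∀ p → ∏ (λ m → y * (p - m)) M * W x y (p ∷ M) V ≈ sum (rowExpansionTerm M V p)
    rowExpansion p = x-y≈0⇒x≈y _ _ (trans (solve 2 (λ a b → a :- b := a :+ (:- :1) :* b) refl _ _)
      (manyRoots Degree-f (List.tabulate tA ++ List.tabulate tB)
        (AllPairs.++⁺ (AllPairs.tabulate⁺ tA-distinct) (AllPairs.tabulate⁺ tB-distinct)
          (ListAll.tabulate⁺ λ i → ListAll.tabulate⁺ λ j → tA≉tB i j))
        (ListAll.++⁺ (ListAll.tabulate⁺ λ i → zeroOfA i (tA i) (A-tA i))
                     (ListAll.tabulate⁺ λ i → zeroOfB i (tB i) (B-tB i)))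
        (ℕ.≤-trans (ℕ.s≤s (ℕ.+-monoʳ-≤ k (ℕ.n≤1+n k))) (ℕ.≤-reflexive (≡.sym length-zeros)))
        p))
      where
      length-zeros : List.length (List.tabulate tA ++ List.tabulate tB) ≡ suc k ℕ.+ suc k
      length-zeros = ≡.trans (List.length-++ (List.tabulate tA))
        (≡.cong₂ ℕ._+_ (List.length-tabulate tA) (List.length-tabulate tB))

-- The bilinear identity for generic parameters

module Bilinear {c ℓ} (K : CommutativeRing c ℓ) (F : IsField₀ K) where

  open CommutativeRing K hiding (zero)
  open IntSolver K
  open SixVertex K
  open Exchange K
  open Poly K F
  open Star K F
  open import Algebra.Properties.Semiring.Sum semiring using (sum; sum-cong-≋; ∑-comm; *-distribˡ-sum)
  import Data.Fin.Properties as Fin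
  open import Data.Vec.Base using (removeAt)
  open import Data.Vec.Relation.Unary.All using ([]; _∷_)
  open import Relation.Binary.Reasoning.Setoid setoid

  module _ {x y : Carrier} (x≉0 : x ≉ 0#) (y≉0 : y ≉ 0#) {k : ℕ} where

    private
      ab : Carrier → Carrier → Carrier
      ab = AB x y

      ab-comm : ∀ p w → ab p w ≈ ab w p
      ab-comm = solve 4 (λ x y p w → :A x y p w :* :B x y p w := :A x y w p :* :B x y w p) refl x y

      Generic-drop₁ : ∀ {n u v} {V : Vec Carrier n} → Generic x y (u ∷ v ∷ V) → Generic x y (u ∷ V)
      Generic-drop₁ G = record
        { ≉0       = λ { zero → ≉0 zero ; (suc i) → ≉0 (suc (suc i)) }
        ; slope≉0  = λ { zero → slope≉0 zero ; (suc i) → slope≉0 (suc (suc i)) }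
        ; distinct = λ
          { zero    zero    i≢j → ⊥-elim (i≢j ≡.refl)
          ; zero    (suc j) i≢j → distinct zero (suc (suc j)) λ ()
          ; (suc i) zero    i≢j → distinct (suc (suc i)) zero λ ()
          ; (suc i) (suc j) i≢j → distinct (suc (suc i)) (suc (suc j)) (i≢j ∘ Fin.suc-injective) }
        ; cross≉0  = λ
          { zero    zero    → cross≉0 zero zero
          ; zero    (suc j) → cross≉0 zero (suc (suc j))
          ; (suc i) zero    → cross≉0 (suc (suc i)) zero
          ; (suc i) (suc j) → cross≉0 (suc (suc i)) (suc (suc j)) }
        }
        where open Generic x y G

      ∏-inverse : ∀ {n} p (M : Vec Carrier n) → (∀ i → p ≉ lookup M i) →
                  ∏ (λ m → inv (p - m)) M * ∏ (λ m → y * (p - m)) M ≈ ∏ (λ _ → y) M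
      ∏-inverse p []      h = *-identityˡ 1#
      ∏-inverse p (m ∷ M) h = trans
        (solve 5 (λ i a y d b → (i :* a) :* (y :* d :* b) := (d :* i) :* y :* (a :* b)) refl _ _ _ _ _)
        (*-cong (trans (*-congʳ (inverseʳ _ (x≉y⇒x-y≉0 (h zero)))) (*-identityˡ y)) (∏-inverse p M (h ∘ suc)))

      ∏≉0 : ∀ {n} (f : Carrier → Carrier) (M : Vec Carrier n) → (∀ m → f m ≉ 0#) → ∏ f M ≉ 0#
      ∏≉0 f []      h e = char0 0 (trans (+-identityʳ 1#) e)
      ∏≉0 f (m ∷ M) h = x*y≉0 (h m) (∏≉0 f M h)

    module _ (p₁ p₂ v₁ v₂ : Carrier) (M X : Vec Carrier k)
             (P-generic : Generic x y (p₁ ∷ p₂ ∷ M)) (V-generic : Generic x y (v₁ ∷ v₂ ∷ X))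
             (ab≉0 : ∀ i j → ab (lookup (p₁ ∷ p₂ ∷ M) i) (lookup (v₁ ∷ v₂ ∷ X) j) ≉ 0#) where

      private
        P : Vec Carrier (suc (suc k))
        P = p₁ ∷ p₂ ∷ M
        Y X′ : Vec Carrier (suc k)
        Y  = v₁ ∷ X
        X′ = v₂ ∷ X

        -- `G` turns a product of the `ab q v` over `Y` into the product over `X′`, and `H` turns a
        -- product of the `ab w p` over `P` into the product over `M`. With these factors the terms
        -- of the row expansion and of the column expansion coincide.
        G H : Carrier → Carrier
        G q = ab q v₂ * inv (ab q v₁)
        H w = inv (ab p₁ w * ab p₂ w)

        ab≉0-Y : ∀ j i → ab (lookup P j) (lookup Y i) ≉ 0#
        ab≉0-Y j zero    = ab≉0 j zero
        ab≉0-Y j (suc i) = ab≉0 j (suc (suc i))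

        g : Fin (suc (suc k)) → Carrier
        g j = W x y X′ (removeAt P j) * G (lookup P j) * ∏ (λ r → inv (lookup P j - r)) (removeAt P j)

        h : Fin (suc k) → Carrier
        h i = W x y M (removeAt Y i) * ∏ (λ v → inv (lookup Y i - v)) (removeAt Y i) * H (lookup Y i)

        -- Multiplication by `ab q w` completes the two products that lack a factor, the one over
        -- `Y` without w and the one over `P` without q.
        balance : ∀ i j → let w = lookup Y i ; q = lookup P j in
          ∏ (λ m → ab m w) M * ∏ (ab q) (removeAt Y i) * G q ≈
          ∏ (λ v → ab v q) X′ * ∏ (ab w) (removeAt P j) * H w
        balance i j = *-cancelˡ (ab≉0-Y j i) (begin
          ab q w * (∏ (λ m → ab m w) M * ∏ (ab q) (removeAt Y i) * G q)
            ≈⟨ solve 4 (λ a b c d → a :* (b :* c :* d) := b :* (a :* c) :* d) refl _ _ _ _ ⟩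
          ∏ (λ m → ab m w) M * (ab q w * ∏ (ab q) (removeAt Y i)) * G q
            ≈⟨ *-congʳ (*-congˡ (∏-pick x y (ab q) (pick x y Y i))) ⟨
          ∏ (λ m → ab m w) M * (ab q v₁ * ∏ (ab q) X) * (ab q v₂ * inv (ab q v₁))
            ≈⟨ solve 5 (λ a b c d e → a :* (b :* c) :* (d :* e) := (b :* e) :* (a :* c :* d)) refl _ _ _ _ _ ⟩
          (ab q v₁ * inv (ab q v₁)) * (∏ (λ m → ab m w) M * ∏ (ab q) X * ab q v₂)
            ≈⟨ *-congʳ (trans (inverseʳ _ (ab≉0 j zero)) (sym (inverseʳ _ (x*y≉0 (ab≉0-Y zero i) (ab≉0-Y (suc zero) i))))) ⟩
          (ab p₁ w * ab p₂ w * H w) * (∏ (λ m → ab m w) M * ∏ (ab q) X * ab q v₂)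
            ≈⟨ solve 6 (λ a b c d e f → (a :* b :* c) :* (d :* e :* f) := (f :* e) :* (a :* (b :* d)) :* c) refl _ _ _ _ _ _ ⟩
          (ab q v₂ * ∏ (ab q) X) * (ab p₁ w * (ab p₂ w * ∏ (λ m → ab m w) M)) * H w
            ≈⟨ *-congʳ (*-cong (∏-cong X′ X′ λ _ → ab-comm _ _) (∏-cong P P λ _ → ab-comm _ _)) ⟩
          ∏ (λ v → ab v q) X′ * ∏ (ab w) P * H w
            ≈⟨ *-congʳ (*-congˡ (trans (∏-pick x y (ab w) (pick x y P j)) (*-congʳ (ab-comm w q)))) ⟩
          ∏ (λ v → ab v q) X′ * (ab q w * ∏ (ab w) (removeAt P j)) * H w
            ≈⟨ solve 4 (λ a b c d → b :* (a :* c) :* d := a :* (b :* c :* d)) refl _ _ _ _ ⟩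
          ab q w * (∏ (λ v → ab v q) X′ * ∏ (ab w) (removeAt P j) * H w) ∎)
          where
          w = lookup Y i
          q = lookup P j

        terms : ∀ i j → g j * rowExpansionTerm x y M Y (lookup P j) i ≈
                        h i * rowExpansionTerm x y X′ P (lookup Y i) j
        terms i j = begin
          w₁ * G q * d₁ * (w₂ * (e * ∏ (λ v → ab q v * inv (w - v)) (removeAt Y i)))
            ≈⟨ *-congˡ (*-congˡ (*-congˡ (∏-* x y _ _ (removeAt Y i)))) ⟩
          w₁ * G q * d₁ * (w₂ * (e * (∏ (ab q) (removeAt Y i) * d₂)))
            ≈⟨ solve 7 (λ w₁ G d₁ w₂ e f d₂ → w₁ :* G :* d₁ :* (w₂ :* (e :* (f :* d₂))) :=
                 (w₁ :* d₁ :* w₂ :* d₂) :* (e :* f :* G)) refl _ _ _ _ _ _ _ ⟩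
          (w₁ * d₁ * w₂ * d₂) * (e * ∏ (ab q) (removeAt Y i) * G q)
            ≈⟨ *-congˡ (balance i j) ⟩
          (w₁ * d₁ * w₂ * d₂) * (e′ * ∏ (ab w) (removeAt P j) * H w)
            ≈⟨ solve 7 (λ w₁ H d₁ w₂ e f d₂ → (w₁ :* d₁ :* w₂ :* d₂) :* (e :* f :* H) :=
                 w₂ :* d₂ :* H :* (w₁ :* (e :* (f :* d₁)))) refl _ _ _ _ _ _ _ ⟩
          w₂ * d₂ * H w * (w₁ * (e′ * (∏ (ab w) (removeAt P j) * d₁)))
            ≈⟨ *-congˡ (*-congˡ (*-congˡ (∏-* x y _ _ (removeAt P j)))) ⟨
          h i * rowExpansionTerm x y X′ P w j ∎
          where
          w = lookup Y i
          q = lookup P j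
          w₁ = W x y X′ (removeAt P j)
          w₂ = W x y M (removeAt Y i)
          d₁ = ∏ (λ r → inv (q - r)) (removeAt P j)
          d₂ = ∏ (λ v → inv (w - v)) (removeAt Y i)
          e  = ∏ (λ m → ab m w) M
          e′ = ∏ (λ v → ab v q) X′

        rowSum : Fin (suc (suc k)) → Carrier
        rowSum j = g j * (∏ (λ m → y * (lookup P j - m)) M * W x y (lookup P j ∷ M) Y)

        columnSum : Fin (suc k) → Carrier
        columnSum i = h i * (∏ (λ v → y * (lookup Y i - v)) X′ * W x y (lookup Y i ∷ X′) P)

        doubleSum : sum rowSum ≈ sum columnSum
        doubleSum = begin
          sum rowSum
            ≈⟨ sum-cong-≋ (λ j → trans (*-congˡ (rowExpansion x y x≉0 y≉0 M Y (Generic-drop₁ V-generic) (lookup P j)))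
                                   (*-distribˡ-sum (g j) (rowExpansionTerm x y M Y (lookup P j)))) ⟩
          sum (λ j → sum (λ i → g j * rowExpansionTerm x y M Y (lookup P j) i))
            ≈⟨ ∑-comm (λ j i → g j * rowExpansionTerm x y M Y (lookup P j) i) ⟩
          sum (λ i → sum (λ j → g j * rowExpansionTerm x y M Y (lookup P j) i))
            ≈⟨ sum-cong-≋ (λ i → sum-cong-≋ (terms i)) ⟩
          sum (λ i → sum (λ j → h i * rowExpansionTerm x y X′ P (lookup Y i) j))
            ≈⟨ sum-cong-≋ (λ i → trans (*-congˡ (rowExpansion x y x≉0 y≉0 X′ P P-generic (lookup Y i)))
                                   (*-distribˡ-sum (h i) (rowExpansionTerm x y X′ P (lookup Y i)))) ⟨
          sum columnSum ∎

        Yᵏ : Carrier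
        Yᵏ = ∏ (λ _ → y) M

        y*[q-q]≈0 : ∀ q → y * (q - q) ≈ 0#
        y*[q-q]≈0 = solve 2 (λ y q → y :* (q :- q) := :0) refl y

        open Generic x y P-generic using () renaming (distinct to P-distinct)
        open Generic x y V-generic using () renaming (distinct to V-distinct)

        -- For q in `M` the product of the differences q - m contains a 0, so only p₁ and p₂
        -- contribute.
        rowSums : sum rowSum ≈ Yᵏ *
          ( inv (p₁ - p₂) * G p₁ * (W x y X′ (p₂ ∷ M) * W x y (p₁ ∷ M) Y)
          + inv (p₂ - p₁) * G p₂ * (W x y X′ (p₁ ∷ M) * W x y (p₂ ∷ M) Y))
        rowSums = begin
          rowSum zero + (rowSum (suc zero) + sum (λ j → rowSum (suc (suc j))))
            ≈⟨ +-cong (part _ _ _ _ _ _ (∏-inverse p₁ M λ i → P-distinct zero (suc (suc i)) λ ()))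
                      (+-cong (part _ _ _ _ _ _ (∏-inverse p₂ M λ i → P-distinct (suc zero) (suc (suc i)) λ ()))
                        (sum-0 x y (λ j → rowSum (suc (suc j))) λ j →
                          trans (*-congˡ (trans (*-congʳ (∏-0 x y (λ m → y * (lookup M j - m)) M j (y*[q-q]≈0 _))) (zeroˡ _)))
                                (zeroʳ _))) ⟩
          _ + (_ + 0#)
            ≈⟨ solve 3 (λ a b c → a :* b :+ (a :* c :+ :0) := a :* (b :+ c)) refl _ _ _ ⟩
          _ ∎
          where
          part : ∀ w G i d e w′ → d * e ≈ Yᵏ → w * G * (i * d) * (e * w′) ≈ Yᵏ * (i * G * (w * w′))
          part w G i d e w′ de = trans
            (solve 6 (λ w G i d e w′ → w :* G :* (i :* d) :* (e :* w′) := (d :* e) :* (i :* G :* (w :* w′))) refl w G i d e w′)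
            (*-congʳ de)

        -- For w in `X`, which is part of `X′`, the product of the differences w - v contains a 0,
        -- so only v₁ contributes.
        columnSums : sum columnSum ≈ Yᵏ * (y * (v₁ - v₂) * H v₁ * (W x y M X * W x y (v₁ ∷ X′) P))
        columnSums = begin
          sum columnSum
            ≈⟨ sum-single x y columnSum zero (λ
                 { zero    i≢j → ⊥-elim (i≢j ≡.refl)
                 ; (suc j) _   → trans (*-congˡ (trans (*-congʳ (∏-0 x y (λ v → y * (lookup X j - v)) X′ (suc j) (y*[q-q]≈0 _))) (zeroˡ _)))
                                       (zeroʳ _) }) ⟩
          columnSum zero
            ≈⟨ solve 6 (λ w d H z e w′ → w :* d :* H :* (z :* e :* w′) := (d :* e) :* (z :* H :* (w :* w′))) refl _ _ _ _ _ _ ⟩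
          (∏ (λ v → inv (v₁ - v)) X * ∏ (λ v → y * (v₁ - v)) X) * (y * (v₁ - v₂) * H v₁ * (W x y M X * W x y (v₁ ∷ X′) P))
            ≈⟨ *-congʳ (trans (∏-inverse v₁ X λ i → V-distinct zero (suc (suc i)) λ ()) (∏-cong X M λ _ → refl)) ⟩
          _ ∎

      bilinear-generic :
        y * (p₁ - p₂) * (v₁ - v₂) * (W x y (p₁ ∷ p₂ ∷ M) (v₁ ∷ v₂ ∷ X) * W x y M X) ≈
        ab p₁ v₂ * ab p₂ v₁ * (W x y (p₂ ∷ M) (v₂ ∷ X) * W x y (p₁ ∷ M) (v₁ ∷ X))
        - ab p₁ v₁ * ab p₂ v₂ * (W x y (p₁ ∷ M) (v₂ ∷ X) * W x y (p₂ ∷ M) (v₁ ∷ X))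
      bilinear-generic = begin
        y * (p₁ - p₂) * (v₁ - v₂) * (w₀ * w₁)
          -- The inserted `ab p₁ v₁ * ab p₂ v₁ * H v₁` is 1. It provides the `H v₁` of `main`, and
          -- its other factors later clear the denominators of `G p₁` and `G p₂`.
          ≈⟨ trans (*-congˡ (inverseʳ _ (x*y≉0 (ab≉0 zero zero) (ab≉0 (suc zero) zero)))) (*-identityʳ _) ⟨
        y * (p₁ - p₂) * (v₁ - v₂) * (w₀ * w₁) * (ab p₁ v₁ * ab p₂ v₁ * H v₁)
          ≈⟨ solve 8 (λ y p v w₀ w₁ a b H → y :* p :* v :* (w₀ :* w₁) :* (a :* b :* H) :=
               (p :* a :* b) :* (y :* v :* H :* (w₁ :* w₀))) refl _ _ _ _ _ _ _ _ ⟩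
        ((p₁ - p₂) * ab p₁ v₁ * ab p₂ v₁) * (y * (v₁ - v₂) * H v₁ * (w₁ * w₀))
          ≈⟨ *-congˡ (trans (*-congˡ (*-congˡ (W-transpose x y P (v₁ ∷ X′)))) main) ⟩
        ((p₁ - p₂) * ab p₁ v₁ * ab p₂ v₁) *
          ( inv (p₁ - p₂) * G p₁ * (W x y X′ (p₂ ∷ M) * W x y (p₁ ∷ M) Y)
          + inv (p₂ - p₁) * G p₂ * (W x y X′ (p₁ ∷ M) * W x y (p₂ ∷ M) Y))
          ≈⟨ solve 12 (λ p q a b i j g₁ i₁ g₂ i₂ u v →
               ((p :- q) :* a :* b) :* (i :* (g₁ :* i₁) :* u :+ j :* (g₂ :* i₂) :* v) :=
               ((p :- q) :* i) :* (a :* i₁) :* (g₁ :* b :* u) :-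
               ((q :- p) :* j) :* (b :* i₂) :* (a :* g₂ :* v)) refl _ _ _ _ _ _ _ _ _ _ _ _ ⟩
        ((p₁ - p₂) * inv (p₁ - p₂)) * (ab p₁ v₁ * inv (ab p₁ v₁)) * (ab p₁ v₂ * ab p₂ v₁ * (W x y X′ (p₂ ∷ M) * W x y (p₁ ∷ M) Y)) -
        ((p₂ - p₁) * inv (p₂ - p₁)) * (ab p₂ v₁ * inv (ab p₂ v₁)) * (ab p₁ v₁ * ab p₂ v₂ * (W x y X′ (p₁ ∷ M) * W x y (p₂ ∷ M) Y))
          ≈⟨ +-cong (unit (inverseʳ _ (x≉y⇒x-y≉0 (P-distinct zero (suc zero) λ ()))) (inverseʳ _ (ab≉0 zero zero))
                          (*-congˡ (*-congʳ (W-transpose x y X′ (p₂ ∷ M)))))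
                    (-‿cong (unit (inverseʳ _ (x≉y⇒x-y≉0 (P-distinct (suc zero) zero λ ()))) (inverseʳ _ (ab≉0 (suc zero) zero))
                          (*-congˡ (*-congʳ (W-transpose x y X′ (p₁ ∷ M)))))) ⟩
        _ ∎
        where
        w₀ = W x y P (v₁ ∷ X′)
        w₁ = W x y M X

        main : y * (v₁ - v₂) * H v₁ * (w₁ * W x y (v₁ ∷ X′) P) ≈
               inv (p₁ - p₂) * G p₁ * (W x y X′ (p₂ ∷ M) * W x y (p₁ ∷ M) Y)
               + inv (p₂ - p₁) * G p₂ * (W x y X′ (p₁ ∷ M) * W x y (p₂ ∷ M) Y)
        -- The factor y^k that both sums carry is cancelled.
        main = *-cancelˡ (∏≉0 _ M λ _ → y≉0) (trans (sym columnSums) (trans (sym doubleSum) rowSums))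

        unit : ∀ {a b u v} → a ≈ 1# → b ≈ 1# → u ≈ v → a * b * u ≈ v
        unit {u = u} a≈1 b≈1 u≈v = trans (*-cong (*-cong a≈1 b≈1) u≈v) (trans (*-congʳ (*-identityˡ 1#)) (*-identityˡ _))

-- The bilinear identity for all parameters, by deformation along a line

module Everywhere {c ℓ} (K : CommutativeRing c ℓ) (F : IsField₀ K) where

  open CommutativeRing K hiding (zero)
  open IntSolver K
  open SixVertex K
  open Exchange K
  open Poly K F
  open Star K F using (Generic; AB)
  open Bilinear K F
  open import Data.Fin.Base as Fin using (toℕ)
  import Data.Fin.Properties as Fin
  open import Data.Vec.Base using (map; tabulate)
  open import Data.Vec.Properties using (lookup-map; lookup∘tabulate; tabulate∘lookup; tabulate-∘)
  open import Algebra.Properties.Semiring.Mult semiring using (×-homo-+; ×1-homo-*)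
  open import Relation.Binary.Reasoning.Setoid setoid

  private
    variable
      α β : Level
      I : Set α
      J : Set β
      m n : ℕ
      f g : Carrier → Carrier

  poly-sub : IsPolynomial f → IsPolynomial g → IsPolynomial (λ s → f s - g s)
  poly-sub p q = poly-+ p (poly-neg q)

  PolynomialWeights : (Carrier → Weights) → Set (c ⊔ ℓ)
  PolynomialWeights w = IsPolynomial (a₁ ∘ w) × IsPolynomial (a₂ ∘ w) × IsPolynomial (b ∘ w) × IsPolynomial (c₋ ∘ w)

  vertex-poly : ∀ {w : Carrier → Weights} → PolynomialWeights w → ∀ h t {k : Carrier → Bool → Bool → Carrier} →
                (∀ h t → IsPolynomial (λ s → k s h t)) → IsPolynomial (λ s → vertex (w s) h t (k s))
  vertex-poly (p , q , r , u) false false e = poly-+ (poly-* q (e _ _)) (e _ _)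
  vertex-poly (p , q , r , u) false true  e = poly-* r (e _ _)
  vertex-poly (p , q , r , u) true  false e = poly-* r (e _ _)
  vertex-poly (p , q , r , u) true  true  e = poly-+ (poly-* p (e _ _)) (poly-* u (e _ _))

  row-poly : ∀ {ω : Carrier → J → Weights} → (∀ j → PolynomialWeights (λ s → ω s j)) →
             ∀ (js : Vec J n) h t {k : Carrier → Bool → Vec Bool n → Carrier} →
             (∀ h t → IsPolynomial (λ s → k s h t)) → IsPolynomial (λ s → row (ω s) js h t (k s))
  row-poly ω-poly []       h []       e = e h []
  row-poly ω-poly (j ∷ js) h (t ∷ ts) e = vertex-poly (ω-poly j) h t λ h′ t′ →
    row-poly ω-poly js h′ ts λ h″ ts′ → e h″ (t′ ∷ ts′)

  rows-poly : ∀ {ω : Carrier → I → J → Weights} → (∀ i j → PolynomialWeights (λ s → ω s i j)) →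
              ∀ (is : Vec I m) (js : Vec J n) t k → IsPolynomial (λ s → rows (ω s) is js t k)
  rows-poly ω-poly []       js t k = poly-const _
  rows-poly ω-poly (i ∷ is) js t k = row-poly (ω-poly i) js false t λ
    { true  t → rows-poly ω-poly is js t k
    ; false t → poly-const 0# }

  A-cong : ∀ {x x′ y y′ p p′ w w′} → x ≈ x′ → y ≈ y′ → p ≈ p′ → w ≈ w′ → A x y p w ≈ A x′ y′ p′ w′
  A-cong ex ey ep ew = +-cong
    (*-cong (+-congˡ (*-cong ey ep)) (+-congˡ (*-cong ey ew)))
    (-‿cong (*-cong (*-cong ey ep) ew))

  B-cong : ∀ {x x′ y y′ p p′ w w′} → x ≈ x′ → y ≈ y′ → p ≈ p′ → w ≈ w′ → B x y p w ≈ B x′ y′ p′ w′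
  B-cong ex ey ep ew = +-congˡ (-‿cong (*-cong (*-cong (*-cong ex ey) ep) ew))

  κ-cong : ∀ {x x′ y y′ p p′} → x ≈ x′ → y ≈ y′ → p ≈ p′ → κ x y p ≈ κ x′ y′ p′
  κ-cong ex ey ep = +-cong (+-congˡ (*-cong (+-congʳ (+-cong ex ey)) ep)) (*-cong (*-cong (*-cong ex ey) ep) ep)

  six-cong : ∀ {x x′ y y′ p p′ w w′} → x ≈ x′ → y ≈ y′ → p ≈ p′ → w ≈ w′ → six x y p w ≈ʷ six x′ y′ p′ w′
  six-cong ex ey ep ew = *-cong ex (A-cong ex ey ep ew) , A-cong ex ey ep ew , B-cong ex ey ep ew ,
    *-cong (*-cong ey (κ-cong ex ey ep)) (κ-cong ex ey ew)

  module _ {x y p w : Carrier → Carrier} (px : IsPolynomial x) (py : IsPolynomial y)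
           (pp : IsPolynomial p) (pw : IsPolynomial w) where

    private
      p1 : IsPolynomial (λ _ → 1#)
      p1 = poly-const 1#

    A-poly : IsPolynomial (λ s → A (x s) (y s) (p s) (w s))
    A-poly = poly-sub (poly-* (poly-+ p1 (poly-* py pp)) (poly-+ p1 (poly-* py pw))) (poly-* (poly-* py pp) pw)

    B-poly : IsPolynomial (λ s → B (x s) (y s) (p s) (w s))
    B-poly = poly-sub p1 (poly-* (poly-* (poly-* px py) pp) pw)

    cross-poly : IsPolynomial (λ s → cross (x s) (y s) (p s) (w s))
    cross-poly = poly-+ (poly-+ (poly-+ p1 (poly-* (poly-sub py p1) pp)) (poly-* px pw))
                        (poly-* (poly-* (poly-* px py) pp) pw)

    κ-poly : IsPolynomial (λ s → κ (x s) (y s) (p s))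
    κ-poly = poly-+ (poly-+ p1 (poly-* (poly-sub (poly-+ px py) p1) pp)) (poly-* (poly-* (poly-* px py) pp) pp)

  six-poly : ∀ {x y p w} → IsPolynomial x → IsPolynomial y → IsPolynomial p → IsPolynomial w →
             PolynomialWeights (λ s → six (x s) (y s) (p s) (w s))
  six-poly px py pp pw = poly-* px (A-poly px py pp pw) , A-poly px py pp pw , B-poly px py pp pw ,
    poly-* (poly-* py (κ-poly px py pp pp)) (κ-poly px py pw pw)

  module _ {k : ℕ} (x y p₁ p₂ v₁ v₂ : Carrier) (M X : Vec Carrier k) where

    private
      line : Carrier → Carrier → Carrier → Carrier
      line g t s = s * t + (1# - s) * g

      line-0 : ∀ g t → line g t 0# ≈ g
      line-0 = solve 2 (λ g t → :0 :* t :+ (:1 :- :0) :* g := g) refl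

      line-1 : ∀ g t → line g t 1# ≈ t
      line-1 = solve 2 (λ g t → :1 :* t :+ (:1 :- :1) :* g := t) refl

      line-poly : ∀ g t → IsPolynomial (line g t)
      line-poly g t = poly-+ (poly-* poly-id (poly-const t)) (poly-* (poly-sub (poly-const 1#) poly-id) (poly-const g))

      -- At s = 0 all the nondegeneracy conditions hold, and s = 1 gives the
      -- parameters we want.
      source : Fin (suc (suc k)) → Carrier
      source i = fromℕ (suc (suc (toℕ i)))

      xₛ yₛ : Carrier → Carrier
      xₛ = line 1# x
      yₛ = line 1# y

      P V : Carrier → Fin (suc (suc k)) → Carrier
      P s i = line (source i) (lookup (p₁ ∷ p₂ ∷ M) i) s
      V s i = line (source i) (lookup (v₁ ∷ v₂ ∷ X) i) s

      x-poly : IsPolynomial xₛ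
      x-poly = line-poly _ _
      y-poly : IsPolynomial yₛ
      y-poly = line-poly _ _
      P-poly : ∀ i → IsPolynomial (λ s → P s i)
      P-poly i = line-poly _ _
      V-poly : ∀ i → IsPolynomial (λ s → V s i)
      V-poly i = line-poly _ _

      shift : Fin k → Fin (suc (suc k))
      shift i = suc (suc i)

      -- Parameter vectors are written as images of vectors of positions, so that all partition
      -- functions of the identity move along the same line.
      rest : Vec (Fin (suc (suc k))) k
      rest = tabulate shift

      i₁₂ : Vec (Fin (suc (suc k))) (suc (suc k))
      i₁₂ = zero ∷ suc zero ∷ rest

      i₁ i₂ : Vec (Fin (suc (suc k))) (suc k)
      i₁ = zero ∷ rest
      i₂ = suc zero ∷ rest

      lookup-rest : ∀ {A : Set c} (f : Fin (suc (suc k)) → A) i → lookup (map f i₁₂) i ≡ f i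
      lookup-rest f zero          = ≡.refl
      lookup-rest f (suc zero)    = ≡.refl
      lookup-rest f (suc (suc i)) = ≡.trans (lookup-map i f rest) (≡.cong f (lookup∘tabulate shift i))

      w : ∀ {m n} → Vec (Fin (suc (suc k))) m → Vec (Fin (suc (suc k))) n → Carrier → Carrier
      w is js s = W (xₛ s) (yₛ s) (map (P s) is) (map (V s) js)

      -- The maps are absorbed into the weights. These then live on fixed positions and depend
      -- polynomially on s, which is the form that `rows-poly` handles.
      w-poly : ∀ {m n} (is : Vec _ m) (js : Vec _ n) → IsPolynomial (w is js)
      w-poly is js = poly-resp
        (λ s → partition-cong (map (P s) is) is (map (V s) js) js λ p q →
          six-cong refl refl (reflexive (lookup-map p (P s) is)) (reflexive (lookup-map q (V s) js)))
        (rows-poly (λ i j → six-poly x-poly y-poly (P-poly i) (V-poly j)) is js _ allTrue)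

      fromℕ-1 : fromℕ 1 ≈ 1#
      fromℕ-1 = +-identityʳ 1#

      source≉0 : ∀ i → source i ≉ 0#
      source≉0 i = char0 (suc (toℕ i))

      slope-0 : ∀ {t u} → t ≈ u → 1# + (yₛ 0# - 1#) * t ≈ 1#
      slope-0 {t} _ = trans (+-congˡ (*-congʳ (+-congʳ (line-0 1# y)))) (solve 1 (λ t → :1 :+ (:1 :- :1) :* t := :1) refl t)

      -- At x = y = 1 the quantity is 1 + v + uv, and in the next lemma it is 1 + u + v; at natural
      -- numbers both are positive.
      cross-0 : ∀ {t t′} m n → t ≈ fromℕ m → t′ ≈ fromℕ n → cross (xₛ 0#) (yₛ 0#) t t′ ≉ 0#
      cross-0 {t} {t′} m n et et′ e = char0 (n ℕ.+ m ℕ.* n) (begin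
        fromℕ (suc (n ℕ.+ m ℕ.* n))             ≈⟨ +-congˡ (×-homo-+ 1# n (m ℕ.* n)) ⟩
        1# + (fromℕ n + fromℕ (m ℕ.* n))        ≈⟨ +-congˡ (+-cong (sym et′) (trans (×1-homo-* m n) (sym (*-cong et et′)))) ⟩
        1# + (t′ + t * t′)                      ≈⟨ solve 2 (λ u v → :1 :+ (v :+ u :* v) := :cross :1 :1 u v) refl t t′ ⟩
        cross 1# 1# t t′                        ≈⟨ cross-congˣʸ ⟨
        cross (xₛ 0#) (yₛ 0#) t t′              ≈⟨ e ⟩
        0#                                      ∎)
        where
        cross-congˣʸ : cross (xₛ 0#) (yₛ 0#) t t′ ≈ cross 1# 1# t t′
        cross-congˣʸ = +-cong (+-cong (+-congˡ (*-congʳ (+-congʳ (line-0 1# y)))) (*-congʳ (line-0 1# x)))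
          (*-congʳ (*-congʳ (*-cong (line-0 1# x) (line-0 1# y))))

      A-0 : ∀ {t t′} m n → t ≈ fromℕ m → t′ ≈ fromℕ n → A (xₛ 0#) (yₛ 0#) t t′ ≉ 0#
      A-0 {t} {t′} m n et et′ e = char0 (m ℕ.+ n) (begin
        fromℕ (suc (m ℕ.+ n))                   ≈⟨ +-congˡ (×-homo-+ 1# m n) ⟩
        1# + (fromℕ m + fromℕ n)                ≈⟨ +-congˡ (+-cong et et′) ⟨
        1# + (t + t′)                           ≈⟨ solve 2 (λ u v → :1 :+ (u :+ v) := :A :1 :1 u v) refl t t′ ⟩
        A 1# 1# t t′                            ≈⟨ A-cong (line-0 1# x) (line-0 1# y) refl refl ⟨
        A (xₛ 0#) (yₛ 0#) t t′                  ≈⟨ e ⟩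
        0#                                      ∎)

      -- At x = y = 1 this is 1 - uv. The source parameters start at 2 rather than 1 so that uv is
      -- never 1.
      B-0 : ∀ {t t′} m n → t ≈ fromℕ (suc (suc m)) → t′ ≈ fromℕ (suc (suc n)) → B (xₛ 0#) (yₛ 0#) t t′ ≉ 0#
      B-0 {t} {t′} m n et et′ e = 1+≢1 (fromℕ-injective (begin
        fromℕ (suc (suc m) ℕ.* suc (suc n))     ≈⟨ ×1-homo-* (suc (suc m)) (suc (suc n)) ⟩
        fromℕ (suc (suc m)) * fromℕ (suc (suc n)) ≈⟨ *-cong et et′ ⟨
        t * t′                                  ≈⟨ solve 2 (λ u v → u :* v := :1 :- :B :1 :1 u v) refl t t′ ⟩
        1# - B 1# 1# t t′                       ≈⟨ +-congˡ (-‿cong (B-cong (line-0 1# x) (line-0 1# y) refl refl)) ⟨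
        1# - B (xₛ 0#) (yₛ 0#) t t′             ≈⟨ +-congˡ (-‿cong e) ⟩
        1# - 0#                                 ≈⟨ solve 0 (:1 :- :0 := :1) refl ⟩
        1#                                      ≈⟨ fromℕ-1 ⟨
        fromℕ 1                                 ∎))
        where
        1+≢1 : suc (suc m) ℕ.* suc (suc n) ≢ 1
        1+≢1 ()

      generic : (Q : Fin (suc (suc k)) → Carrier) →
                Generically (λ s → Generic (xₛ s) (yₛ s) (map (λ i → line (source i) (Q i) s) i₁₂))
      generic Q = generically-map
        (λ s (h₁ , h₂ , h₃ , h₄) → record
          { ≉0       = λ i → ≡.subst (_≉ 0#) (≡.sym (lookup-rest (T s) i)) (h₁ i)
          ; slope≉0  = λ i → ≡.subst (λ t → 1# + (yₛ s - 1#) * t ≉ 0#) (≡.sym (lookup-rest (T s) i)) (h₂ i)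
          ; distinct = λ i j i≢j → ≡.subst₂ _≉_ (≡.sym (lookup-rest (T s) i)) (≡.sym (lookup-rest (T s) j)) (h₃ i j i≢j)
          ; cross≉0  = λ i j → ≡.subst₂ (λ t u → cross (xₛ s) (yₛ s) t u ≉ 0#)
                         (≡.sym (lookup-rest (T s) i)) (≡.sym (lookup-rest (T s) j)) (h₄ i j)
          })
        (generically-×
          (generically-∀ λ i → generically-≉0 (T-poly i) λ e → source≉0 i (trans (sym (line-0 _ _)) e))
        (generically-×
          (generically-∀ λ i → generically-≉0
            (poly-+ (poly-const 1#) (poly-* (poly-sub y-poly (poly-const 1#)) (T-poly i)))
            λ e → 1≉0 (trans (sym (slope-0 refl)) e))
        (generically-×
          (generically-∀ λ i → generically-∀ λ j → distinct i j)
          (generically-∀ λ i → generically-∀ λ j → generically-≉0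
            (cross-poly x-poly y-poly (T-poly i) (T-poly j)) (cross-0 (suc (suc (toℕ i))) (suc (suc (toℕ j))) (line-0 _ _) (line-0 _ _))))))
        where
        T : Carrier → Fin (suc (suc k)) → Carrier
        T s i = line (source i) (Q i) s
        T-poly : ∀ i → IsPolynomial (λ s → T s i)
        T-poly i = line-poly _ _
        distinct : ∀ i j → Generically (λ s → i ≢ j → T s i ≉ T s j)
        distinct i j with i Fin.≟ j
        ... | yes i≡j = generically-always λ s i≢j → ⊥-elim (i≢j i≡j)
        ... | no  i≢j = generically-map
          (λ s h _ e → h (trans (+-congʳ e) (-‿inverseʳ _)))
          (generically-≉0 (poly-sub (T-poly i) (T-poly j)) λ e → i≢j (Fin.toℕ-injective
            (ℕ.suc-injective (ℕ.suc-injective (fromℕ-injective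
              (trans (sym (line-0 _ _)) (trans (x-y≈0⇒x≈y _ _ e) (line-0 _ _))))))))

      AB≉0 : Generically (λ s → ∀ i j →
        A (xₛ s) (yₛ s) (lookup (map (P s) i₁₂) i) (lookup (map (V s) i₁₂) j)
        * B (xₛ s) (yₛ s) (lookup (map (P s) i₁₂) i) (lookup (map (V s) i₁₂) j)
        ≉ 0#)
      AB≉0 = generically-map
        (λ s h i j → ≡.subst₂ (λ t u → A (xₛ s) (yₛ s) t u * B (xₛ s) (yₛ s) t u ≉ 0#)
          (≡.sym (lookup-rest (P s) i)) (≡.sym (lookup-rest (V s) j)) (h i j))
        (generically-∀ λ i → generically-∀ λ j → generically-≉0
          (poly-* (A-poly x-poly y-poly (P-poly i) (V-poly j)) (B-poly x-poly y-poly (P-poly i) (V-poly j)))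
          (x*y≉0 (A-0 (suc (suc (toℕ i))) (suc (suc (toℕ j))) (line-0 _ _) (line-0 _ _))
                 (B-0 (toℕ i) (toℕ j) (line-0 _ _) (line-0 _ _))))

      P₁ P₂ V₁ V₂ : Carrier → Carrier
      P₁ s = P s zero
      P₂ s = P s (suc zero)
      V₁ s = V s zero
      V₂ s = V s (suc zero)

      ab : (p v : Carrier → Carrier) → Carrier → Carrier
      ab p v s = A (xₛ s) (yₛ s) (p s) (v s) * B (xₛ s) (yₛ s) (p s) (v s)

      left right : Carrier → Carrier
      left s = yₛ s * (P₁ s - P₂ s) * (V₁ s - V₂ s) *
        (w i₁₂ i₁₂ s * w rest rest s)
      right s =
        ab P₁ V₂ s * ab P₂ V₁ s * (w i₂ i₂ s * w i₁ i₁ s)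
        - ab P₁ V₁ s * ab P₂ V₂ s * (w i₁ i₂ s * w i₂ i₁ s)

      -- The difference is a polynomial in s that vanishes wherever `bilinear-generic` applies, and
      -- the hypotheses of the latter are generic because they hold at s = 0.
      difference≈0 : ∀ s → left s - right s ≈ 0#
      difference≈0 = generically-≈0
        (poly-sub
          (poly-* (poly-* (poly-* y-poly (poly-sub (P-poly zero) (P-poly (suc zero)))) (poly-sub (V-poly zero) (V-poly (suc zero))))
                  (poly-* (w-poly i₁₂ i₁₂) (w-poly rest rest)))
          (poly-sub (poly-* (poly-* (ab-poly zero (suc zero)) (ab-poly (suc zero) zero)) (poly-* (w-poly i₂ i₂) (w-poly i₁ i₁)))
                    (poly-* (poly-* (ab-poly zero zero) (ab-poly (suc zero) (suc zero))) (poly-* (w-poly i₁ i₂) (w-poly i₂ i₁)))))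
        (generically-map
          (λ s (hx , hy , hP , hV , hAB) → trans
            (+-congʳ (bilinear-generic hx hy (P₁ s) (P₂ s) (V₁ s) (V₂ s) (map (P s) rest) (map (V s) rest) hP hV hAB)) (-‿inverseʳ _))
          (generically-× (generically-≉0 x-poly λ e → 1≉0 (trans (sym (line-0 1# x)) e))
          (generically-× (generically-≉0 y-poly λ e → 1≉0 (trans (sym (line-0 1# y)) e))
          (generically-× (generic (lookup (p₁ ∷ p₂ ∷ M))) (generically-× (generic (lookup (v₁ ∷ v₂ ∷ X))) AB≉0)))))
        where
        ab-poly : ∀ i j → IsPolynomial (ab (λ s → P s i) (λ s → V s j))
        ab-poly i j = poly-* (A-poly x-poly y-poly (P-poly i) (V-poly j)) (B-poly x-poly y-poly (P-poly i) (V-poly j))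

      w-1 : ∀ {m n} (is : Vec (Fin (suc (suc k))) m) (js : Vec (Fin (suc (suc k))) n) →
            w is js 1# ≈ W x y (map (lookup (p₁ ∷ p₂ ∷ M)) is) (map (lookup (v₁ ∷ v₂ ∷ X)) js)
      w-1 is js = partition-cong (map (P 1#) is) (map P′ is) (map (V 1#) js) (map V′ js) λ p q →
        six-cong (line-1 1# x) (line-1 1# y)
          (trans (reflexive (lookup-map p (P 1#) is)) (trans (line-1 _ _) (reflexive (≡.sym (lookup-map p P′ is)))))
          (trans (reflexive (lookup-map q (V 1#) js)) (trans (line-1 _ _) (reflexive (≡.sym (lookup-map q V′ js)))))
        where
        P′ V′ : Fin (suc (suc k)) → Carrier
        P′ = lookup (p₁ ∷ p₂ ∷ M)
        V′ = lookup (v₁ ∷ v₂ ∷ X)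

      map-rest : ∀ (u v : Carrier) (N : Vec Carrier k) → map (lookup (u ∷ v ∷ N)) rest ≡ N
      map-rest u v N = ≡.trans (≡.sym (tabulate-∘ (lookup (u ∷ v ∷ N)) shift)) (tabulate∘lookup N)

      AB-1 : ∀ i j → ab (λ s → P s i) (λ s → V s j) 1# ≈
                     AB x y (lookup (p₁ ∷ p₂ ∷ M) i) (lookup (v₁ ∷ v₂ ∷ X) j)
      AB-1 i j = *-cong (A-cong (line-1 1# x) (line-1 1# y) (line-1 _ _) (line-1 _ _))
                        (B-cong (line-1 1# x) (line-1 1# y) (line-1 _ _) (line-1 _ _))

    bilinear :
      y * (p₁ - p₂) * (v₁ - v₂) * (W x y (p₁ ∷ p₂ ∷ M) (v₁ ∷ v₂ ∷ X) * W x y M X) ≈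
      AB x y p₁ v₂ * AB x y p₂ v₁ * (W x y (p₂ ∷ M) (v₂ ∷ X) * W x y (p₁ ∷ M) (v₁ ∷ X))
      - AB x y p₁ v₁ * AB x y p₂ v₂ * (W x y (p₁ ∷ M) (v₂ ∷ X) * W x y (p₂ ∷ M) (v₁ ∷ X))
    bilinear = ≡.subst₂ (λ M X →
      y * (p₁ - p₂) * (v₁ - v₂) * (W x y (p₁ ∷ p₂ ∷ M) (v₁ ∷ v₂ ∷ X) * W x y M X) ≈
      AB x y p₁ v₂ * AB x y p₂ v₁ * (W x y (p₂ ∷ M) (v₂ ∷ X) * W x y (p₁ ∷ M) (v₁ ∷ X))
      - AB x y p₁ v₁ * AB x y p₂ v₂ * (W x y (p₁ ∷ M) (v₂ ∷ X) * W x y (p₂ ∷ M) (v₁ ∷ X)))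
      (map-rest p₁ p₂ M) (map-rest v₁ v₂ X) (begin
        _        ≈⟨ *-cong (*-cong (*-cong (line-1 1# y) (+-cong (line-1 _ p₁) (-‿cong (line-1 _ p₂))))
                                   (+-cong (line-1 _ v₁) (-‿cong (line-1 _ v₂))))
                           (*-cong (w-1 i₁₂ i₁₂) (w-1 rest rest)) ⟨
        left 1#  ≈⟨ x-y≈0⇒x≈y _ _ (difference≈0 1#) ⟩
        right 1# ≈⟨ +-cong (*-cong (*-cong (AB-1 zero (suc zero)) (AB-1 (suc zero) zero))
                                   (*-cong (w-1 i₂ i₂) (w-1 i₁ i₁)))
                           (-‿cong (*-cong (*-cong (AB-1 zero zero) (AB-1 (suc zero) (suc zero)))
                                   (*-cong (w-1 i₁ i₂) (w-1 i₂ i₁)))) ⟩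
        _        ∎)

-- Transfer of integer polynomial identities between rings

module Term where

  open import Data.Integer.Base as ℤ using (ℤ; +_; 0ℤ; 1ℤ)
  open import Data.List.Base as List using (List; []; _∷_)
  open import Data.List.Relation.Unary.All as All using (All; []; _∷_)
  import Data.List.Relation.Unary.All.Properties as All

  infixl 6 _∔_
  infixl 7 _∙_

  -- A polynomial function over one ring says nothing about another ring, so identities that are to
  -- be transferred need a syntax which every commutative ring can evaluate.
  data Term (n : ℕ) : Set where
    var     : Fin n → Term n
    𝟘 𝟙     : Term n
    _∔_ _∙_ : Term n → Term n → Term n
    neg     : Term n → Term n

  private
    variable
      n : ℕ

  -- Coefficients with respect to the first variable, the constant one first.
  addᶜ mulᶜ : List (Term n) → List (Term n) → List (Term n)
  addᶜ []       ds       = ds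
  addᶜ (c ∷ cs) []       = c ∷ cs
  addᶜ (c ∷ cs) (d ∷ ds) = c ∔ d ∷ addᶜ cs ds
  mulᶜ []       ds       = []
  mulᶜ (c ∷ cs) ds       = addᶜ (List.map (c ∙_) ds) (𝟘 ∷ mulᶜ cs ds)

  coefficients : Term (suc n) → List (Term n)
  coefficients (var zero)    = 𝟘 ∷ 𝟙 ∷ []
  coefficients (var (suc i)) = var i ∷ []
  coefficients 𝟘             = []
  coefficients 𝟙             = 𝟙 ∷ []
  coefficients (s ∔ t)       = addᶜ (coefficients s) (coefficients t)
  coefficients (s ∙ t)       = mulᶜ (coefficients s) (coefficients t)
  coefficients (neg t)       = List.map neg (coefficients t)

  value : Term 0 → ℤ
  value 𝟘       = 0ℤ
  value 𝟙       = 1ℤ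
  value (s ∔ t) = value s ℤ.+ value t
  value (s ∙ t) = value s ℤ.* value t
  value (neg t) = ℤ.- value t

  module Evaluation {c ℓ} (R : CommutativeRing c ℓ) where

    open CommutativeRing R hiding (zero)
    open IntSolver R
    open import Relation.Binary.Reasoning.Setoid setoid

    ⟦_⟧ : Term n → (Fin n → Carrier) → Carrier
    ⟦ var i ⟧ ρ = ρ i
    ⟦ 𝟘 ⟧     ρ = 0#
    ⟦ 𝟙 ⟧     ρ = 1#
    ⟦ s ∔ t ⟧ ρ = ⟦ s ⟧ ρ + ⟦ t ⟧ ρ
    ⟦ s ∙ t ⟧ ρ = ⟦ s ⟧ ρ * ⟦ t ⟧ ρ
    ⟦ neg t ⟧ ρ = - ⟦ t ⟧ ρ

    ⟦⟧-cong : ∀ (t : Term n) {ρ σ} → (∀ i → ρ i ≈ σ i) → ⟦ t ⟧ ρ ≈ ⟦ t ⟧ σ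
    ⟦⟧-cong (var i) e = e i
    ⟦⟧-cong 𝟘       e = refl
    ⟦⟧-cong 𝟙       e = refl
    ⟦⟧-cong (s ∔ t) e = +-cong (⟦⟧-cong s e) (⟦⟧-cong t e)
    ⟦⟧-cong (s ∙ t) e = *-cong (⟦⟧-cong s e) (⟦⟧-cong t e)
    ⟦⟧-cong (neg t) e = -‿cong (⟦⟧-cong t e)

    horner : List (Term n) → (Fin n → Carrier) → Carrier → Carrier
    horner []       ρ r = 0#
    horner (c ∷ cs) ρ r = ⟦ c ⟧ ρ + r * horner cs ρ r

    private
      module _ (ρ : Fin n → Carrier) (r : Carrier) where

        horner-add : ∀ cs ds → horner (addᶜ cs ds) ρ r ≈ horner cs ρ r + horner ds ρ r
        horner-add []       ds       = sym (+-identityˡ _)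
        horner-add (c ∷ cs) []       = sym (+-identityʳ _)
        horner-add (c ∷ cs) (d ∷ ds) = trans (+-congˡ (*-congˡ (horner-add cs ds)))
          (solve 5 (λ c d r x y → (c :+ d) :+ r :* (x :+ y) := (c :+ r :* x) :+ (d :+ r :* y)) refl _ _ _ _ _)

        horner-scale : ∀ c ds → horner (List.map (c ∙_) ds) ρ r ≈ ⟦ c ⟧ ρ * horner ds ρ r
        horner-scale c []       = sym (zeroʳ _)
        horner-scale c (d ∷ ds) = trans (+-congˡ (*-congˡ (horner-scale c ds)))
          (solve 4 (λ c d r x → c :* d :+ r :* (c :* x) := c :* (d :+ r :* x)) refl _ _ _ _)

        horner-mul : ∀ cs ds → horner (mulᶜ cs ds) ρ r ≈ horner cs ρ r * horner ds ρ r
        horner-mul []       ds = sym (zeroˡ _)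
        horner-mul (c ∷ cs) ds = begin
          horner (addᶜ (List.map (c ∙_) ds) (𝟘 ∷ mulᶜ cs ds)) ρ r
            ≈⟨ horner-add (List.map (c ∙_) ds) _ ⟩
          horner (List.map (c ∙_) ds) ρ r + (0# + r * horner (mulᶜ cs ds) ρ r)
            ≈⟨ +-cong (horner-scale c ds) (+-congˡ (*-congˡ (horner-mul cs ds))) ⟩
          ⟦ c ⟧ ρ * horner ds ρ r + (0# + r * (horner cs ρ r * horner ds ρ r))
            ≈⟨ solve 4 (λ c x r y → c :* x :+ (:0 :+ r :* (y :* x)) := (c :+ r :* y) :* x) refl _ _ _ _ ⟩
          horner (c ∷ cs) ρ r * horner ds ρ r ∎

        horner-neg : ∀ cs → horner (List.map neg cs) ρ r ≈ - horner cs ρ r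
        horner-neg []       = solve 0 (:0 := :- :0) refl
        horner-neg (c ∷ cs) = trans (+-congˡ (*-congˡ (horner-neg cs)))
          (solve 3 (λ c r x → :- c :+ r :* (:- x) := :- (c :+ r :* x)) refl _ _ _)

    horner-coefficients : ∀ (t : Term (suc n)) ρ → ⟦ t ⟧ ρ ≈ horner (coefficients t) (ρ ∘ suc) (ρ zero)
    horner-coefficients (var zero)    ρ = solve 1 (λ r → r := :0 :+ r :* (:1 :+ r :* :0)) refl _
    horner-coefficients (var (suc i)) ρ = solve 2 (λ c r → c := c :+ r :* :0) refl _ (ρ zero)
    horner-coefficients 𝟘             ρ = refl
    horner-coefficients 𝟙             ρ = solve 1 (λ r → :1 := :1 :+ r :* :0) refl (ρ zero)
    horner-coefficients (s ∔ t)       ρ = trans (+-cong (horner-coefficients s ρ) (horner-coefficients t ρ))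
      (sym (horner-add _ _ (coefficients s) (coefficients t)))
    horner-coefficients (s ∙ t)       ρ = trans (*-cong (horner-coefficients s ρ) (horner-coefficients t ρ))
      (sym (horner-mul _ _ (coefficients s) (coefficients t)))
    horner-coefficients (neg t)       ρ = trans (-‿cong (horner-coefficients t ρ))
      (sym (horner-neg _ _ (coefficients t)))

    horner-0 : ∀ {cs : List (Term n)} {ρ} r → All (λ c → ⟦ c ⟧ ρ ≈ 0#) cs → horner cs ρ r ≈ 0#
    horner-0 r []       = refl
    horner-0 r (e ∷ es) = trans (+-cong e (*-congˡ (horner-0 r es)))
      (solve 1 (λ r → :0 :+ r :* :0 := :0) refl r)

    ⟦⟧-value : ∀ t ρ → ⟦ t ⟧ ρ ≈ fromℤ (value t)
    ⟦⟧-value 𝟘       ρ = refl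
    ⟦⟧-value 𝟙       ρ = sym (+-identityʳ 1#)
    ⟦⟧-value (s ∔ t) ρ = trans (+-cong (⟦⟧-value s ρ) (⟦⟧-value t ρ)) (sym (fromℤ-+ (value s) (value t)))
    ⟦⟧-value (s ∙ t) ρ = trans (*-cong (⟦⟧-value s ρ) (⟦⟧-value t ρ)) (sym (fromℤ-* (value s) (value t)))
    ⟦⟧-value (neg t) ρ = trans (-‿cong (⟦⟧-value t ρ)) (sym (fromℤ-neg (value t)))

  module _ {c ℓ} (K : CommutativeRing c ℓ) (F : IsField₀ K) where

    open CommutativeRing K hiding (zero)
    open IntSolver K
    open Poly K F
    open Evaluation K
    open import Relation.Binary.Reasoning.Setoid setoid

    private
      Degree-horner : ∀ (cs : List (Term n)) ρ → IsPolynomial (horner cs ρ)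
      Degree-horner []       ρ = poly-const 0#
      Degree-horner (c ∷ cs) ρ = poly-+ (poly-const _) (poly-* poly-id (Degree-horner cs ρ))

      horner≈0 : ∀ (cs : List (Term n)) ρ → (∀ r → horner cs ρ r ≈ 0#) → All (λ c → ⟦ c ⟧ ρ ≈ 0#) cs
      horner≈0 []       ρ h = []
      horner≈0 (c ∷ cs) ρ h = c≈0 ∷ horner≈0 cs ρ (zeroAwayFrom0 (proj₂ (Degree-horner cs ρ)) λ r r≉0 →
        x*y≈0⇒y≈0 r≉0 (trans (sym (trans (+-congʳ c≈0) (+-identityˡ _))) (h r)))
        where
        c≈0 : ⟦ c ⟧ ρ ≈ 0#
        c≈0 = trans (solve 2 (λ c x → c := c :+ :0 :* x) refl _ _) (h 0#)

      fromℤ≈0 : ∀ i → fromℤ i ≈ 0# → i ≡ 0ℤ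
      fromℤ≈0 (+ zero)      e = ≡.refl
      fromℤ≈0 (+ suc n)     e = ⊥-elim (char0 n e)
      fromℤ≈0 (ℤ.-[1+ n ])  e = ⊥-elim (char0 n (begin
        fromℕ (suc n)         ≈⟨ solve 1 (λ a → a := :- (:- a)) refl _ ⟩
        - - fromℕ (suc n)     ≈⟨ -‿cong e ⟩
        - 0#                  ≈⟨ solve 0 (:- :0 := :0) refl ⟩
        0#                    ∎))

    module _ {c′ ℓ′} (R : CommutativeRing c′ ℓ′) where

      private
        module R = CommutativeRing R
        module ER = Evaluation R

      -- Induction on the number of variables. A polynomial function that vanishes on a field of
      -- characteristic 0 has vanishing coefficients, and these are terms in one variable fewer;
      -- without variables, an integer that is 0 in the field is 0.
      transfer : ∀ (t : Term n) → (∀ ρ → ⟦ t ⟧ ρ ≈ 0#) → ∀ ρ → ER.⟦ t ⟧ ρ R.≈ R.0#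
      transferAll : ∀ (cs : List (Term n)) → All (λ c → ∀ ρ → ⟦ c ⟧ ρ ≈ 0#) cs → ∀ ρ → All (λ c → ER.⟦ c ⟧ ρ R.≈ R.0#) cs
      transfer {zero}  t h ρ = R.trans (ER.⟦⟧-value t ρ)
        (R.reflexive (≡.cong (IntSolver.fromℤ R) (fromℤ≈0 (value t) (trans (sym (⟦⟧-value t λ ())) (h _)))))
      transfer {suc n} t h ρ = R.trans (ER.horner-coefficients t ρ) (ER.horner-0 (ρ zero)
        (transferAll (coefficients t) (swap λ σ → horner≈0 (coefficients t) σ λ r →
          trans (sym (horner-coefficients t (r ▸ σ))) (h (r ▸ σ))) _))
        where
        _▸_ : Carrier → (Fin n → Carrier) → Fin (suc n) → Carrier
        (r ▸ σ) zero    = r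
        (r ▸ σ) (suc i) = σ i
        swap : ∀ {cs : List (Term n)} → (∀ σ → All (λ c → ⟦ c ⟧ σ ≈ 0#) cs) → All (λ c → ∀ σ → ⟦ c ⟧ σ ≈ 0#) cs
        swap {[]}     h = []
        swap {c ∷ cs} h = (λ σ → All.head (h σ)) ∷ swap λ σ → All.tail (h σ)
      transferAll []       []       ρ = []
      transferAll (c ∷ cs) (h ∷ hs) ρ = transfer c h ρ ∷ transferAll cs hs ρ

      -- A line joins any point to `ρ₀`, which lies off the hypersurface d = 0. Along this line t
      -- vanishes generically, hence everywhere, and in particular at its end.
      transferGeneric : ∀ (d t : Term n) ρ₀ → ⟦ d ⟧ ρ₀ ≉ 0# → (∀ ρ → ⟦ d ⟧ ρ ≉ 0# → ⟦ t ⟧ ρ ≈ 0#) →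
                        ∀ ρ → ER.⟦ t ⟧ ρ R.≈ R.0#
      transferGeneric d t ρ₀ d≉0 h = transfer t λ ρ → trans (⟦⟧-cong t λ i → sym (line-1 (ρ₀ i) (ρ i)))
        (generically-≈0 (⟦⟧-poly t ρ) (_ , ⟦⟧-poly d ρ , (λ e → d≉0 (trans (⟦⟧-cong d λ i → sym (line-0 (ρ₀ i) (ρ i))) e)) , λ s → h (line ρ s)) 1#)
        where
        line : (Fin _ → Carrier) → Carrier → Fin _ → Carrier
        line ρ s i = s * ρ i + (1# - s) * ρ₀ i
        line-0 : ∀ g t → 0# * t + (1# - 0#) * g ≈ g
        line-0 = solve 2 (λ g t → :0 :* t :+ (:1 :- :0) :* g := g) refl
        line-1 : ∀ g t → 1# * t + (1# - 1#) * g ≈ t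
        line-1 = solve 2 (λ g t → :1 :* t :+ (:1 :- :1) :* g := t) refl
        ⟦⟧-poly : ∀ t ρ → IsPolynomial (λ s → ⟦ t ⟧ (line ρ s))
        ⟦⟧-poly (var i) ρ = poly-+ (poly-* poly-id (poly-const (ρ i)))
          (poly-* (poly-+ (poly-const 1#) (poly-neg poly-id)) (poly-const (ρ₀ i)))
        ⟦⟧-poly 𝟘       ρ = poly-const 0#
        ⟦⟧-poly 𝟙       ρ = poly-const 1#
        ⟦⟧-poly (s ∔ t) ρ = poly-+ (⟦⟧-poly s ρ) (⟦⟧-poly t ρ)
        ⟦⟧-poly (s ∙ t) ρ = poly-* (⟦⟧-poly s ρ) (⟦⟧-poly t ρ)
        ⟦⟧-poly (neg t) ρ = poly-neg (⟦⟧-poly t ρ)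

-- The rational numbers as a field of characteristic 0

module RationalField where

  open import Data.Rational.Base using (ℚ; 0ℚ; 1ℚ; _*_; _<_; _≤_; 1/_; ≢-nonZero)
  import Data.Rational.Properties as ℚ
  open import Relation.Binary.PropositionalEquality using (sym)
  open import Relation.Nullary.Decidable using (toWitness)
  open IntSolver ℚ.+-*-commutativeRing using (fromℕ)

  private
    inverse : ℚ → ℚ
    inverse p with p ℚ.≟ 0ℚ
    -- A default value, about which `inverseʳ` makes no claim.
    ... | yes _   = 0ℚ
    ... | no  p≢0 = 1/_ p {{≢-nonZero p≢0}}

    *-inverse : ∀ p → p ≢ 0ℚ → p * inverse p ≡ 1ℚ
    *-inverse p p≢0 with p ℚ.≟ 0ℚ
    ... | yes p≡0 = ⊥-elim (p≢0 p≡0)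
    ... | no  p≢0 = ℚ.*-inverseʳ p {{≢-nonZero p≢0}}

    0<1 : 0ℚ < 1ℚ
    0<1 = toWitness {a? = 0ℚ ℚ.<? 1ℚ} _

    fromℕ≥0 : ∀ n → 0ℚ ≤ fromℕ n
    fromℕ>0 : ∀ n → 0ℚ < fromℕ (suc n)
    fromℕ≥0 zero    = ℚ.≤-refl
    fromℕ≥0 (suc n) = ℚ.<⇒≤ (fromℕ>0 n)
    fromℕ>0 n = ℚ.+-mono-<-≤ 0<1 (fromℕ≥0 n)

  ℚ-isField₀ : IsField₀ ℚ.+-*-commutativeRing
  ℚ-isField₀ = record
    { _≟_      = ℚ._≟_
    ; inv      = inverse
    ; inverseʳ = *-inverse
    ; char0    = λ n e → ℚ.<⇒≢ (fromℕ>0 n) (sym e)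
    }

-- Alternating sign matrices as six-vertex configurations

module Validity where

  open import Data.Integer.Base as ℤ using (ℤ; 0ℤ; 1ℤ; -1ℤ; sign)
  import Data.Integer.Properties as ℤ
  open import Algebra.Properties.CommutativeMonoid.Sum ℤ.+-0-commutativeMonoid using (sum)
  open import Data.List.Base using ([]; _∷_)
  open import Data.List.Relation.Unary.Any using (here; there)
  open import Data.List.Relation.Unary.Linked as Linked using (Linked; []; [-]; _∷_)
  open import Data.Sum.Base using (_⊎_; inj₁; inj₂)
  open import Data.Vec.Base using (transpose; map; _⊛_)
  open import Data.Vec.Properties using (lookup-⊛; lookup-replicate)
  open import Data.Vec.Relation.Unary.All as All using (All; []; _∷_)
  import Data.Vec.Relation.Unary.All.Properties as All
  open import Relation.Binary.PropositionalEquality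
  open import Data.List.Membership.DecPropositional ℤ._≟_ using (_∈_)

  private
    variable
      m n : ℕ
      h h′ : Bool
      s s′ : Vec Bool n
      v : Vec ℤ n

  trues : ∀ n → Vec Bool n
  trues n = replicate n true

  -- The partial sums of a line stay in {0, 1}, start at h and end at 1.
  data Path : Bool → Vec ℤ n → Set where
    done : Path true []
    zero : Path h v → Path h (0ℤ ∷ v)
    up   : Path true v → Path false (1ℤ ∷ v)
    down : Path false v → Path true (-1ℤ ∷ v)

  -- Reading a row, from left to right: h and h′ are its partial sums before and
  -- after, s and s′ those of the columns above and below it.
  data Row : Bool → Vec Bool n → Vec ℤ n → Bool → Vec Bool n → Set where
    done : Row h [] [] h []
    zero : ∀ {t} → Row h s v h′ s′ → Row h (t ∷ s) (0ℤ ∷ v) h′ (t ∷ s′)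
    up   : Row true s v h′ s′ → Row false (false ∷ s) (1ℤ ∷ v) h′ (true ∷ s′)
    down : Row false s v h′ s′ → Row true (true ∷ s) (-1ℤ ∷ v) h′ (false ∷ s′)

  -- A derivation records the partial sums next to every entry, in other words a six-vertex
  -- configuration. Weights and statistics are later computed by recursion on it.
  data Valid : Vec Bool n → Vec (Vec ℤ n) m → Set where
    []  : Valid (trues n) []
    _∷_ : ∀ {A : Vec (Vec ℤ n) m} → Row false s v true s′ → Valid s′ A → Valid s (v ∷ A)

  private
    Opposite : ℤ → ℤ → Set
    Opposite a b = sign a ≢ sign b

    -- A fictitious nonzero entry in front of the line: after the partial sum 1 the next nonzero
    -- entry has to be -1, after the partial sum 0 it has to be 1.
    previous : Bool → ℤ
    previous true  = 1ℤ
    previous false = -1ℤ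

    remaining : Bool → ℤ
    remaining true  = 0ℤ
    remaining false = 1ℤ

    path-linked : Path h v → Linked Opposite (previous h ∷ nonzeros v)
    path-linked done     = [-]
    path-linked (zero p) = path-linked p
    path-linked (up p)   = (λ ()) ∷ path-linked p
    path-linked (down p) = (λ ()) ∷ path-linked p

    path-sum : Path h v → sum (lookup v) ≡ remaining h
    path-sum done = refl
    path-sum (zero {v = v} p) = trans (ℤ.+-identityˡ (sum (lookup v))) (path-sum p)
    path-sum (up p)   = cong (ℤ._+_ 1ℤ) (path-sum p)
    path-sum (down p) = cong (ℤ._+_ -1ℤ) (path-sum p)

    -- Alternation keeps the partial sums in {0, 1}, so the only way to fail is to end at 0, with a
    -- total that is one too small.
    linked-sum : ∀ h {v : Vec ℤ n} → All (_∈ entries) v → Linked Opposite (previous h ∷ nonzeros v) →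
                 Path h v ⊎ sum (lookup v) ≡ remaining h ℤ.- 1ℤ
    linked-sum true  []  _ = inj₁ done
    linked-sum false []  _ = inj₂ refl
    linked-sum h {_ ∷ v} (here refl ∷ es) l with linked-sum h es l
    ... | inj₁ p = inj₁ (zero p)
    ... | inj₂ e = inj₂ (trans (ℤ.+-identityˡ (sum (lookup v))) e)
    linked-sum true  (there (here refl) ∷ es) (o ∷ l) = ⊥-elim (o refl)
    linked-sum false (there (here refl) ∷ es) (o ∷ l) with linked-sum true es l
    ... | inj₁ p = inj₁ (up p)
    ... | inj₂ e = inj₂ (cong (ℤ._+_ 1ℤ) e)
    linked-sum true  (there (there (here refl)) ∷ es) (o ∷ l) with linked-sum false es l
    ... | inj₁ p = inj₁ (down p)
    ... | inj₂ e = inj₂ (cong (ℤ._+_ -1ℤ) e)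
    linked-sum false (there (there (here refl)) ∷ es) (o ∷ l) = ⊥-elim (o refl)

  path⇒alternating : Path false v → Alternating v
  path⇒alternating p = Linked.tail (path-linked p) , path-sum p

  alternating⇒path : ∀ {v : Vec ℤ n} → All (_∈ entries) v → Alternating v → Path false v
  alternating⇒path [] (_ , ())
  alternating⇒path {v = _ ∷ v} (here refl ∷ es) (l , e) =
    zero (alternating⇒path es (l , trans (sym (ℤ.+-identityˡ (sum (lookup v)))) e))
  alternating⇒path {v = _ ∷ v} (there (here refl) ∷ es) (l , e) with linked-sum true es l
  ... | inj₁ p  = up p
  ... | inj₂ e′ with () ← trans (sym (cong (ℤ._+_ 1ℤ) e′)) e
  -- A line whose first nonzero entry is -1 has total 0 or -1, never 1.
  alternating⇒path {v = _ ∷ v} (there (there (here refl)) ∷ es) (l , e) with linked-sum false es l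
  ... | inj₁ p  with () ← trans (sym (cong (ℤ._+_ -1ℤ) (path-sum p))) e
  ... | inj₂ e′ with () ← trans (sym (cong (ℤ._+_ -1ℤ) e′)) e

  path-entries : Path h v → All (_∈ entries) v
  path-entries done     = []
  path-entries (zero p) = here refl ∷ path-entries p
  path-entries (up p)   = there (here refl) ∷ path-entries p
  path-entries (down p) = there (there (here refl)) ∷ path-entries p

  row-path : Row h s v true s′ → Path h v
  row-path done     = done
  row-path (zero p) = zero (row-path p)
  row-path (up p)   = up (row-path p)
  row-path (down p) = down (row-path p)

  column : Vec (Vec ℤ n) m → Fin n → Vec ℤ m
  column A j = map (λ v → lookup v j) A

  private
    row-column : ∀ {v : Vec ℤ n} → Row h s v h′ s′ → ∀ j {u : Vec ℤ m} →
                 Path (lookup s′ j) u → Path (lookup s j) (lookup v j ∷ u)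
    row-column (zero r) zero    p = zero p
    row-column (zero r) (suc j) p = row-column r j p
    row-column (up r)   zero    p = up p
    row-column (up r)   (suc j) p = row-column r j p
    row-column (down r) zero    p = down p
    row-column (down r) (suc j) p = row-column r j p

    trues-path : ∀ (j : Fin n) → Path (lookup (trues n) j) []
    trues-path j rewrite lookup-replicate j true = done

    path-trues : (∀ (j : Fin n) → Path (lookup s j) []) → s ≡ trues n
    path-trues {s = []}         h = refl
    path-trues {s = true ∷ s}   h = cong (true ∷_) (path-trues λ j → h (suc j))
    path-trues {s = false ∷ s}  h with () ← h zero

    -- The first steps of the column paths have to agree with the entries of the row, and they
    -- determine the column sums below it.
    split-row : ∀ {v : Vec ℤ n} {u : Fin n → Vec ℤ m} → Path h v → (∀ j → Path (lookup s j) (lookup v j ∷ u j)) →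
                ∃[ s′ ] Row h s v true s′ × (∀ j → Path (lookup s′ j) (u j))
    split-row {s = []}        done     q = [] , done , λ ()
    split-row {s = t ∷ s}     (zero p) q with zero q₀ ← q zero with s′ , r , q′ ← split-row {s = s} p (λ j → q (suc j)) =
      t ∷ s′ , zero r , λ { zero → q₀ ; (suc j) → q′ j }
    split-row {s = true ∷ s}  (up p)   q with () ← q zero
    split-row {s = false ∷ s} (up p)   q with up q₀ ← q zero with s′ , r , q′ ← split-row {s = s} p (λ j → q (suc j)) =
      true ∷ s′ , up r , λ { zero → q₀ ; (suc j) → q′ j }
    split-row {s = false ∷ s} (down p) q with () ← q zero
    split-row {s = true ∷ s}  (down p) q with down q₀ ← q zero with s′ , r , q′ ← split-row {s = s} p (λ j → q (suc j)) =
      false ∷ s′ , down r , λ { zero → q₀ ; (suc j) → q′ j }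

    valid-columns : ∀ {A : Vec (Vec ℤ n) m} → Valid s A → ∀ j → Path (lookup s j) (column A j)
    valid-columns []      j = trues-path j
    valid-columns (r ∷ V) j = row-column r j (valid-columns V j)

    valid-rows : ∀ {A : Vec (Vec ℤ n) m} → Valid s A → All (Path false) A
    valid-rows []      = []
    valid-rows (r ∷ V) = row-path r ∷ valid-rows V

    paths-valid : ∀ {A : Vec (Vec ℤ n) m} → All (Path false) A → (∀ j → Path (lookup s j) (column A j)) → Valid s A
    paths-valid {s = s} []       q with refl ← path-trues {s = s} q = []
    paths-valid {s = s} (p ∷ ps) q with s′ , r , q′ ← split-row {s = s} p q = r ∷ paths-valid ps q′

  lookup-transpose : ∀ (A : Vec (Vec ℤ n) m) j → lookup (transpose A) j ≡ column A j
  lookup-transpose                 []      j = lookup-replicate j []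
  lookup-transpose {n = n} {suc m} (v ∷ A) j = begin
    lookup (replicate n cons ⊛ v ⊛ transpose A) j
      ≡⟨ lookup-⊛ j (replicate n cons ⊛ v) (transpose A) ⟩
    lookup (replicate n cons ⊛ v) j (lookup (transpose A) j)
      ≡⟨ cong₂ (λ (f : Vec ℤ m → Vec ℤ (suc m)) u → f u) (lookup-⊛ j (replicate n cons) v) (lookup-transpose A j) ⟩
    lookup (replicate n cons) j (lookup v j) (column A j)
      ≡⟨ cong (λ (f : ℤ → Vec ℤ m → Vec ℤ (suc m)) → f (lookup v j) (column A j)) (lookup-replicate j cons) ⟩
    lookup v j ∷ column A j ∎
    where
    open ≡-Reasoning
    cons : ℤ → Vec ℤ m → Vec ℤ (suc m)
    cons = _∷_

  falseₛ : ∀ n → Vec Bool n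
  falseₛ n = replicate n false

  valid⇒ASM : ∀ {A : Matrix n} → Valid (falseₛ n) A → IsASM A
  valid⇒ASM {n} {A} V =
    All.map path-entries (valid-rows V) , All.map path⇒alternating (valid-rows V) ,
    All.lookup⁻ λ j → subst Alternating (sym (lookup-transpose A j))
      (path⇒alternating (subst (λ t → Path t (column A j)) (lookup-replicate j false) (valid-columns V j)))

  ASM⇒valid : ∀ {A : Matrix n} → IsASM A → Valid (falseₛ n) A
  ASM⇒valid {n} {A} (es , rows , columns) = paths-valid
    (All.map (λ (e , r) → alternating⇒path e r) (All.zip (es , rows)))
    λ j → subst (λ t → Path t (column A j)) (sym (lookup-replicate j false))
      (alternating⇒path (All.map⁺ (All.map (λ e → All.lookup⁺ e j) es))
        (subst Alternating (lookup-transpose A j) (All.lookup⁺ columns j)))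

-- The statistics ν and μ as numbers of vertices

module Statistics where

  open Validity
  open import Data.Bool.Base using (if_then_else_; _∧_)
  open import Data.Fin.Base using (toℕ)
  open import Data.Fin.Properties using (_<?_; _≤?_)
  open import Data.Integer.Base as ℤ using (ℤ; +_; 0ℤ; 1ℤ; -1ℤ; ∣_∣)
  import Data.Integer.Properties as ℤₚ
  open import Data.Integer.Tactic.RingSolver using (solve-∀)
  open import Algebra.Properties.CommutativeMonoid.Sum ℤₚ.+-0-commutativeMonoid
    using (sum; sum-syntax; sum-cong-≗; sum-replicate-zero; ∑-distrib-+)
  open import Data.Vec.Base using (concat; count; _++_)
  open import Data.Vec.Properties using (lookup-replicate)
  open import Relation.Binary.PropositionalEquality
  open import Relation.Nullary.Decidable using (does; _×-dec_)
  open ≡-Reasoning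

  private
    variable
      m n : ℕ
      h h′ : Bool
      s s′ : Vec Bool n
      v : Vec ℤ n

  bit : Bool → ℕ
  bit true  = 1
  bit false = 0

  -- An entry 0 whose partial sums are both 1 is a vertex of type `a₁`, and ν turns out to be the
  -- number of these.
  row₁₁ row₋ : Row h s v h′ s′ → ℕ
  row₁₁ done                     = 0
  row₁₁ (zero {h = h} {t = t} r) = bit (h ∧ t) ℕ.+ row₁₁ r
  row₁₁ (up r)                   = row₁₁ r
  row₁₁ (down r)                 = row₁₁ r
  row₋ done     = 0
  row₋ (zero r) = row₋ r
  row₋ (up r)   = row₋ r
  row₋ (down r) = suc (row₋ r)

  total₁₁ total₋ : ∀ {A : Vec (Vec ℤ n) m} → Valid s A → ℕ
  total₁₁ []      = 0
  total₁₁ (r ∷ V) = row₁₁ r ℕ.+ total₁₁ V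
  total₋ []       = 0
  total₋ (r ∷ V)  = row₋ r ℕ.+ total₋ V

  count-++ : ∀ (u : Vec ℤ m) (v : Vec ℤ n) →
             count (ℤₚ._≟ -1ℤ) (u ++ v) ≡ count (ℤₚ._≟ -1ℤ) u ℕ.+ count (ℤₚ._≟ -1ℤ) v
  count-++ []      v = refl
  count-++ (a ∷ u) v with does (a ℤₚ.≟ -1ℤ)
  ... | true  = cong suc (count-++ u v)
  ... | false = count-++ u v

  row₋-count : (r : Row h s v h′ s′) → count (ℤₚ._≟ -1ℤ) v ≡ row₋ r
  row₋-count done     = refl
  row₋-count (zero r) = row₋-count r
  row₋-count (up r)   = row₋-count r
  row₋-count (down r) = cong suc (row₋-count r)

  total₋-count : ∀ {A : Vec (Vec ℤ n) m} (V : Valid s A) → count (ℤₚ._≟ -1ℤ) (concat A) ≡ total₋ V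
  total₋-count []                    = refl
  total₋-count {A = v ∷ A} (r ∷ V) = trans (count-++ v (concat A)) (cong₂ ℕ._+_ (row₋-count r) (total₋-count V))

  private
    pairs : (Fin n → ℤ) → (Fin n → ℤ) → ℤ
    pairs {n} f g = ∑[ j < n ] (∑[ j′ < n ] (if does (j′ ≤? j) then f j ℤ.* g j′ else 0ℤ))

    below : (Fin n → ℤ) → Vec (Vec ℤ n) m → ℤ
    below f []      = 0ℤ
    below f (v ∷ A) = pairs f (lookup v) ℤ.+ below f A

    inversions : Vec (Vec ℤ n) m → ℤ
    inversions {n} {m} A = ∑[ i < m ] (∑[ i′ < m ] (∑[ j < n ] (∑[ j′ < n ]
      (if does (i <? i′ ×-dec j′ ≤? j) then lookup (lookup A i) j ℤ.* lookup (lookup A i′) j′ else 0ℤ))))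

    sum-0 : ∀ {n} (f : Fin n → ℤ) → (∀ i → f i ≡ 0ℤ) → sum f ≡ 0ℤ
    sum-0 {n} f h = trans (sum-cong-≗ h) (sum-replicate-zero n)

    sum-below : ∀ (f : Fin n → ℤ) (A : Vec (Vec ℤ n) m) → sum (λ i → pairs f (lookup (lookup A i))) ≡ below f A
    sum-below f []      = refl
    sum-below f (v ∷ A) = cong (ℤ._+_ (pairs f (lookup v))) (sum-below f A)

    inversions-∷ : ∀ (v : Vec ℤ n) (A : Vec (Vec ℤ n) m) → inversions (v ∷ A) ≡ below (lookup v) A ℤ.+ inversions A
    inversions-∷ {n} {m} v A = cong₂ ℤ._+_
      (trans (cong₂ ℤ._+_ (zeros n) (sum-below (lookup v) A)) (ℤₚ.+-identityˡ (below (lookup v) A)))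
      (sum-cong-≗ {m} λ i → trans (cong (ℤ._+ rest i) (zeros n)) (ℤₚ.+-identityˡ (rest i)))
      where
      rest : Fin m → ℤ
      rest i = ∑[ i′ < m ] (∑[ j < n ] (∑[ j′ < n ]
        (if does (i <? i′ ×-dec j′ ≤? j) then lookup (lookup A i) j ℤ.* lookup (lookup A i′) j′ else 0ℤ)))
      zeros : ∀ n → (∑[ j < n ] (∑[ j′ < n ] 0ℤ)) ≡ 0ℤ
      zeros n = sum-0 {n} (λ _ → sum {n} λ _ → 0ℤ) λ _ → sum-replicate-zero n

    pairs-suc : ∀ (f g : Fin (suc n) → ℤ) →
      pairs f g ≡ f zero ℤ.* g zero ℤ.+ (sum (λ j → f (suc j)) ℤ.* g zero ℤ.+ pairs (λ j → f (suc j)) (λ j → g (suc j)))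
    pairs-suc {n} f g = cong₂ ℤ._+_
      (trans (cong (ℤ._+_ (f zero ℤ.* g zero)) (sum-replicate-zero n)) (ℤₚ.+-identityʳ (f zero ℤ.* g zero)))
      (trans (trans (sum-cong-≗ λ j → cong (ℤ._+_ (f (suc j) ℤ.* g zero)) (sum-cong-≗ λ j′ →
          cong (λ b → if b then f (suc j) ℤ.* g (suc j′) else 0ℤ) (≤ᵇ-suc (toℕ j′) (toℕ j))))
        (∑-distrib-+ (λ j → f (suc j) ℤ.* g zero) λ j → ∑[ j′ < n ] (if does (j′ ≤? j) then f (suc j) ℤ.* g (suc j′) else 0ℤ)))
        (cong (ℤ._+ pairs (λ j → f (suc j)) (λ j → g (suc j))) (sum-*ʳ (λ j → f (suc j)) (g zero))))
      where
      ≤ᵇ-suc : ∀ i j → (suc i ℕ.≤ᵇ suc j) ≡ (i ℕ.≤ᵇ j)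
      ≤ᵇ-suc zero    j = refl
      ≤ᵇ-suc (suc i) j = refl
      sum-*ʳ : ∀ {n} (f : Fin n → ℤ) a → sum (λ j → f j ℤ.* a) ≡ sum f ℤ.* a
      sum-*ʳ {zero}  f a = refl
      sum-*ʳ {suc n} f a = trans (cong (ℤ._+_ (f zero ℤ.* a)) (sum-*ʳ (λ j → f (suc j)) a))
        (sym (ℤₚ.*-distribʳ-+ a (f zero) _))

    value : Vec Bool n → Fin n → ℤ
    value s j = + bit (lookup s j)

    -- In total, each column contributes the column sum above the row times the row sum up to and
    -- including that column, and this product is 1 exactly at the zeros of type `a₁`. The summand
    -- with `h` accounts for the part of the row further left, which the induction has already
    -- removed.
    pairs-row : (r : Row h s v h′ s′) →
      pairs (value s) (lookup v) ℤ.+ + bit h ℤ.* sum (value s) ≡ + row₁₁ r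
    pairs-row {h = h} done = trans (ℤₚ.+-identityˡ _) (ℤₚ.*-zeroʳ (+ bit h))
    pairs-row {h = h} {s = t ∷ s} {v = _ ∷ v} (zero r) = begin
      pairs (value (t ∷ s)) (lookup (0ℤ ∷ v)) ℤ.+ + bit h ℤ.* (+ bit t ℤ.+ sum (value s))
        ≡⟨ cong (ℤ._+ _) (pairs-suc (value (t ∷ s)) (lookup (0ℤ ∷ v))) ⟩
      (+ bit t ℤ.* 0ℤ ℤ.+ (sum (value s) ℤ.* 0ℤ ℤ.+ pairs (value s) (lookup v))) ℤ.+ + bit h ℤ.* (+ bit t ℤ.+ sum (value s))
        ≡⟨ lemma (+ bit t) (sum (value s)) (pairs (value s) (lookup v)) (+ bit h) ⟩
      + bit h ℤ.* + bit t ℤ.+ (pairs (value s) (lookup v) ℤ.+ + bit h ℤ.* sum (value s))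
        ≡⟨ cong₂ ℤ._+_ (bit-∧ h t) (pairs-row r) ⟩
      + bit (h ∧ t) ℤ.+ + row₁₁ r ∎
      where
      lemma : ∀ t S p h → (t ℤ.* 0ℤ ℤ.+ (S ℤ.* 0ℤ ℤ.+ p)) ℤ.+ h ℤ.* (t ℤ.+ S) ≡ h ℤ.* t ℤ.+ (p ℤ.+ h ℤ.* S)
      lemma = solve-∀
      bit-∧ : ∀ h t → + bit h ℤ.* + bit t ≡ + bit (h ∧ t)
      bit-∧ true  true  = refl
      bit-∧ true  false = refl
      bit-∧ false true  = refl
      bit-∧ false false = refl
    pairs-row {s = _ ∷ s} {v = _ ∷ v} (up r) = begin
      pairs (value (false ∷ s)) (lookup (1ℤ ∷ v)) ℤ.+ 0ℤ ℤ.* (0ℤ ℤ.+ sum (value s))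
        ≡⟨ cong (ℤ._+ _) (pairs-suc (value (false ∷ s)) (lookup (1ℤ ∷ v))) ⟩
      (0ℤ ℤ.* 1ℤ ℤ.+ (sum (value s) ℤ.* 1ℤ ℤ.+ pairs (value s) (lookup v))) ℤ.+ 0ℤ ℤ.* (0ℤ ℤ.+ sum (value s))
        ≡⟨ lemma (sum (value s)) (pairs (value s) (lookup v)) ⟩
      pairs (value s) (lookup v) ℤ.+ 1ℤ ℤ.* sum (value s)
        ≡⟨ pairs-row r ⟩
      + row₁₁ r ∎
      where
      lemma : ∀ S p → (0ℤ ℤ.* 1ℤ ℤ.+ (S ℤ.* 1ℤ ℤ.+ p)) ℤ.+ 0ℤ ℤ.* (0ℤ ℤ.+ S) ≡ p ℤ.+ 1ℤ ℤ.* S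
      lemma = solve-∀
    pairs-row {s = _ ∷ s} {v = _ ∷ v} (down r) = begin
      pairs (value (true ∷ s)) (lookup (-1ℤ ∷ v)) ℤ.+ 1ℤ ℤ.* (1ℤ ℤ.+ sum (value s))
        ≡⟨ cong (ℤ._+ _) (pairs-suc (value (true ∷ s)) (lookup (-1ℤ ∷ v))) ⟩
      (1ℤ ℤ.* -1ℤ ℤ.+ (sum (value s) ℤ.* -1ℤ ℤ.+ pairs (value s) (lookup v))) ℤ.+ 1ℤ ℤ.* (1ℤ ℤ.+ sum (value s))
        ≡⟨ lemma (sum (value s)) (pairs (value s) (lookup v)) ⟩
      pairs (value s) (lookup v) ℤ.+ 0ℤ ℤ.* sum (value s)
        ≡⟨ pairs-row r ⟩
      + row₁₁ r ∎
      where
      lemma : ∀ S p → (1ℤ ℤ.* -1ℤ ℤ.+ (S ℤ.* -1ℤ ℤ.+ p)) ℤ.+ 1ℤ ℤ.* (1ℤ ℤ.+ S) ≡ p ℤ.+ 0ℤ ℤ.* S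
      lemma = solve-∀

    pairs-cong : ∀ {f f′ : Fin n → ℤ} (g : Fin n → ℤ) → (∀ j → f j ≡ f′ j) → pairs f g ≡ pairs f′ g
    pairs-cong g e = sum-cong-≗ λ j → sum-cong-≗ λ j′ →
      cong (λ a → if does (j′ ≤? j) then a ℤ.* g j′ else 0ℤ) (e j)

    pairs-+ : ∀ (f f′ g : Fin n → ℤ) → pairs (λ j → f j ℤ.+ f′ j) g ≡ pairs f g ℤ.+ pairs f′ g
    pairs-+ {n} f f′ g = trans
      (sum-cong-≗ λ j → trans (sum-cong-≗ λ j′ → distrib (does (j′ ≤? j)) (f j) (f′ j) (g j′)) (∑-distrib-+ {n} _ _))
      (∑-distrib-+ {n} _ _)
      where
      distrib : ∀ b x y z → (if b then (x ℤ.+ y) ℤ.* z else 0ℤ) ≡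
                            (if b then x ℤ.* z else 0ℤ) ℤ.+ (if b then y ℤ.* z else 0ℤ)
      distrib true  x y z = ℤₚ.*-distribʳ-+ z x y
      distrib false x y z = refl

    below-cong : ∀ {f f′ : Fin n → ℤ} (A : Vec (Vec ℤ n) m) → (∀ j → f j ≡ f′ j) → below f A ≡ below f′ A
    below-cong []      e = refl
    below-cong (v ∷ A) e = cong₂ ℤ._+_ (pairs-cong (lookup v) e) (below-cong A e)

    below-+ : ∀ (f f′ : Fin n → ℤ) (A : Vec (Vec ℤ n) m) → below (λ j → f j ℤ.+ f′ j) A ≡ below f A ℤ.+ below f′ A
    below-+ f f′ []      = refl
    below-+ f f′ (v ∷ A) = trans (cong₂ ℤ._+_ (pairs-+ f f′ (lookup v)) (below-+ f f′ A)) 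
      (interchange (pairs f (lookup v)) (pairs f′ (lookup v)) (below f A) (below f′ A))
      where
      interchange : ∀ a b c d → (a ℤ.+ b) ℤ.+ (c ℤ.+ d) ≡ (a ℤ.+ c) ℤ.+ (b ℤ.+ d)
      interchange = solve-∀

    value-row : Row h s v h′ s′ → ∀ j → lookup v j ℤ.+ value s j ≡ value s′ j
    value-row (zero {t = t} r) zero = ℤₚ.+-identityˡ (+ bit t)
    value-row (up r)   zero    = refl
    value-row (down r) zero    = refl
    value-row (zero r) (suc j) = value-row r j
    value-row (up r)   (suc j) = value-row r j
    value-row (down r) (suc j) = value-row r j

    -- Accumulating the column sums s of the rows already read removes the double
    -- sum over rows.
    inversions-total : ∀ {A : Vec (Vec ℤ n) m} (V : Valid s A) → inversions A ℤ.+ below (value s) A ≡ + total₁₁ V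
    inversions-total [] = refl
    inversions-total {s = s} {A = v ∷ A} (_∷_ {s′ = s′} r V) = begin
      inversions (v ∷ A) ℤ.+ (pairs (value s) (lookup v) ℤ.+ below (value s) A)
        ≡⟨ cong (ℤ._+ (pairs (value s) (lookup v) ℤ.+ below (value s) A)) (inversions-∷ v A) ⟩
      (below (lookup v) A ℤ.+ inversions A) ℤ.+ (pairs (value s) (lookup v) ℤ.+ below (value s) A)
        ≡⟨ lemma (below (lookup v) A) (inversions A) (pairs (value s) (lookup v)) (below (value s) A) (sum (value s)) ⟩
      (pairs (value s) (lookup v) ℤ.+ 0ℤ ℤ.* sum (value s)) ℤ.+ (inversions A ℤ.+ (below (lookup v) A ℤ.+ below (value s) A))
        ≡⟨ cong₂ (λ a b → a ℤ.+ (inversions A ℤ.+ b)) (pairs-row r)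
             (trans (sym (below-+ (lookup v) (value s) A)) (below-cong A (value-row r))) ⟩
      + row₁₁ r ℤ.+ (inversions A ℤ.+ below (value s′) A)
        ≡⟨ cong (ℤ._+_ (+ row₁₁ r)) (inversions-total V) ⟩
      + row₁₁ r ℤ.+ + total₁₁ V ∎
      where
      lemma : ∀ a b c d S → (a ℤ.+ b) ℤ.+ (c ℤ.+ d) ≡ (c ℤ.+ 0ℤ ℤ.* S) ℤ.+ (b ℤ.+ (a ℤ.+ d))
      lemma = solve-∀

    below-0 : ∀ (A : Vec (Vec ℤ n) m) → below (λ _ → 0ℤ) A ≡ 0ℤ
    below-0 []      = refl
    below-0 {n} (v ∷ A) = cong₂ ℤ._+_
      (sum-0 {n} _ λ j → sum-0 {n} _ λ j′ → if-0 (does (j′ ≤? j)) (lookup v j′)) (below-0 A)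
      where
      if-0 : ∀ b z → (if b then 0ℤ ℤ.* z else 0ℤ) ≡ 0ℤ
      if-0 true  z = refl
      if-0 false z = refl

  ν-total : ∀ {A : Matrix n} (V : Valid (falseₛ n) A) → ν A ≡ total₁₁ V
  ν-total {n} {A} V = cong ∣_∣ (begin
    inversions A                                    ≡⟨ ℤₚ.+-identityʳ _ ⟨
    inversions A ℤ.+ 0ℤ                             ≡⟨ cong (ℤ._+_ (inversions A)) (below-0 A) ⟨
    inversions A ℤ.+ below (λ _ → 0ℤ) A             ≡⟨ cong (ℤ._+_ (inversions A))
      (below-cong A λ j → cong (λ t → + bit t) (sym (lookup-replicate j false))) ⟩
    inversions A ℤ.+ below (value (falseₛ n)) A     ≡⟨ inversions-total V ⟩
    + total₁₁ V                                     ∎)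

  μ-total : ∀ {A : Matrix n} (V : Valid (falseₛ n) A) → μ A ≡ total₋ V
  μ-total V = total₋-count V

-- Sums over alternating sign matrices as state sums

module Matrices {c ℓ} (R : CommutativeRing c ℓ) where

  open CommutativeRing R hiding (zero)
  open IntSolver R
  open SixVertex R
  open Validity
  open Statistics
  open GeneratingFunctions R
  open import Data.Bool.Base using (if_then_else_)
  open import Data.Integer.Base using (ℤ; +_; -[1+_]; 0ℤ)
  open import Data.List.Base as List using (List; []; _∷_; _++_; cartesianProductWith)
  open import Data.Sum.Base using (_⊎_; inj₁; inj₂)
  open import Data.Vec.Base using (map)
  open import Relation.Nullary.Decidable using (does)
  open import Relation.Binary.Reasoning.Setoid setoid

  private
    variable
      α β : Level
      I J X Y : Set α
      m n : ℕ
      h h′ : Bool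
      s s′ : Vec Bool n
      v : Vec ℤ n

  listSum : (X → Carrier) → List X → Carrier
  listSum f xs = List.foldr _+_ 0# (List.map f xs)

  listSum-cong : ∀ {f g : X → Carrier} → (∀ x → f x ≈ g x) → ∀ xs → listSum f xs ≈ listSum g xs
  listSum-cong e []       = refl
  listSum-cong e (x ∷ xs) = +-cong (e x) (listSum-cong e xs)

  listSum-filter : ∀ {P : X → Set β} (P? : ∀ x → Dec (P x)) (f : X → Carrier) xs →
                   listSum f (List.filter P? xs) ≈ listSum (λ x → if does (P? x) then f x else 0#) xs
  listSum-filter P? f []       = refl
  listSum-filter P? f (x ∷ xs) with does (P? x)
  ... | true  = +-congˡ (listSum-filter P? f xs)
  ... | false = trans (listSum-filter P? f xs) (sym (+-identityˡ _))

  listSum-++ : ∀ (f : X → Carrier) xs ys → listSum f (xs ++ ys) ≈ listSum f xs + listSum f ys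
  listSum-++ f []       ys = sym (+-identityˡ _)
  listSum-++ f (x ∷ xs) ys = trans (+-congˡ (listSum-++ f xs ys)) (sym (+-assoc _ _ _))

  listSum-map : ∀ (f : Y → Carrier) (g : X → Y) xs → listSum f (List.map g xs) ≈ listSum (λ x → f (g x)) xs
  listSum-map f g []       = refl
  listSum-map f g (x ∷ xs) = +-congˡ (listSum-map f g xs)

  listSum-cartesian : ∀ {Z : Set β} (f : Z → Carrier) (g : X → Y → Z) xs ys →
    listSum f (cartesianProductWith g xs ys) ≈ listSum (λ x → listSum (λ y → f (g x y)) ys) xs
  listSum-cartesian f g []       ys = refl
  listSum-cartesian f g (x ∷ xs) ys = trans (listSum-++ f (List.map (g x) ys) _)
    (+-cong (listSum-map f (g x) ys) (listSum-cartesian f g xs ys))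

  -- The share of the entry `a` in `vertex`, and 0 when the partial sums forbid `a`. Evaluating
  -- arbitrary integer matrices in this way turns the state sum into a sum over the same list of
  -- candidates that `ASM` filters.
  vertexAt : Weights → ℤ → Bool → Bool → (Bool → Bool → Carrier) → Carrier
  vertexAt w (+ 0)    false false k = a₂ w * k false false
  vertexAt w (+ 0)    false true  k = b w * k false true
  vertexAt w (+ 0)    true  false k = b w * k true false
  vertexAt w (+ 0)    true  true  k = a₁ w * k true true
  vertexAt w (+ 1)    false false k = k true true
  vertexAt w -[1+ 0 ] true  true  k = c₋ w * k false false
  vertexAt w _        _     _     k = 0#

  rowAt : (J → Weights) → Vec J n → Vec ℤ n → Bool → Vec Bool n → (Bool → Vec Bool n → Carrier) → Carrier
  rowAt ω []       []      h []       k = k h []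
  rowAt ω (j ∷ js) (a ∷ v) h (s ∷ ss) k =
    vertexAt (ω j) a h s λ h′ s′ → rowAt ω js v h′ ss λ h″ ss′ → k h″ (s′ ∷ ss′)

  matrixAt : (I → J → Weights) → Vec I m → Vec J n → Vec Bool n → Vec (Vec ℤ n) m → Carrier
  matrixAt ω []       js s []      = allTrue s
  matrixAt ω (i ∷ is) js s (v ∷ A) = rowAt (ω i) js v false s (whenTrue λ s′ → matrixAt ω is js s′ A)

  private
    vertexAt-congʳ : ∀ w a h s {k l} → (∀ h s → k h s ≈ l h s) → vertexAt w a h s k ≈ vertexAt w a h s l
    vertexAt-congʳ w (+ 0)           false false e = *-congˡ (e _ _)
    vertexAt-congʳ w (+ 0)           false true  e = *-congˡ (e _ _)
    vertexAt-congʳ w (+ 0)           true  false e = *-congˡ (e _ _)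
    vertexAt-congʳ w (+ 0)           true  true  e = *-congˡ (e _ _)
    vertexAt-congʳ w (+ 1)           false false e = e _ _
    vertexAt-congʳ w (+ 1)           false true  e = refl
    vertexAt-congʳ w (+ 1)           true  false e = refl
    vertexAt-congʳ w (+ 1)           true  true  e = refl
    vertexAt-congʳ w (+ suc (suc _)) _     _     e = refl
    vertexAt-congʳ w -[1+ 0 ]        false false e = refl
    vertexAt-congʳ w -[1+ 0 ]        false true  e = refl
    vertexAt-congʳ w -[1+ 0 ]        true  false e = refl
    vertexAt-congʳ w -[1+ 0 ]        true  true  e = *-congˡ (e _ _)
    vertexAt-congʳ w -[1+ suc _ ]    _     _     e = refl

    vertexAt-0 : ∀ w a h s {k} → (∀ h s → k h s ≈ 0#) → vertexAt w a h s k ≈ 0#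
    vertexAt-0 w a h s {k} k≈0 = trans (vertexAt-congʳ w a h s k≈0) (zeros w a h s)
      where
      zeros : ∀ w a h s → vertexAt w a h s (λ _ _ → 0#) ≈ 0#
      zeros w (+ 0)           false false = zeroʳ _
      zeros w (+ 0)           false true  = zeroʳ _
      zeros w (+ 0)           true  false = zeroʳ _
      zeros w (+ 0)           true  true  = zeroʳ _
      zeros w (+ 1)           false false = refl
      zeros w (+ 1)           false true  = refl
      zeros w (+ 1)           true  false = refl
      zeros w (+ 1)           true  true  = refl
      zeros w (+ suc (suc _)) _     _     = refl
      zeros w -[1+ 0 ]        false false = refl
      zeros w -[1+ 0 ]        false true  = refl
      zeros w -[1+ 0 ]        true  false = refl
      zeros w -[1+ 0 ]        true  true  = zeroʳ _
      zeros w -[1+ suc _ ]    _     _     = refl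

    vertexAt-+ : ∀ w a h s k l → vertexAt w a h s (λ h s → k h s + l h s) ≈ vertexAt w a h s k + vertexAt w a h s l
    vertexAt-+ w (+ 0)           false false k l = distribˡ _ _ _
    vertexAt-+ w (+ 0)           false true  k l = distribˡ _ _ _
    vertexAt-+ w (+ 0)           true  false k l = distribˡ _ _ _
    vertexAt-+ w (+ 0)           true  true  k l = distribˡ _ _ _
    vertexAt-+ w (+ 1)           false false k l = refl
    vertexAt-+ w (+ 1)           false true  k l = sym (+-identityˡ 0#)
    vertexAt-+ w (+ 1)           true  false k l = sym (+-identityˡ 0#)
    vertexAt-+ w (+ 1)           true  true  k l = sym (+-identityˡ 0#)
    vertexAt-+ w (+ suc (suc _)) _     _     k l = sym (+-identityˡ 0#)
    vertexAt-+ w -[1+ 0 ]        false false k l = sym (+-identityˡ 0#)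
    vertexAt-+ w -[1+ 0 ]        false true  k l = sym (+-identityˡ 0#)
    vertexAt-+ w -[1+ 0 ]        true  false k l = sym (+-identityˡ 0#)
    vertexAt-+ w -[1+ 0 ]        true  true  k l = distribˡ _ _ _
    vertexAt-+ w -[1+ suc _ ]    _     _     k l = sym (+-identityˡ 0#)

    rowAt-congʳ : ∀ (ω : J → Weights) (js : Vec J n) v h s {k l} → (∀ h s → k h s ≈ l h s) →
                  rowAt ω js v h s k ≈ rowAt ω js v h s l
    rowAt-congʳ ω []       []      h []       e = e h []
    rowAt-congʳ ω (j ∷ js) (a ∷ v) h (s ∷ ss) e =
      vertexAt-congʳ (ω j) a h s λ h′ s′ → rowAt-congʳ ω js v h′ ss λ h″ ss′ → e h″ (s′ ∷ ss′)

    rowAt-0 : ∀ (ω : J → Weights) (js : Vec J n) v h s {k} → (∀ h s → k h s ≈ 0#) → rowAt ω js v h s k ≈ 0#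
    rowAt-0 ω []       []      h []       e = e h []
    rowAt-0 ω (j ∷ js) (a ∷ v) h (s ∷ ss) e =
      vertexAt-0 (ω j) a h s λ h′ s′ → rowAt-0 ω js v h′ ss λ h″ ss′ → e h″ (s′ ∷ ss′)

    rowAt-+ : ∀ (ω : J → Weights) (js : Vec J n) v h s k l →
              rowAt ω js v h s (λ h s → k h s + l h s) ≈ rowAt ω js v h s k + rowAt ω js v h s l
    rowAt-+ ω []       []      h []       k l = refl
    rowAt-+ ω (j ∷ js) (a ∷ v) h (s ∷ ss) k l = trans
      (vertexAt-congʳ (ω j) a h s λ h′ s′ → rowAt-+ ω js v h′ ss _ _) (vertexAt-+ (ω j) a h s _ _)

    rowAt-listSum : ∀ (ω : J → Weights) (js : Vec J n) v h s (k : X → Bool → Vec Bool n → Carrier) xs →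
      listSum (λ x → rowAt ω js v h s (k x)) xs ≈ rowAt ω js v h s (λ h s → listSum (λ x → k x h s) xs)
    rowAt-listSum ω js v h s k []       = sym (rowAt-0 ω js v h s λ _ _ → refl)
    rowAt-listSum ω js v h s k (x ∷ xs) = trans (+-congˡ (rowAt-listSum ω js v h s k xs))
      (sym (rowAt-+ ω js v h s (k x) _))

    sum-vertexAt : ∀ w h s k → listSum (λ a → vertexAt w a h s k) entries ≈ vertex w h s k
    sum-vertexAt w false false k = solve 2 (λ a b → a :+ (b :+ (:0 :+ :0)) := a :+ b) refl _ _
    sum-vertexAt w false true  k = solve 1 (λ a → a :+ (:0 :+ (:0 :+ :0)) := a) refl _
    sum-vertexAt w true  false k = solve 1 (λ a → a :+ (:0 :+ (:0 :+ :0)) := a) refl _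
    sum-vertexAt w true  true  k = solve 2 (λ a b → a :+ (:0 :+ (b :+ :0)) := a :+ b) refl _ _

    vertexAt-listSum : ∀ w a h s (k : X → Bool → Bool → Carrier) xs →
      listSum (λ x → vertexAt w a h s (k x)) xs ≈ vertexAt w a h s (λ h s → listSum (λ x → k x h s) xs)
    vertexAt-listSum w a h s k []       = sym (vertexAt-0 w a h s λ _ _ → refl)
    vertexAt-listSum w a h s k (x ∷ xs) = trans (+-congˡ (vertexAt-listSum w a h s k xs))
      (sym (vertexAt-+ w a h s (k x) _))

    sum-rowAt : ∀ (ω : J → Weights) (js : Vec J n) h s k →
                listSum (λ v → rowAt ω js v h s k) (vectors entries n) ≈ row ω js h s k
    sum-rowAt ω []       h []       k = +-identityʳ _
    sum-rowAt {n = suc n} ω (j ∷ js) h (s ∷ ss) k = begin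
      listSum (λ v → rowAt ω (j ∷ js) v h (s ∷ ss) k) (vectors entries (suc n))
        ≈⟨ listSum-cartesian _ _∷_ entries (vectors entries n) ⟩
      listSum (λ a → listSum (λ v → rowAt ω (j ∷ js) (a ∷ v) h (s ∷ ss) k) (vectors entries n)) entries
        ≈⟨ listSum-cong (λ a → trans (vertexAt-listSum (ω j) a h s _ (vectors entries n))
             (vertexAt-congʳ (ω j) a h s λ h′ s′ → sum-rowAt ω js h′ ss λ h″ ss′ → k h″ (s′ ∷ ss′))) entries ⟩
      listSum (λ a → vertexAt (ω j) a h s (λ h′ s′ → row ω js h′ ss λ h″ ss′ → k h″ (s′ ∷ ss′))) entries
        ≈⟨ sum-vertexAt (ω j) h s _ ⟩
      row ω (j ∷ js) h (s ∷ ss) k ∎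

  sum-matrixAt : ∀ (ω : I → J → Weights) (is : Vec I m) (js : Vec J n) s →
    listSum (matrixAt ω is js s) (vectors (vectors entries n) m) ≈ rows ω is js s allTrue
  sum-matrixAt ω []       js s = +-identityʳ _
  sum-matrixAt {m = suc m} {n = n} ω (i ∷ is) js s = begin
    listSum (matrixAt ω (i ∷ is) js s) (vectors (vectors entries n) (suc m))
      ≈⟨ listSum-cartesian _ _∷_ (vectors entries n) (vectors (vectors entries n) m) ⟩
    listSum (λ v → listSum (λ A → matrixAt ω (i ∷ is) js s (v ∷ A)) (vectors (vectors entries n) m)) (vectors entries n)
      ≈⟨ listSum-cong (λ v → trans (rowAt-listSum (ω i) js v false s _ (vectors (vectors entries n) m))
           (rowAt-congʳ (ω i) js v false s λ
             { true  s′ → sum-matrixAt ω is js s′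
             ; false s′ → zeros (vectors (vectors entries n) m) })) (vectors entries n) ⟩
    listSum (λ v → rowAt (ω i) js v false s (whenTrue λ s′ → rows ω is js s′ allTrue)) (vectors entries n)
      ≈⟨ sum-rowAt (ω i) js false s _ ⟩
    rows ω (i ∷ is) js s allTrue ∎
    where
    zeros : ∀ (xs : List X) → listSum (λ _ → 0#) xs ≈ 0#
    zeros []       = refl
    zeros (x ∷ xs) = trans (+-identityˡ _) (zeros xs)

  zeroWeight : Weights → Bool → Bool → Carrier
  zeroWeight w false false = a₂ w
  zeroWeight w false true  = b w
  zeroWeight w true  false = b w
  zeroWeight w true  true  = a₁ w

  rowWeight : (J → Weights) → Vec J n → Row {n} h s v h′ s′ → Carrier
  rowWeight ω []       done                     = 1#
  rowWeight ω (j ∷ js) (zero {h = h} {t = t} r) = zeroWeight (ω j) h t * rowWeight ω js r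
  rowWeight ω (j ∷ js) (up r)                   = rowWeight ω js r
  rowWeight ω (j ∷ js) (down r)                 = c₋ (ω j) * rowWeight ω js r

  weight : (I → J → Weights) → Vec I m → Vec J n → ∀ {A : Vec (Vec ℤ n) m} → Valid s A → Carrier
  weight ω []       js []      = 1#
  weight ω (i ∷ is) js (r ∷ V) = rowWeight (ω i) js r * weight ω is js V

  private
    vertexAt-zero : ∀ w h t k → vertexAt w 0ℤ h t k ≈ zeroWeight w h t * k h t
    vertexAt-zero w false false k = refl
    vertexAt-zero w false true  k = refl
    vertexAt-zero w true  false k = refl
    vertexAt-zero w true  true  k = refl

    rowAt-row : ∀ (ω : J → Weights) (js : Vec J n) (r : Row {n} h s v h′ s′) k →
                rowAt ω js v h s k ≈ rowWeight ω js r * k h′ s′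
    rowAt-row ω []       done     k = sym (*-identityˡ _)
    rowAt-row ω (j ∷ js) (zero {h = h} {t = t} r) k = trans (vertexAt-zero (ω j) h t _)
      (trans (*-congˡ (rowAt-row ω js r _)) (sym (*-assoc _ _ _)))
    rowAt-row ω (j ∷ js) (up r)   k = rowAt-row ω js r _
    rowAt-row ω (j ∷ js) (down r) k = trans (*-congˡ (rowAt-row ω js r _)) (sym (*-assoc _ _ _))

    allTrue-trues : ∀ n → allTrue (trues n) ≈ 1#
    allTrue-trues zero    = refl
    allTrue-trues (suc n) = allTrue-trues n

    matrixAt-valid : ∀ (ω : I → J → Weights) (is : Vec I m) (js : Vec J n) {A} (V : Valid s A) →
                     matrixAt ω is js s A ≈ weight ω is js V
    matrixAt-valid {n = n} ω [] js []  = allTrue-trues n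
    matrixAt-valid ω (i ∷ is) js (r ∷ V) = trans (rowAt-row (ω i) js r _) (*-congˡ (matrixAt-valid ω is js V))

    row? : ∀ (v : Vec ℤ n) h s → (∃[ h′ ] ∃[ s′ ] Row h s v h′ s′) ⊎
           (∀ (ω : J → Weights) js k → rowAt ω js v h s k ≈ 0#)
    row? []              h []           = inj₁ (_ , _ , done)
    row? (+ 0 ∷ v)       h (t ∷ s)      with row? v h s
    ... | inj₁ (_ , _ , r) = inj₁ (_ , _ , zero r)
    ... | inj₂ e           = inj₂ λ { ω (j ∷ js) k → trans (vertexAt-zero (ω j) h t _) (trans (*-congˡ (e ω js _)) (zeroʳ _)) }
    row? (+ 1 ∷ v)       false (false ∷ s) with row? v true s
    ... | inj₁ (_ , _ , r) = inj₁ (_ , _ , up r)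
    ... | inj₂ e           = inj₂ λ { ω (j ∷ js) k → e ω js _ }
    row? (+ 1 ∷ v)       false (true ∷ s)  = inj₂ λ { ω (j ∷ js) k → refl }
    row? (+ 1 ∷ v)       true  (false ∷ s) = inj₂ λ { ω (j ∷ js) k → refl }
    row? (+ 1 ∷ v)       true  (true ∷ s)  = inj₂ λ { ω (j ∷ js) k → refl }
    row? (+ suc (suc _) ∷ v) h (t ∷ s)     = inj₂ λ { ω (j ∷ js) k → refl }
    row? (-[1+ 0 ] ∷ v)  true (true ∷ s) with row? v false s
    ... | inj₁ (_ , _ , r) = inj₁ (_ , _ , down r)
    ... | inj₂ e           = inj₂ λ { ω (j ∷ js) k → trans (*-congˡ (e ω js _)) (zeroʳ _) }
    row? (-[1+ 0 ] ∷ v)  true  (false ∷ s) = inj₂ λ { ω (j ∷ js) k → refl }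
    row? (-[1+ 0 ] ∷ v)  false (true ∷ s)  = inj₂ λ { ω (j ∷ js) k → refl }
    row? (-[1+ 0 ] ∷ v)  false (false ∷ s) = inj₂ λ { ω (j ∷ js) k → refl }
    row? (-[1+ suc _ ] ∷ v) h (t ∷ s)      = inj₂ λ { ω (j ∷ js) k → refl }

    allTrue? : ∀ (s : Vec Bool n) → s ≡ trues n ⊎ allTrue s ≈ 0#
    allTrue? []          = inj₁ ≡.refl
    allTrue? (false ∷ s) = inj₂ refl
    allTrue? (true ∷ s)  with allTrue? s
    ... | inj₁ e = inj₁ (≡.cong (true ∷_) e)
    ... | inj₂ e = inj₂ e

    valid? : ∀ (A : Vec (Vec ℤ n) m) s → Valid s A ⊎ (∀ (ω : I → J → Weights) is js → matrixAt ω is js s A ≈ 0#)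
    valid? [] s with allTrue? s
    ... | inj₁ ≡.refl = inj₁ []
    ... | inj₂ e      = inj₂ λ { ω [] js → e }
    valid? (v ∷ A) s with row? v false s
    ... | inj₂ e = inj₂ λ { ω (i ∷ is) js → e (ω i) js _ }
    ... | inj₁ (false , s′ , r) = inj₂ λ { ω (i ∷ is) js → trans (rowAt-row (ω i) js r _) (zeroʳ _) }
    ... | inj₁ (true , s′ , r) with valid? A s′
    ...   | inj₁ V = inj₁ (r ∷ V)
    ...   | inj₂ e = inj₂ λ { ω (i ∷ is) js → trans (rowAt-row (ω i) js r _) (trans (*-congˡ (e ω is js)) (zeroʳ _)) }

  -- A candidate that is not an ASM meets a forbidden entry or a wrong total in `matrixAt` and
  -- contributes 0 there, so `f` is compared with the weight on valid matrices alone.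
  sum-ASM : ∀ (ω : I → J → Weights) (is : Vec I n) (js : Vec J n) (f : Matrix n → Carrier) →
            (∀ A (V : Valid (falseₛ n) A) → f A ≈ weight ω is js V) →
            listSum f (ASM n) ≈ partition ω is js
  sum-ASM {n = n} ω is js f e = begin
    listSum f (ASM n)
      ≈⟨ listSum-filter isASM? f (vectors (vectors entries n) n) ⟩
    listSum (λ A → if does (isASM? A) then f A else 0#) (vectors (vectors entries n) n)
      ≈⟨ listSum-cong term (vectors (vectors entries n) n) ⟩
    listSum (matrixAt ω is js (falseₛ n)) (vectors (vectors entries n) n)
      ≈⟨ sum-matrixAt ω is js (falseₛ n) ⟩
    partition ω is js ∎
    where
    term : ∀ A → (if does (isASM? A) then f A else 0#) ≈ matrixAt ω is js (falseₛ n) A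
    term A = byCases (isASM? A)
      where
      byCases : (d : Dec (IsASM A)) → (if does d then f A else 0#) ≈ matrixAt ω is js (falseₛ n) A
      byCases (yes A∈ASM) = trans (e A (ASM⇒valid A∈ASM)) (sym (matrixAt-valid ω is js (ASM⇒valid A∈ASM)))
      byCases (no  A∉ASM) with valid? A (falseₛ n)
      ... | inj₁ V  = ⊥-elim (A∉ASM (valid⇒ASM V))
      ... | inj₂ e′ = sym (e′ ω is js)

-- Weights for the four boundary statistics

module Boundary {c ℓ} (R : CommutativeRing c ℓ) where

  open CommutativeRing R hiding (zero)
  open IntSolver R hiding (fromℕ)
  open SixVertex R
  open Matrices R
  open Validity
  open Statistics
  open GeneratingFunctions R
  open import Algebra.Properties.Semiring.Exp semiring using (^-homo-*)
  open import Data.Bool.Base using (_∧_)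
  open import Data.Fin.Base using (fromℕ)
  open import Data.Integer.Base using (ℤ; 0ℤ; 1ℤ)
  open import Data.Vec.Base using (head; last; reverse; map; transpose)
  open import Data.Vec.Properties using (reverse-∷; map-cong)
  open import Relation.Binary.Reasoning.Setoid setoid

  private
    variable
      α β : Level
      I J : Set α
      m n a : ℕ
      h h′ : Bool

  infixl 7 _⊛_

  -- An entry 1 always has weight 1, so multiplying weights vertex by vertex multiplies the weights
  -- of matrices. Each of the six statistics can then be treated by weights of its own.
  _⊛_ : Weights → Weights → Weights
  v ⊛ w = weights (a₁ v * a₁ w) (a₂ v * a₂ w) (b v * b w) (c₋ v * c₋ w)

  ones : Weights
  ones = weights 1# 1# 1# 1#

  private
    interchange : ∀ a b c d → (a * b) * (c * d) ≈ (a * c) * (b * d)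
    interchange = solve 4 (λ a b c d → (a :* b) :* (c :* d) := (a :* c) :* (b :* d)) refl

    zeroWeight-⊛ : ∀ v w h t → zeroWeight (v ⊛ w) h t ≈ zeroWeight v h t * zeroWeight w h t
    zeroWeight-⊛ v w false false = refl
    zeroWeight-⊛ v w false true  = refl
    zeroWeight-⊛ v w true  false = refl
    zeroWeight-⊛ v w true  true  = refl

    rowWeight-⊛ : ∀ (ω ω′ : J → Weights) (js : Vec J n) {s v s′} (r : Row {n} h s v h′ s′) →
                  rowWeight (λ j → ω j ⊛ ω′ j) js r ≈ rowWeight ω js r * rowWeight ω′ js r
    rowWeight-⊛ ω ω′ []       done     = sym (*-identityˡ 1#)
    rowWeight-⊛ ω ω′ (j ∷ js) (zero {h = h} {t = t} r) = trans
      (*-cong (zeroWeight-⊛ (ω j) (ω′ j) h t) (rowWeight-⊛ ω ω′ js r)) (interchange _ _ _ _)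
    rowWeight-⊛ ω ω′ (j ∷ js) (up r)   = rowWeight-⊛ ω ω′ js r
    rowWeight-⊛ ω ω′ (j ∷ js) (down r) = trans (*-congˡ (rowWeight-⊛ ω ω′ js r)) (interchange _ _ _ _)

  weight-⊛ : ∀ (ω ω′ : I → J → Weights) (is : Vec I m) (js : Vec J n) {s A} (V : Valid s A) →
             weight (λ i j → ω i j ⊛ ω′ i j) is js V ≈ weight ω is js V * weight ω′ is js V
  weight-⊛ ω ω′ []       js []      = sym (*-identityˡ 1#)
  weight-⊛ ω ω′ (i ∷ is) js (r ∷ V) = trans
    (*-cong (rowWeight-⊛ (ω i) (ω′ i) js r) (weight-⊛ ω ω′ is js V)) (interchange _ _ _ _)

  module _ (x : Carrier) where

    weight-ν : ∀ (is : Vec I m) (js : Vec J n) {s A} (V : Valid s A) →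
               weight (λ _ _ → weights x 1# 1# 1#) is js V ≈ x ^ total₁₁ V
    weight-ν []       js []      = refl
    weight-ν (i ∷ is) js (r ∷ V) = trans (*-cong (row-ν js r) (weight-ν is js V))
      (sym (^-homo-* x (row₁₁ r) (total₁₁ V)))
      where
      bit-ν : ∀ h t → zeroWeight (weights x 1# 1# 1#) h t ≈ x ^ bit (h ∧ t)
      bit-ν false false = refl
      bit-ν false true  = refl
      bit-ν true  false = refl
      bit-ν true  true  = sym (*-identityʳ x)
      row-ν : ∀ (js : Vec J n) {s v s′} (r : Row {n} h s v h′ s′) →
              rowWeight (λ _ → weights x 1# 1# 1#) js r ≈ x ^ row₁₁ r
      row-ν []       done     = refl
      row-ν (j ∷ js) (zero {h = h} {t = t} r) = trans (*-cong (bit-ν h t) (row-ν js r)) (sym (^-homo-* x (bit (h ∧ t)) (row₁₁ r)))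
      row-ν (j ∷ js) (up r)   = row-ν js r
      row-ν (j ∷ js) (down r) = trans (*-identityˡ _) (row-ν js r)

    weight-μ : ∀ (is : Vec I m) (js : Vec J n) {s A} (V : Valid s A) →
               weight (λ _ _ → weights 1# 1# 1# x) is js V ≈ x ^ total₋ V
    weight-μ []       js []      = refl
    weight-μ (i ∷ is) js (r ∷ V) = trans (*-cong (row-μ js r) (weight-μ is js V))
      (sym (^-homo-* x (row₋ r) (total₋ V)))
      where
      bit-μ : ∀ h t → zeroWeight (weights 1# 1# 1# x) h t ≈ 1#
      bit-μ false false = refl
      bit-μ false true  = refl
      bit-μ true  false = refl
      bit-μ true  true  = refl
      row-μ : ∀ (js : Vec J n) {s v s′} (r : Row {n} h s v h′ s′) →
              rowWeight (λ _ → weights 1# 1# 1# x) js r ≈ x ^ row₋ r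
      row-μ []       done     = refl
      row-μ (j ∷ js) (zero {h = h} {t = t} r) = trans (*-cong (bit-μ h t) (row-μ js r)) (*-identityˡ _)
      row-μ (j ∷ js) (up r)   = row-μ js r
      row-μ (j ∷ js) (down r) = *-congˡ (row-μ js r)

  data Before : ℕ → Vec ℤ n → Set where
    here  : ∀ {v : Vec ℤ n} → Before 0 (1ℤ ∷ v)
    there : ∀ {v : Vec ℤ n} → Before a v → Before (suc a) (0ℤ ∷ v)

  data Zeros : Vec ℤ n → Set where
    []   : Zeros []
    0∷_  : ∀ {v : Vec ℤ n} → Zeros v → Zeros (0ℤ ∷ v)

  -- The index counts the zeros behind the 1, as is suited to the two boundary lines that the
  -- statistics read in reverse.
  data After : ℕ → Vec ℤ n → Set where
    here  : ∀ {v : Vec ℤ a} → Zeros v → After a (1ℤ ∷ v)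
    there : ∀ {v : Vec ℤ n} → After a v → After a (0ℤ ∷ v)

  zerosBefore1-Before : ∀ {v : Vec ℤ n} → Before a v → zerosBefore1 v ≡ a
  zerosBefore1-Before here      = ≡.refl
  zerosBefore1-Before (there p) = ≡.cong suc (zerosBefore1-Before p)

  private
    Zeros-∷ʳ : ∀ {v : Vec ℤ n} → Zeros v → Zeros (v ∷ʳ 0ℤ)
    Zeros-∷ʳ []     = 0∷ []
    Zeros-∷ʳ (0∷ p) = 0∷ Zeros-∷ʳ p

    Zeros-reverse : ∀ {v : Vec ℤ n} → Zeros v → Zeros (reverse v)
    Zeros-reverse []                   = []
    Zeros-reverse (0∷_ {v = v} p) = ≡.subst Zeros (≡.sym (reverse-∷ 0ℤ v)) (Zeros-∷ʳ (Zeros-reverse p))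

    Zeros-Before : ∀ {v : Vec ℤ n} → Zeros v → Before n (v ∷ʳ 1ℤ)
    Zeros-Before []     = here
    Zeros-Before (0∷ p) = there (Zeros-Before p)

    Before-∷ʳ : ∀ {v : Vec ℤ n} → Before a v → Before a (v ∷ʳ 0ℤ)
    Before-∷ʳ here      = here
    Before-∷ʳ (there p) = there (Before-∷ʳ p)

    After-reverse : ∀ {v : Vec ℤ n} → After a v → Before a (reverse v)
    After-reverse {a = a} (here {v = v} p) =
      ≡.subst (Before a) (≡.sym (reverse-∷ 1ℤ v)) (Zeros-Before (Zeros-reverse p))
    After-reverse {a = a} (there {v = v} p) =
      ≡.subst (Before a) (≡.sym (reverse-∷ 0ℤ v)) (Before-∷ʳ (After-reverse p))

  zerosBefore1-After : ∀ {v : Vec ℤ n} → After a v → zerosBefore1 (reverse v) ≡ a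
  zerosBefore1-After p = zerosBefore1-Before (After-reverse p)

  private
    last-lookup : ∀ {A : Set α} (v : Vec A (suc n)) → last v ≡ lookup v (fromℕ n)
    last-lookup (x ∷ [])        = ≡.refl
    last-lookup (x ∷ v@(_ ∷ _)) = last-lookup v

  last-transpose : ∀ (A : Vec (Vec ℤ (suc n)) m) → last (transpose A) ≡ map last A
  last-transpose {n = n} A = ≡.trans (last-lookup (transpose A))
    (≡.trans (lookup-transpose A (fromℕ n)) (map-cong (λ v → ≡.sym (last-lookup v)) A))

  head-transpose : ∀ (A : Vec (Vec ℤ (suc n)) m) → head (transpose A) ≡ map head A
  head-transpose A = ≡.trans (head-lookup (transpose A))
    (≡.trans (lookup-transpose A zero) (map-cong (λ v → ≡.sym (head-lookup v)) A))
    where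
    head-lookup : ∀ {A : Set α} {n} (v : Vec A (suc n)) → head v ≡ lookup v zero
    head-lookup (x ∷ v) = ≡.refl

  private
    zeroWeight-ones : ∀ h t → zeroWeight ones h t ≈ 1#
    zeroWeight-ones false false = refl
    zeroWeight-ones false true  = refl
    zeroWeight-ones true  false = refl
    zeroWeight-ones true  true  = refl

    rowWeight-ones : ∀ {ω : J → Weights} (js : Vec J n) → (∀ q → ω (lookup js q) ≡ ones) →
                     ∀ {s v s′} (r : Row {n} h s v h′ s′) → rowWeight ω js r ≈ 1#
    rowWeight-ones []       e done     = refl
    rowWeight-ones (j ∷ js) e (zero {h = h} {t = t} r) rewrite e zero =
      trans (*-cong (zeroWeight-ones h t) (rowWeight-ones js (λ q → e (suc q)) r)) (*-identityˡ 1#)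
    rowWeight-ones (j ∷ js) e (up r)   = rowWeight-ones js (λ q → e (suc q)) r
    rowWeight-ones (j ∷ js) e (down r) rewrite e zero =
      trans (*-identityˡ _) (rowWeight-ones js (λ q → e (suc q)) r)

  module _ (z κ : Carrier) where

    -- One choice serves all four sides: the zeros to be counted have both partial sums 0 in the top
    -- row and left column and both 1 in the bottom row and right column, while the other zeros are
    -- of type `b`. A boundary line contains no -1, so `κ` can be chosen freely.
    boundary : Weights
    boundary = weights z z 1# κ

    private
      row-true : ∀ (js : Vec J n) {v s′} (r : Row {n} true (falseₛ n) v true s′) → rowWeight (λ _ → boundary) js r ≈ 1#
      row-true []       done     = refl
      row-true (j ∷ js) (zero r) = trans (*-identityˡ _) (row-true js r)

      topRow : ∀ (js : Vec J n) {v s′} (r : Row {n} false (falseₛ n) v true s′) →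
               ∃[ a ] Before a v × rowWeight (λ _ → boundary) js r ≈ z ^ a
      topRow (j ∷ js) (up r)   = 0 , here , row-true js r
      topRow (j ∷ js) (zero r) with a , p , e ← topRow js r = suc a , there p , *-congˡ e

      row-trues : ∀ (js : Vec J n) {s v} (r : Row {n} true s v true (trues n)) →
                  Zeros v × rowWeight (λ _ → boundary) js r ≈ z ^ n
      row-trues []       done     = [] , refl
      row-trues (j ∷ js) (zero r) with p , e ← row-trues js r = 0∷ p , *-congˡ e

      bottomRow : ∀ (js : Vec J n) {s v} (r : Row {n} false s v true (trues n)) →
                  ∃[ a ] After a v × rowWeight (λ _ → boundary) js r ≈ z ^ a
      bottomRow {n = suc n} (j ∷ js) (up r) with p , e ← row-trues js r = n , here p , e
      bottomRow (j ∷ js) (zero r) with a , p , e ← bottomRow js r = a , there p , trans (*-identityˡ _) e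

      weight-ones : ∀ {ω : I → J → Weights} (is : Vec I m) → (∀ p j → ω (lookup is p) j ≡ ones) →
                    ∀ (js : Vec J n) {s A} (V : Valid s A) → weight ω is js V ≈ 1#
      weight-ones []       e js []      = refl
      weight-ones (i ∷ is) e js (r ∷ V) = trans
        (*-cong (rowWeight-ones js (λ q → e zero (lookup js q)) r) (weight-ones is (λ p → e (suc p)) js V)) (*-identityˡ 1#)

    weight-top : ∀ (ω : I → Weights) i (is : Vec I m) → ω i ≡ boundary → (∀ p → ω (lookup is p) ≡ ones) →
                 ∀ (js : Vec J n) {v A} (V : Valid (falseₛ n) (v ∷ A)) →
                 ∃[ a ] Before a v × weight (λ i _ → ω i) (i ∷ is) js V ≈ z ^ a
    weight-top ω i is e e′ js (r ∷ V) rewrite e with a , p , q ← topRow js r =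
      a , p , trans (*-cong q (weight-ones is (λ p _ → e′ p) js V)) (*-identityʳ _)

    weight-bottom : ∀ (ω : I → Weights) (is : Vec I m) i → ω i ≡ boundary → (∀ p → ω (lookup is p) ≡ ones) →
                    ∀ (js : Vec J n) {s A} (V : Valid s A) →
                    ∃[ a ] After a (last A) × weight (λ i _ → ω i) (is ∷ʳ i) js V ≈ z ^ a
    weight-bottom ω []       i e e′ js (r ∷ []) rewrite e with a , p , q ← bottomRow js r =
      a , p , trans (*-identityʳ _) q
    weight-bottom ω (i′ ∷ is) i e e′ js (r ∷ V@(_ ∷ _)) with a , p , q ← weight-bottom ω is i e (λ p → e′ (suc p)) js V =
      a , p , trans (*-cong (rowWeight-ones js (λ _ → e′ zero) r) q) (*-identityˡ _)

    module _ (ω : J → Weights) j (js : Vec J n) (e : ω j ≡ boundary) (e′ : ∀ q → ω (lookup js q) ≡ ones) where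

      private
        weight-left-true : ∀ (is : Vec I m) {s A} (V : Valid (true ∷ s) A) → weight (λ _ → ω) is (j ∷ js) V ≈ 1#
        weight-left-true []       []           = refl
        weight-left-true (i ∷ is) (zero r ∷ V) rewrite e = trans
          (*-cong (trans (*-identityˡ _) (rowWeight-ones js e′ r)) (weight-left-true is V)) (*-identityˡ 1#)

      weight-left : ∀ (is : Vec I m) {s A} (V : Valid (false ∷ s) A) →
                    ∃[ a ] Before a (map head A) × weight (λ _ → ω) is (j ∷ js) V ≈ z ^ a
      weight-left (i ∷ is) (up r ∷ V)   = 0 , here , trans
        (*-cong (rowWeight-ones js e′ r) (weight-left-true is V)) (*-identityˡ 1#)
      weight-left (i ∷ is) (zero r ∷ V) with a , p , q ← weight-left is V rewrite e =
        suc a , there p , *-cong (trans (*-congˡ (rowWeight-ones js e′ r)) (*-identityʳ z)) q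

    -- The last vertex of a row: its column sum before, its entry, its column sum after.
    data LastVertex : Bool → ℤ → Bool → Carrier → Set where
      still₀ : LastVertex false 0ℤ false 1#
      up     : LastVertex false 1ℤ true 1#
      still₁ : LastVertex true 0ℤ true z

    module _ (ω : J → Weights) j (e : ω j ≡ boundary) where

      -- A row ends with sum 1, which excludes an entry -1 in its last place and leaves three cases.
      lastVertex : ∀ (js : Vec J n) (e′ : ∀ q → ω (lookup js q) ≡ ones) {s v s′} (r : Row {suc n} h s v true s′) →
                   ∃[ w ] LastVertex (last s) (last v) (last s′) w × rowWeight ω (js ∷ʳ j) r ≈ w
      lastVertex [] e′ (zero {h = true} {t = false} done) rewrite e = 1# , still₀ , *-identityʳ _
      lastVertex [] e′ (zero {h = true} {t = true} done)  rewrite e = z , still₁ , *-identityʳ _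
      lastVertex [] e′ (up done) = 1# , up , refl
      lastVertex (j′ ∷ js) e′ {s = _ ∷ _ ∷ _} {v = _ ∷ _ ∷ _} {s′ = _ ∷ _ ∷ _} (zero {h = h} {t = t} r)
        with w , p , q ← lastVertex js (λ q → e′ (suc q)) r rewrite e′ zero =
        w , p , trans (*-cong (zeroWeight-ones h t) q) (*-identityˡ _)
      lastVertex (j′ ∷ js) e′ {s = _ ∷ _ ∷ _} {v = _ ∷ _ ∷ _} {s′ = _ ∷ _ ∷ _} (up r)
        with w , p , q ← lastVertex js (λ q → e′ (suc q)) r = w , p , q
      lastVertex (j′ ∷ js) e′ {s = _ ∷ _ ∷ _} {v = _ ∷ _ ∷ _} {s′ = _ ∷ _ ∷ _} (down r)
        with w , p , q ← lastVertex js (λ q → e′ (suc q)) r rewrite e′ zero =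
        w , p , trans (*-identityˡ _) q

      last-trues : ∀ n → last (trues (suc n)) ≡ true
      last-trues zero    = ≡.refl
      last-trues (suc n) = last-trues n

      last-falses : ∀ n → last (falseₛ (suc n)) ≡ false
      last-falses zero    = ≡.refl
      last-falses (suc n) = last-falses n

      module _ (js : Vec J n) (e′ : ∀ q → ω (lookup js q) ≡ ones) where

        weight-right-true : ∀ (is : Vec I m) {s A} (V : Valid s A) → last s ≡ true →
                            Zeros (map last A) × weight (λ _ → ω) is (js ∷ʳ j) V ≈ z ^ m
        weight-right-true []       []      t = [] , refl
        weight-right-true (i ∷ is) (_∷_ {s = s} {v = v} {s′ = s′} r V) t with lastVertex js e′ r
        ... | w , p , q = step (last s) (last v) (last s′) t p q (weight-right-true is V)
          where
          -- The two sums and the entry are made variables so that `LastVertex` can be matched.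
          step : ∀ t a t′ {w} → t ≡ true → LastVertex t a t′ w → rowWeight ω (js ∷ʳ j) r ≈ w →
                 (t′ ≡ true → Zeros _ × weight (λ _ → ω) is (js ∷ʳ j) V ≈ _) →
                 Zeros (a ∷ _) × weight (λ _ → ω) (i ∷ is) (js ∷ʳ j) (r ∷ V) ≈ _
          step _ _ _ _ still₁ q ih with u , q′ ← ih ≡.refl = 0∷ u , *-cong q q′

        weight-right : ∀ (is : Vec I m) {s A} (V : Valid s A) → last s ≡ false →
                       ∃[ a ] After a (map last A) × weight (λ _ → ω) is (js ∷ʳ j) V ≈ z ^ a
        weight-right [] [] t with () ← ≡.trans (≡.sym (last-trues n)) t
        weight-right {m = suc m} (i ∷ is) (_∷_ {s = s} {v = v} {s′ = s′} r V) t with lastVertex js e′ r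
        ... | w , p , q = step (last s) (last v) (last s′) t p q (weight-right-true is V) (weight-right is V)
          where
          step : ∀ t a t′ {w} → t ≡ false → LastVertex t a t′ w → rowWeight ω (js ∷ʳ j) r ≈ w →
                 (t′ ≡ true → Zeros _ × weight (λ _ → ω) is (js ∷ʳ j) V ≈ z ^ m) →
                 (t′ ≡ false → ∃[ a ] After a _ × weight (λ _ → ω) is (js ∷ʳ j) V ≈ z ^ a) →
                 ∃[ b ] After b (a ∷ _) × weight (λ _ → ω) (i ∷ is) (js ∷ʳ j) (r ∷ V) ≈ z ^ b
          step _ _ _ _ up     q ih₁ ih₀ with u , q′ ← ih₁ ≡.refl = m , here u , trans (*-cong q q′) (*-identityˡ _)
          step _ _ _ _ still₀ q ih₁ ih₀ with a , u , q′ ← ih₀ ≡.refl = a , there u , trans (*-cong q q′) (*-identityˡ _)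

-- The refined generating functions as partition functions

module Refined {c ℓ} (R : CommutativeRing c ℓ) where

  open CommutativeRing R hiding (zero)
  open IntSolver R hiding (fromℕ)
  open SixVertex R
  open Exchange R using (A; κ; :κ)
  open Matrices R
  open Boundary R
  open Validity
  open Statistics
  open GeneratingFunctions R
  open import Data.Vec.Base using (reverse)
  open import Relation.Binary.Reasoning.Setoid setoid

  private
    variable
      m n : ℕ

  -- The weights depend only on whether a line is the first, an inner or the last one. First and
  -- last differ from order 2 on; order 1 is treated by itself.
  data Side : Set where
    front inner back : Side

  sides : ∀ m → Vec Side (suc (suc m))
  sides m = front ∷ (replicate m inner ∷ʳ back)

  atFront atBack : Weights → Side → Weights
  atFront w front = w
  atFront w inner = ones
  atFront w back  = ones
  atBack w front = ones
  atBack w inner = ones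
  atBack w back  = w

  private
    atFront-ones : ∀ m {w} q → atFront w (lookup (replicate m inner ∷ʳ back) q) ≡ ones
    atFront-ones zero    zero    = ≡.refl
    atFront-ones (suc m) zero    = ≡.refl
    atFront-ones (suc m) (suc q) = atFront-ones m q

    atBack-ones : ∀ m {w} q → atBack w (lookup (front ∷ replicate m inner) q) ≡ ones
    atBack-ones m       zero          = ≡.refl
    atBack-ones (suc m) (suc zero)    = ≡.refl
    atBack-ones (suc m) (suc (suc q)) = atBack-ones m (suc q)

  module _ (x y z₁ z₂ z₃ z₄ k₁ k₂ k₃ k₄ : Carrier) where

    refinedWeights : Side → Side → Weights
    refinedWeights i j = weights x 1# 1# 1# ⊛ weights 1# 1# 1# y
      ⊛ atFront (boundary z₁ k₁) i ⊛ atBack (boundary z₂ k₂) j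
      ⊛ atBack (boundary z₃ k₃) i ⊛ atFront (boundary z₄ k₄) j

    Zquad-partition : ∀ m → Zquad (suc (suc m)) x y z₁ z₂ z₃ z₄ ≈ partition refinedWeights (sides m) (sides m)
    Zquad-partition m = sum-ASM refinedWeights (sides m) (sides m) _ λ { A@(_ ∷ _) V → trans
      (*-cong (*-cong (*-cong (*-cong (*-cong
        (trans (^-≡ x (ν-total V)) (sym (weight-ν x (sides m) (sides m) V)))
        (trans (^-≡ y (μ-total V)) (sym (weight-μ y (sides m) (sides m) V))))
        (top A V)) (right A V)) (bottom A V)) (left A V))
      (sym (split V)) }
      where
      ^-≡ : ∀ z {m n} → m ≡ n → z ^ m ≈ z ^ n
      ^-≡ z e = reflexive (≡.cong (z ^_) e)

      N : ℕ
      N = suc (suc m)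

      top : ∀ (A : Matrix N) (V : Valid (falseₛ N) A) →
            z₁ ^ ρT A ≈ weight (λ i _ → atFront (boundary z₁ k₁) i) (sides m) (sides m) V
      top (_ ∷ _) V with a , p , e ← weight-top z₁ k₁ (atFront (boundary z₁ k₁)) front _ ≡.refl (atFront-ones m) (sides m) V =
        trans (^-≡ z₁ (zerosBefore1-Before p)) (sym e)

      bottom : ∀ (A : Matrix N) (V : Valid (falseₛ N) A) →
               z₃ ^ ρB A ≈ weight (λ i _ → atBack (boundary z₃ k₃) i) (sides m) (sides m) V
      bottom A V with a , p , e ← weight-bottom z₃ k₃ (atBack (boundary z₃ k₃)) (front ∷ replicate m inner) back
                                     ≡.refl (atBack-ones m) (sides m) V =
        trans (^-≡ z₃ (zerosBefore1-After p)) (sym e)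

      left : ∀ (A : Matrix N) (V : Valid (falseₛ N) A) →
             z₄ ^ ρL A ≈ weight (λ _ j → atFront (boundary z₄ k₄) j) (sides m) (sides m) V
      left A V with a , p , e ← weight-left z₄ k₄ (atFront (boundary z₄ k₄)) front _ ≡.refl (atFront-ones m) (sides m) V =
        trans (^-≡ z₄ (≡.trans (≡.cong zerosBefore1 (head-transpose A)) (zerosBefore1-Before p))) (sym e)

      right : ∀ (A : Matrix N) (V : Valid (falseₛ N) A) →
              z₂ ^ ρR A ≈ weight (λ _ j → atBack (boundary z₂ k₂) j) (sides m) (sides m) V
      right A V with a , p , e ← weight-right z₂ k₂ (atBack (boundary z₂ k₂)) back ≡.refl
                                    (front ∷ replicate m inner) (atBack-ones m) (sides m) V
                                    (last-falses z₂ k₂ (atBack (boundary z₂ k₂)) back ≡.refl (suc m)) =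
        trans (^-≡ z₂ (≡.trans (≡.cong (λ v → zerosBefore1 (reverse v)) (last-transpose A)) (zerosBefore1-After p))) (sym e)

      split : ∀ {A : Matrix N} (V : Valid (falseₛ N) A) → weight refinedWeights (sides m) (sides m) V ≈ _
      split V = trans (weight-⊛ _ _ (sides m) (sides m) V) (*-congʳ (trans (weight-⊛ _ _ (sides m) (sides m) V)
        (*-congʳ (trans (weight-⊛ _ _ (sides m) (sides m) V) (*-congʳ (trans (weight-⊛ _ _ (sides m) (sides m) V)
        (*-congʳ (weight-⊛ _ _ (sides m) (sides m) V))))))))

  -- The weights of Zquad in the coordinates of the six-vertex weights; the two
  -- families differ only where both parameters are nonzero.
  module _ (x y : Carrier) where

    refine : Carrier → Carrier
    refine p = 1# + y * p

    plain : Carrier → Carrier → Weights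
    plain p v = weights (x * (refine p * refine v)) (refine p * refine v) 1# (y * κ x y p * κ x y v)

    zeros : ∀ m → Vec Carrier m
    zeros m = replicate m 0#

    private
      refine-0 : 1# ≈ refine 0#
      refine-0 = solve 1 (λ y → :1 := :1 :+ y :* :0) refl y

      parameter : Carrier → Carrier → Side → Carrier
      parameter p q front = p
      parameter p q inner = 0#
      parameter p q back  = q

      lookup-parameter : ∀ m p q i → lookup (p ∷ (zeros m ∷ʳ q)) i ≡ parameter p q (lookup (sides m) i)
      lookup-parameter m       p q zero          = ≡.refl
      lookup-parameter zero    p q (suc zero)    = ≡.refl
      lookup-parameter (suc m) p q (suc zero)    = ≡.refl
      lookup-parameter (suc m) p q (suc (suc i)) = lookup-parameter m p q (suc i)

      κ-0 : κ x y 0# ≈ 1#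
      κ-0 = solve 2 (λ x y → :κ x y :0 := :1) refl x y

    module _ {p₁ p₂ p₃ p₄ z₁ z₂ z₃ z₄ : Carrier}
             (e₁ : z₁ ≈ refine p₁) (e₂ : z₂ ≈ refine p₂) (e₃ : z₃ ≈ refine p₃) (e₄ : z₄ ≈ refine p₄) where

      private
        ω : Side → Side → Weights
        -- The free weights of -1 in the boundary lines are chosen as `κ x y p`, which makes `c₋`
        -- the same as in the six-vertex weights.
        ω = refinedWeights x y z₁ z₂ z₃ z₄ (κ x y p₁) (κ x y p₂) (κ x y p₃) (κ x y p₄)

        rowFactor columnFactor rowκ columnκ : Side → Carrier
        rowFactor i    = a₂ (atFront (boundary z₁ (κ x y p₁)) i) * a₂ (atBack (boundary z₃ (κ x y p₃)) i)
        columnFactor j = a₂ (atFront (boundary z₄ (κ x y p₄)) j) * a₂ (atBack (boundary z₂ (κ x y p₂)) j)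
        rowκ i    = c₋ (atFront (boundary z₁ (κ x y p₁)) i) * c₋ (atBack (boundary z₃ (κ x y p₃)) i)
        columnκ j = c₋ (atFront (boundary z₄ (κ x y p₄)) j) * c₋ (atBack (boundary z₂ (κ x y p₂)) j)

        rowFactor≈ : ∀ i → rowFactor i ≈ refine (parameter p₁ p₃ i)
        rowFactor≈ front = trans (*-identityʳ _) e₁
        rowFactor≈ inner = trans (*-identityʳ _) refine-0
        rowFactor≈ back  = trans (*-identityˡ _) e₃

        columnFactor≈ : ∀ j → columnFactor j ≈ refine (parameter p₄ p₂ j)
        columnFactor≈ front = trans (*-identityʳ _) e₄
        columnFactor≈ inner = trans (*-identityʳ _) refine-0
        columnFactor≈ back  = trans (*-identityˡ _) e₂

        rowκ≈ : ∀ i → rowκ i ≈ κ x y (parameter p₁ p₃ i)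
        rowκ≈ front = *-identityʳ _
        rowκ≈ inner = trans (*-identityʳ _) (sym κ-0)
        rowκ≈ back  = *-identityˡ _

        columnκ≈ : ∀ j → columnκ j ≈ κ x y (parameter p₄ p₂ j)
        columnκ≈ front = *-identityʳ _
        columnκ≈ inner = trans (*-identityʳ _) (sym κ-0)
        columnκ≈ back  = *-identityˡ _

        boundary-a : ∀ i {z κ} → a₁ (atFront (boundary z κ) i) ≈ a₂ (atFront (boundary z κ) i)
        boundary-a front = refl
        boundary-a inner = refl
        boundary-a back  = refl

        boundary-a′ : ∀ i {z κ} → a₁ (atBack (boundary z κ) i) ≈ a₂ (atBack (boundary z κ) i)
        boundary-a′ front = refl
        boundary-a′ inner = refl
        boundary-a′ back  = refl

        boundary-b : ∀ i {z κ} → b (atFront (boundary z κ) i) ≈ 1#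
        boundary-b front = refl
        boundary-b inner = refl
        boundary-b back  = refl

        boundary-b′ : ∀ i {z κ} → b (atBack (boundary z κ) i) ≈ 1#
        boundary-b′ front = refl
        boundary-b′ inner = refl
        boundary-b′ back  = refl

        ω≈plain : ∀ i j → ω i j ≈ʷ plain (parameter p₁ p₃ i) (parameter p₄ p₂ j)
        ω≈plain i j =
          trans (*-cong (*-cong (*-cong (*-congˡ (boundary-a i)) (boundary-a′ j)) (boundary-a′ i)) (boundary-a j))
            (trans (solve 5 (λ x a b c d → x :* :1 :* a :* b :* c :* d := x :* ((a :* c) :* (d :* b))) refl _ _ _ _ _)
              (*-congˡ (*-cong (rowFactor≈ i) (columnFactor≈ j)))) ,
          trans (solve 4 (λ a b c d → :1 :* :1 :* a :* b :* c :* d := (a :* c) :* (d :* b)) refl _ _ _ _)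
            (*-cong (rowFactor≈ i) (columnFactor≈ j)) ,
          trans (*-cong (*-cong (*-cong (*-congˡ (boundary-b i)) (boundary-b′ j)) (boundary-b′ i)) (boundary-b j))
            (solve 0 (:1 :* :1 :* :1 :* :1 :* :1 :* :1 := :1) refl) ,
          trans (solve 5 (λ y a b c d → :1 :* y :* a :* b :* c :* d := y :* (a :* c) :* (d :* b)) refl _ _ _ _ _)
            (*-cong (*-congˡ (rowκ≈ i)) (columnκ≈ j))

      Zquad-plain : ∀ m → Zquad (suc (suc m)) x y z₁ z₂ z₃ z₄ ≈
                          partition plain (p₁ ∷ (zeros m ∷ʳ p₃)) (p₄ ∷ (zeros m ∷ʳ p₂))
      Zquad-plain m = trans (Zquad-partition x y z₁ z₂ z₃ z₄ (κ x y p₁) (κ x y p₂) (κ x y p₃) (κ x y p₄) m)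
        (partition-cong {ω′ = plain} (sides m) (p₁ ∷ (zeros m ∷ʳ p₃)) (sides m) (p₄ ∷ (zeros m ∷ʳ p₂)) λ i j →
          ≡.subst₂ (λ p v → ω (lookup (sides m) i) (lookup (sides m) j) ≈ʷ plain p v)
            (≡.sym (lookup-parameter m p₁ p₃ i)) (≡.sym (lookup-parameter m p₄ p₂ j))
            (ω≈plain (lookup (sides m) i) (lookup (sides m) j)))

    private
      zeros-∷ʳ : ∀ m → zeros m ∷ʳ 0# ≡ zeros (suc m)
      zeros-∷ʳ zero    = ≡.refl
      zeros-∷ʳ (suc m) = ≡.cong (0# ∷_) (zeros-∷ʳ m)

      one≈ : ∀ a → 1# * 1# * 1# * 1# * 1# * 1# + 0# ≈ a * 0# + 1#
      one≈ = solve 1 (λ a → :1 :* :1 :* :1 :* :1 :* :1 :* :1 :+ :0 := a :* :0 :+ :1) refl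

    Zadj-plain : ∀ {p₁ p₄ z₁ z₄} → z₁ ≈ refine p₁ → z₄ ≈ refine p₄ → ∀ m →
                 Zquad (suc m) x y z₁ 1# 1# z₄ ≈ partition plain (p₁ ∷ zeros m) (p₄ ∷ zeros m)
    -- The only matrix of order 1 is (1), and its weight is 1.
    Zadj-plain e₁ e₄ zero    = one≈ _
    Zadj-plain {p₁} {p₄} {z₁} {z₄} e₁ e₄ (suc m) =
      ≡.subst (λ os → Zquad (suc (suc m)) x y z₁ 1# 1# z₄ ≈ partition plain (p₁ ∷ os) (p₄ ∷ os))
        (zeros-∷ʳ m) (Zquad-plain e₁ refine-0 refine-0 e₄ m)

    Z̃adj-plain : ∀ {p₁ p₂ z₁ z₂} → z₁ ≈ refine p₁ → z₂ ≈ refine p₂ → ∀ m →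
                 Zquad (suc m) x y z₁ z₂ 1# 1# ≈ partition plain (p₁ ∷ zeros m) (zeros m ∷ʳ p₂)
    Z̃adj-plain e₁ e₂ zero    = one≈ _
    Z̃adj-plain {p₁} {p₂} {z₁} {z₂} e₁ e₂ (suc m) =
      ≡.subst (λ os → Zquad (suc (suc m)) x y z₁ z₂ 1# 1# ≈ partition plain (p₁ ∷ os) (0# ∷ (zeros m ∷ʳ p₂)))
        (zeros-∷ʳ m) (Zquad-plain e₁ e₂ refine-0 refine-0 m)

    Z-plain : ∀ m → Z m x y ≈ partition plain (zeros m) (zeros m)
    Z-plain zero    = refl
    Z-plain (suc m) = Zadj-plain refine-0 refine-0 m

-- The algebra of correcting the four corners

module Assembly {c ℓ} (R : CommutativeRing c ℓ) where

  open CommutativeRing R hiding (zero)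
  open IntSolver R hiding (fromℕ)
  open Exchange R using (A; B; :A; :B)
  open import Relation.Binary.Reasoning.Setoid setoid

  -- P and Q are the values at a and b of one affine function with constant term r: a partition
  -- function with two choices of one corner weight.
  Relation : Carrier → Carrier → Carrier → Carrier → Carrier → Set (c ⊔ ℓ)
  Relation P Q a b r = Σ[ t ∈ Carrier ] P ≈ a * t + r × Q ≈ b * t + r

  -- The slope t disappears without division, as a corner weight need not be invertible.
  eliminate : ∀ {P Q a b r} → Relation P Q a b r → b * P ≈ a * Q + (b - a) * r
  eliminate {a = a} {b = b} {r = r} (t , e , f) = trans (*-congˡ e)
    (trans (solve 4 (λ a b r t → b :* (a :* t :+ r) := a :* (b :* t :+ r) :+ (b :- a) :* r) refl a b r t)
           (+-congʳ (*-congˡ (sym f))))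

  -- The part of the final identity that involves the top left and bottom right
  -- corners, and the part that involves the other two.
  module _ (y² a A₁₄ A₃₂ z₁₄ z₃₂ α β U c e₁₄ e₃₂ k₁ k₃ k₅ : Carrier) where

    diagonal :
      y² * z₃₂ * a + c * e₃₂ ≈ (y² * a + k₁ * A₁₄) * A₃₂ →
      y² * z₁₄ * a + c * e₁₄ ≈ (y² * a + k₃ * A₃₂) * A₁₄ →
      y² * a * z₁₄ * z₃₂ + c * (z₁₄ * e₃₂ + A₃₂ * e₁₄) ≈ (y² * a + k₁ * A₁₄ + k₃ * A₃₂ + k₅) * (A₁₄ * A₃₂) →
      y² * a * ((A₃₂ * β + U) * (A₁₄ * α + U)) * (z₁₄ * z₃₂)
        + c * (z₁₄ * e₃₂ * (A₁₄ * α + U) * U + A₃₂ * e₁₄ * (z₃₂ * β + U) * U) ≈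
      (y² * a * (z₁₄ * α + U) * (z₃₂ * β + U) + k₁ * A₁₄ * (z₁₄ * α + U) * U
        + k₃ * A₃₂ * (z₃₂ * β + U) * U + k₅ * (U * U)) * (A₁₄ * A₃₂)
    diagonal i₁ i₂ i₃ = begin
      -- Sorted by monomials in α, β and U, the two sides have the same term with αβ; those with αU,
      -- βU and U² are compared by the three hypotheses.
      _ ≈⟨ solve 12 (λ y² a A₁₄ A₃₂ z₁₄ z₃₂ α β U c e₁₄ e₃₂ →
             y² :* a :* ((A₃₂ :* β :+ U) :* (A₁₄ :* α :+ U)) :* (z₁₄ :* z₃₂)
               :+ c :* (z₁₄ :* e₃₂ :* (A₁₄ :* α :+ U) :* U :+ A₃₂ :* e₁₄ :* (z₃₂ :* β :+ U) :* U) :=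
             α :* β :* (y² :* a :* A₃₂ :* A₁₄ :* z₁₄ :* z₃₂)
               :+ α :* U :* z₁₄ :* A₁₄ :* (y² :* z₃₂ :* a :+ c :* e₃₂)
               :+ β :* U :* z₃₂ :* A₃₂ :* (y² :* z₁₄ :* a :+ c :* e₁₄)
               :+ U :* U :* (y² :* a :* z₁₄ :* z₃₂ :+ c :* (z₁₄ :* e₃₂ :+ A₃₂ :* e₁₄))) refl
             y² a A₁₄ A₃₂ z₁₄ z₃₂ α β U c e₁₄ e₃₂ ⟩
      _ ≈⟨ +-cong (+-cong (+-congˡ (*-congˡ i₁)) (*-congˡ i₂)) (*-congˡ i₃) ⟩
      _ ≈⟨ solve 12 (λ y² a A₁₄ A₃₂ z₁₄ z₃₂ α β U k₁ k₃ k₅ →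
             α :* β :* (y² :* a :* A₃₂ :* A₁₄ :* z₁₄ :* z₃₂)
               :+ α :* U :* z₁₄ :* A₁₄ :* ((y² :* a :+ k₁ :* A₁₄) :* A₃₂)
               :+ β :* U :* z₃₂ :* A₃₂ :* ((y² :* a :+ k₃ :* A₃₂) :* A₁₄)
               :+ U :* U :* ((y² :* a :+ k₁ :* A₁₄ :+ k₃ :* A₃₂ :+ k₅) :* (A₁₄ :* A₃₂)) :=
             (y² :* a :* (z₁₄ :* α :+ U) :* (z₃₂ :* β :+ U) :+ k₁ :* A₁₄ :* (z₁₄ :* α :+ U) :* U
               :+ k₃ :* A₃₂ :* (z₃₂ :* β :+ U) :* U :+ k₅ :* (U :* U)) :* (A₁₄ :* A₃₂)) refl
             y² a A₁₄ A₃₂ z₁₄ z₃₂ α β U k₁ k₃ k₅ ⟩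
      _ ∎

  module _ (y² b B₁₂ B₃₄ γ δ g d c x f₁₂ f₃₄ k₂ k₄ k₆ : Carrier) where

    antidiagonal :
      - (y² * b) + c * x * f₃₄ ≈ - ((y² * b + k₂ * B₁₂) * B₃₄) →
      - (y² * b) + c * x * f₁₂ ≈ - ((y² * b + k₄ * B₃₄) * B₁₂) →
      - (y² * b) + c * x * (f₃₄ + B₃₄ * f₁₂) ≈ - ((y² * b + k₂ * B₁₂ + k₄ * B₃₄ + k₆) * (B₁₂ * B₃₄)) →
      - (y² * b * ((B₁₂ * γ + g) * (B₃₄ * δ + d)))
        + c * x * (f₃₄ * d * (B₁₂ * γ + g) + B₃₄ * f₁₂ * g * (δ + d)) ≈
      - ((y² * b * (γ + g) * (δ + d) + k₂ * B₁₂ * d * (γ + g)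
        + k₄ * B₃₄ * g * (δ + d) + k₆ * g * d) * (B₁₂ * B₃₄))
    antidiagonal i₁ i₂ i₃ = begin
      -- Likewise, the hypotheses compare the terms with γd, δg and gd.
      _ ≈⟨ solve 12 (λ y² b B₁₂ B₃₄ γ δ g d c x f₁₂ f₃₄ →
             :- (y² :* b :* ((B₁₂ :* γ :+ g) :* (B₃₄ :* δ :+ d)))
               :+ c :* x :* (f₃₄ :* d :* (B₁₂ :* γ :+ g) :+ B₃₄ :* f₁₂ :* g :* (δ :+ d)) :=
             :- (γ :* δ :* y² :* b :* B₁₂ :* B₃₄)
               :+ γ :* d :* B₁₂ :* (:- (y² :* b) :+ c :* x :* f₃₄)
               :+ δ :* g :* B₃₄ :* (:- (y² :* b) :+ c :* x :* f₁₂)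
               :+ g :* d :* (:- (y² :* b) :+ c :* x :* (f₃₄ :+ B₃₄ :* f₁₂))) refl
             y² b B₁₂ B₃₄ γ δ g d c x f₁₂ f₃₄ ⟩
      _ ≈⟨ +-cong (+-cong (+-congˡ (*-congˡ i₁)) (*-congˡ i₂)) (*-congˡ i₃) ⟩
      _ ≈⟨ solve 11 (λ y² b B₁₂ B₃₄ γ δ g d k₂ k₄ k₆ →
             :- (γ :* δ :* y² :* b :* B₁₂ :* B₃₄)
               :+ γ :* d :* B₁₂ :* (:- ((y² :* b :+ k₂ :* B₁₂) :* B₃₄))
               :+ δ :* g :* B₃₄ :* (:- ((y² :* b :+ k₄ :* B₃₄) :* B₁₂))
               :+ g :* d :* (:- ((y² :* b :+ k₂ :* B₁₂ :+ k₄ :* B₃₄ :+ k₆) :* (B₁₂ :* B₃₄))) :=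
             :- ((y² :* b :* (γ :+ g) :* (δ :+ d) :+ k₂ :* B₁₂ :* d :* (γ :+ g)
               :+ k₄ :* B₃₄ :* g :* (δ :+ d) :+ k₆ :* g :* d) :* (B₁₂ :* B₃₄))) refl
             y² b B₁₂ B₃₄ γ δ g d k₂ k₄ k₆ ⟩
      _ ∎

  module _ (x y p₁ p₂ p₃ p₄ : Carrier) where

    A₁₂ A₃₄ A₁₄ A₃₂ B₁₂ B₃₄ B₁₄ B₃₂ z₁₄ z₃₂ c₀ : Carrier
    A₁₂ = A x y p₁ p₂
    A₃₄ = A x y p₃ p₄
    A₁₄ = A x y p₁ p₄
    A₃₂ = A x y p₃ p₂
    B₁₂ = B x y p₁ p₂
    B₃₄ = B x y p₃ p₄
    B₁₄ = B x y p₁ p₄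
    B₃₂ = B x y p₃ p₂
    z₁₄ = (1# + y * p₁) * (1# + y * p₄)
    z₃₂ = (1# + y * p₃) * (1# + y * p₂)
    c₀ = y * (y * (p₄ - p₂)) * (y * (p₁ - p₃))

    -- These come from z = 1 + yp in the last five terms of the theorem, where each z - 1 becomes
    -- yp. Those with even index belong to the powers of xz₁z₂ and xz₃z₄; the very last term gives
    -- both `k₅` and `k₆`.
    k₁ k₂ k₃ k₄ k₅ k₆ : Carrier
    k₁ = y * y * y * (p₂ * p₃)
    k₂ = x * (y * y * y * (p₃ * p₄))
    k₃ = y * y * y * (p₁ * p₄)
    k₄ = x * (y * y * y * (p₁ * p₂))
    k₅ = y * y * y * y * (p₁ * p₂ * (p₃ * p₄))
    k₆ = x * x * (y * y * y * y * (p₁ * p₂ * (p₃ * p₄)))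

    private
      :z : ∀ {n} (y p q : Polynomial n) → Polynomial n
      :z y p q = (:1 :+ y :* p) :* (:1 :+ y :* q)
      :c₀ : ∀ {n} (y p₁ p₂ p₃ p₄ : Polynomial n) → Polynomial n
      :c₀ y p₁ p₂ p₃ p₄ = y :* (y :* (p₄ :- p₂)) :* (y :* (p₁ :- p₃))
      :a :b : ∀ {n} (x y p₁ p₂ p₃ p₄ : Polynomial n) → Polynomial n
      :a x y p₁ p₂ p₃ p₄ = :A x y p₁ p₂ :* :A x y p₃ p₄
      :b x y p₁ p₂ p₃ p₄ = :B x y p₁ p₄ :* :B x y p₃ p₂

    identity₁ : y * y * z₃₂ * (A₁₂ * A₃₄) + c₀ * (A₃₂ - z₃₂) ≈ (y * y * (A₁₂ * A₃₄) + k₁ * A₁₄) * A₃₂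
    identity₁ = solve 6 (λ x y p₁ p₂ p₃ p₄ →
      y :* y :* :z y p₃ p₂ :* :a x y p₁ p₂ p₃ p₄ :+ :c₀ y p₁ p₂ p₃ p₄ :* (:A x y p₃ p₂ :- :z y p₃ p₂) :=
      (y :* y :* :a x y p₁ p₂ p₃ p₄ :+ y :* y :* y :* (p₂ :* p₃) :* :A x y p₁ p₄) :* :A x y p₃ p₂) refl x y p₁ p₂ p₃ p₄

    identity₂ : y * y * z₁₄ * (A₁₂ * A₃₄) + c₀ * (A₁₄ - z₁₄) ≈ (y * y * (A₁₂ * A₃₄) + k₃ * A₃₂) * A₁₄
    identity₂ = solve 6 (λ x y p₁ p₂ p₃ p₄ →
      y :* y :* :z y p₁ p₄ :* :a x y p₁ p₂ p₃ p₄ :+ :c₀ y p₁ p₂ p₃ p₄ :* (:A x y p₁ p₄ :- :z y p₁ p₄) :=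
      (y :* y :* :a x y p₁ p₂ p₃ p₄ :+ y :* y :* y :* (p₁ :* p₄) :* :A x y p₃ p₂) :* :A x y p₁ p₄) refl x y p₁ p₂ p₃ p₄

    identity₃ : y * y * (A₁₂ * A₃₄) * z₁₄ * z₃₂ + c₀ * (z₁₄ * (A₃₂ - z₃₂) + A₃₂ * (A₁₄ - z₁₄)) ≈
                (y * y * (A₁₂ * A₃₄) + k₁ * A₁₄ + k₃ * A₃₂ + k₅) * (A₁₄ * A₃₂)
    identity₃ = solve 6 (λ x y p₁ p₂ p₃ p₄ →
      y :* y :* :a x y p₁ p₂ p₃ p₄ :* :z y p₁ p₄ :* :z y p₃ p₂
        :+ :c₀ y p₁ p₂ p₃ p₄ :* (:z y p₁ p₄ :* (:A x y p₃ p₂ :- :z y p₃ p₂) :+ :A x y p₃ p₂ :* (:A x y p₁ p₄ :- :z y p₁ p₄)) :=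
      (y :* y :* :a x y p₁ p₂ p₃ p₄ :+ y :* y :* y :* (p₂ :* p₃) :* :A x y p₁ p₄
        :+ y :* y :* y :* (p₁ :* p₄) :* :A x y p₃ p₂ :+ y :* y :* y :* y :* (p₁ :* p₂ :* (p₃ :* p₄)))
        :* (:A x y p₁ p₄ :* :A x y p₃ p₂)) refl x y p₁ p₂ p₃ p₄

    identity₄ : - (y * y * (B₁₄ * B₃₂)) + c₀ * x * (B₃₄ - 1#) ≈ - ((y * y * (B₁₄ * B₃₂) + k₂ * B₁₂) * B₃₄)
    identity₄ = solve 6 (λ x y p₁ p₂ p₃ p₄ →
      :- (y :* y :* :b x y p₁ p₂ p₃ p₄) :+ :c₀ y p₁ p₂ p₃ p₄ :* x :* (:B x y p₃ p₄ :- :1) :=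
      :- ((y :* y :* :b x y p₁ p₂ p₃ p₄ :+ x :* (y :* y :* y :* (p₃ :* p₄)) :* :B x y p₁ p₂) :* :B x y p₃ p₄)) refl x y p₁ p₂ p₃ p₄

    identity₅ : - (y * y * (B₁₄ * B₃₂)) + c₀ * x * (B₁₂ - 1#) ≈ - ((y * y * (B₁₄ * B₃₂) + k₄ * B₃₄) * B₁₂)
    identity₅ = solve 6 (λ x y p₁ p₂ p₃ p₄ →
      :- (y :* y :* :b x y p₁ p₂ p₃ p₄) :+ :c₀ y p₁ p₂ p₃ p₄ :* x :* (:B x y p₁ p₂ :- :1) :=
      :- ((y :* y :* :b x y p₁ p₂ p₃ p₄ :+ x :* (y :* y :* y :* (p₁ :* p₂)) :* :B x y p₃ p₄) :* :B x y p₁ p₂)) refl x y p₁ p₂ p₃ p₄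

    identity₆ : - (y * y * (B₁₄ * B₃₂)) + c₀ * x * ((B₃₄ - 1#) + B₃₄ * (B₁₂ - 1#)) ≈
                - ((y * y * (B₁₄ * B₃₂) + k₂ * B₁₂ + k₄ * B₃₄ + k₆) * (B₁₂ * B₃₄))
    identity₆ = solve 6 (λ x y p₁ p₂ p₃ p₄ →
      :- (y :* y :* :b x y p₁ p₂ p₃ p₄) :+ :c₀ y p₁ p₂ p₃ p₄ :* x :* ((:B x y p₃ p₄ :- :1) :+ :B x y p₃ p₄ :* (:B x y p₁ p₂ :- :1)) :=
      :- ((y :* y :* :b x y p₁ p₂ p₃ p₄ :+ x :* (y :* y :* y :* (p₃ :* p₄)) :* :B x y p₁ p₂
        :+ x :* (y :* y :* y :* (p₁ :* p₂)) :* :B x y p₃ p₄ :+ x :* x :* (y :* y :* y :* y :* (p₁ :* p₂ :* (p₃ :* p₄))))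
        :* (:B x y p₁ p₂ :* :B x y p₃ p₄))) refl x y p₁ p₂ p₃ p₄

    Ω : Carrier
    Ω = A₁₄ * A₃₂ * (B₁₂ * B₃₄)

    -- The right-hand side of the theorem.
    canonical : (D D′ Q Q′ U g d : Carrier) → Carrier
    canonical D D′ Q Q′ U g d =
      (y * y * (A₁₂ * A₃₄) * D * D′ + k₁ * A₁₄ * D * U + k₃ * A₃₂ * D′ * U + k₅ * (U * U))
      - z₁₄ * z₃₂ * (y * y * (B₁₄ * B₃₂) * Q * Q′ + k₂ * B₁₂ * d * Q + k₄ * B₃₄ * g * Q′ + k₆ * g * d)

    -- `N₀` to `N₄` belong to order n, with the corner weights replaced in the order top left, top
    -- right, bottom left, bottom right. The slopes of the four functions of order n-1 in their
    -- corner weights are α, β, γ, δ; for instance z₁₄α + U becomes A₁₄α + U. The letters g and d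
    -- stand for the contributions of an entry 1 in the top right and bottom left corner.
    module _ {N₀ N₁ N₂ N₃ N₄ U g d α β γ δ R₁ Y₂ Y₃ Y₄ : Carrier}
             (h₁ : Relation N₀ N₁ z₁₄ A₁₄ R₁) (h₂ : Relation N₁ N₂ 1# B₁₂ Y₂)
             (h₃ : Relation N₂ N₃ 1# B₃₄ Y₃) (h₄ : Relation N₃ N₄ z₃₂ A₃₂ Y₄)
             (eR₁ : R₁ ≈ z₃₂ * β + U) (eY₄ : Y₄ ≈ B₃₄ * (B₁₂ * (A₁₄ * α + U)))
             (eY₂ : U * Y₂ ≈ A₁₄ * x * z₃₂ * g * (δ + d))
             (eY₃ : U * Y₃ ≈ A₁₄ * x * z₃₂ * d * (B₁₂ * γ + g))
             (bilinear : y * (p₁ - p₃) * (p₄ - p₂) * (N₄ * U) ≈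
               A₁₂ * B₁₂ * (A₃₄ * B₃₄) * ((A₃₂ * β + U) * (A₁₄ * α + U))
               - A₁₄ * B₁₄ * (A₃₂ * B₃₂) * ((B₁₂ * γ + g) * (B₃₄ * δ + d))) where

      private
        e₁₄ e₃₂ f₁₂ f₃₄ : Carrier
        e₁₄ = A₁₄ - z₁₄
        e₃₂ = A₃₂ - z₃₂
        f₁₂ = B₁₂ - 1#
        f₃₄ = B₃₄ - 1#

        -- Each corner uses up one factor of `Ω`, because `eliminate` multiplies by the new weight.
        chain : Ω * N₀ ≈ z₁₄ * (z₃₂ * N₄ + e₃₂ * Y₄) + z₁₄ * A₃₂ * f₃₄ * Y₃ + z₁₄ * A₃₂ * B₃₄ * f₁₂ * Y₂
                         + A₃₂ * B₁₂ * B₃₄ * e₁₄ * R₁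
        chain = begin
          Ω * N₀
            ≈⟨ solve 5 (λ a b c d n → a :* b :* (c :* d) :* n := b :* c :* d :* (a :* n)) refl _ _ _ _ _ ⟩
          A₃₂ * B₁₂ * B₃₄ * (A₁₄ * N₀)
            ≈⟨ *-congˡ (eliminate h₁) ⟩
          A₃₂ * B₁₂ * B₃₄ * (z₁₄ * N₁ + e₁₄ * R₁)
            ≈⟨ solve 7 (λ a b c z n e r → a :* b :* c :* (z :* n :+ e :* r) :=
                 z :* a :* c :* (b :* n) :+ a :* b :* c :* e :* r) refl _ _ _ _ _ _ _ ⟩
          z₁₄ * A₃₂ * B₃₄ * (B₁₂ * N₁) + A₃₂ * B₁₂ * B₃₄ * e₁₄ * R₁
            ≈⟨ +-congʳ (*-congˡ (trans (eliminate h₂) (+-congʳ (*-identityˡ N₂)))) ⟩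
          z₁₄ * A₃₂ * B₃₄ * (N₂ + f₁₂ * Y₂) + A₃₂ * B₁₂ * B₃₄ * e₁₄ * R₁
            ≈⟨ +-congʳ (solve 6 (λ z a b n f y → z :* a :* b :* (n :+ f :* y) := z :* a :* (b :* n) :+ z :* a :* b :* f :* y) refl _ _ _ _ _ _) ⟩
          z₁₄ * A₃₂ * (B₃₄ * N₂) + z₁₄ * A₃₂ * B₃₄ * f₁₂ * Y₂ + A₃₂ * B₁₂ * B₃₄ * e₁₄ * R₁
            ≈⟨ +-congʳ (+-congʳ (*-congˡ (trans (eliminate h₃) (+-congʳ (*-identityˡ N₃))))) ⟩
          z₁₄ * A₃₂ * (N₃ + f₃₄ * Y₃) + z₁₄ * A₃₂ * B₃₄ * f₁₂ * Y₂ + A₃₂ * B₁₂ * B₃₄ * e₁₄ * R₁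
            ≈⟨ +-congʳ (+-congʳ (trans
                 (solve 5 (λ z a n f y → z :* a :* (n :+ f :* y) := z :* (a :* n) :+ z :* a :* f :* y) refl _ _ _ _ _)
                 (+-congʳ (*-congˡ (eliminate h₄))))) ⟩
          z₁₄ * (z₃₂ * N₄ + e₃₂ * Y₄) + z₁₄ * A₃₂ * f₃₄ * Y₃ + z₁₄ * A₃₂ * B₃₄ * f₁₂ * Y₂
            + A₃₂ * B₁₂ * B₃₄ * e₁₄ * R₁ ∎

      assembled : Ω * (c₀ * N₀ * U) ≈ Ω * canonical (z₁₄ * α + U) (z₃₂ * β + U) (γ + g) (δ + d) U g d
      assembled = begin
        Ω * (c₀ * N₀ * U)
          ≈⟨ solve 4 (λ w c n u → w :* (c :* n :* u) := c :* u :* (w :* n)) refl _ _ _ _ ⟩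
        c₀ * U * (Ω * N₀)
          ≈⟨ *-congˡ chain ⟩
        c₀ * U * (z₁₄ * (z₃₂ * N₄ + e₃₂ * Y₄) + z₁₄ * A₃₂ * f₃₄ * Y₃ + z₁₄ * A₃₂ * B₃₄ * f₁₂ * Y₂ + A₃₂ * B₁₂ * B₃₄ * e₁₄ * R₁)
          ≈⟨ solve 11 (λ c u z n ey af y₃ ab y₂ abe r →
               c :* u :* (z :* (n :+ ey) :+ af :* y₃ :+ ab :* y₂ :+ abe :* r) :=
               z :* (c :* u :* n) :+ c :* (z :* u :* ey :+ af :* (u :* y₃) :+ ab :* (u :* y₂) :+ abe :* u :* r)) refl
               c₀ U z₁₄ (z₃₂ * N₄) (e₃₂ * Y₄) (z₁₄ * A₃₂ * f₃₄) Y₃ (z₁₄ * A₃₂ * B₃₄ * f₁₂) Y₂ (A₃₂ * B₁₂ * B₃₄ * e₁₄) R₁ ⟩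
        z₁₄ * (c₀ * U * (z₃₂ * N₄)) + c₀ * (z₁₄ * U * (e₃₂ * Y₄) + z₁₄ * A₃₂ * f₃₄ * (U * Y₃)
          + z₁₄ * A₃₂ * B₃₄ * f₁₂ * (U * Y₂) + A₃₂ * B₁₂ * B₃₄ * e₁₄ * U * R₁)
          -- The bilinear identity replaces the one summand with `N₄`; the others are corrections,
          -- which the hypotheses express by the slopes.
          ≈⟨ +-cong (trans (rearrange z₁₄ z₃₂ N₄ U) (*-congˡ bilinear))
               (*-congˡ (+-cong (+-cong (+-cong (*-congˡ (*-congˡ eY₄)) (*-congˡ eY₃)) (*-congˡ eY₂)) (*-congˡ eR₁))) ⟩
        z₁₄ * z₃₂ * (y * y) * (A₁₂ * B₁₂ * (A₃₄ * B₃₄) * (BR * TL) - A₁₄ * B₁₄ * (A₃₂ * B₃₂) * (TR * BL))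
          + c₀ * (z₁₄ * U * (e₃₂ * (B₃₄ * (B₁₂ * TL))) + z₁₄ * A₃₂ * f₃₄ * (A₁₄ * x * z₃₂ * d * TR)
          + z₁₄ * A₃₂ * B₃₄ * f₁₂ * (A₁₄ * x * z₃₂ * g * (δ + d)) + A₃₂ * B₁₂ * B₃₄ * e₁₄ * U * (z₃₂ * β + U))
          -- The expression falls apart into one part in α, β, U and another in γ, δ, g, d.
          ≈⟨ separate ⟩
        B₁₂ * B₃₄ * (y * y * (A₁₂ * A₃₄) * (BR * TL) * (z₁₄ * z₃₂)
            + c₀ * (z₁₄ * e₃₂ * TL * U + A₃₂ * e₁₄ * (z₃₂ * β + U) * U))
          + z₁₄ * z₃₂ * (A₁₄ * A₃₂) * (- (y * y * (B₁₄ * B₃₂) * (TR * BL))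
            + c₀ * x * (f₃₄ * d * TR + B₃₄ * f₁₂ * g * (δ + d)))
          ≈⟨ +-cong
               (*-congˡ (diagonal (y * y) (A₁₂ * A₃₄) A₁₄ A₃₂ z₁₄ z₃₂ α β U c₀ e₁₄ e₃₂ k₁ k₃ k₅ identity₁ identity₂ identity₃))
               (*-congˡ (antidiagonal (y * y) (B₁₄ * B₃₂) B₁₂ B₃₄ γ δ g d c₀ x f₁₂ f₃₄ k₂ k₄ k₆ identity₄ identity₅ identity₆)) ⟩
        _ ≈⟨ solve 7 (λ b₁ b₂ a₁ a₂ z u v → b₁ :* b₂ :* (u :* (a₁ :* a₂)) :+ z :* (a₁ :* a₂) :* (:- (v :* (b₁ :* b₂))) :=
               a₁ :* a₂ :* (b₁ :* b₂) :* (u :- z :* v)) refl B₁₂ B₃₄ A₁₄ A₃₂ (z₁₄ * z₃₂) _ _ ⟩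
        Ω * canonical (z₁₄ * α + U) (z₃₂ * β + U) (γ + g) (δ + d) U g d ∎
        where
        TL BR TR BL : Carrier
        TL = A₁₄ * α + U
        BR = A₃₂ * β + U
        TR = B₁₂ * γ + g
        BL = B₃₄ * δ + d
        rearrange : ∀ z z′ n u → z * (c₀ * u * (z′ * n)) ≈ z * z′ * (y * y) * (y * (p₁ - p₃) * (p₄ - p₂) * (n * u))
        rearrange = solve 9 (λ y p₁ p₂ p₃ p₄ z z′ n u → z :* (:c₀ y p₁ p₂ p₃ p₄ :* u :* (z′ :* n)) :=
          z :* z′ :* (y :* y) :* (y :* (p₁ :- p₃) :* (p₄ :- p₂) :* (n :* u))) refl y p₁ p₂ p₃ p₄
        separate₁ : ∀ A₁₂ A₃₄ A₃₂ B₁₂ B₃₄ z₁₄ z₃₂ y c U e₁₄ e₃₂ BR TL D →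
          z₁₄ * z₃₂ * (y * y) * (A₁₂ * B₁₂ * (A₃₄ * B₃₄) * (BR * TL))
            + c * (z₁₄ * U * (e₃₂ * (B₃₄ * (B₁₂ * TL))) + A₃₂ * B₁₂ * B₃₄ * e₁₄ * U * D) ≈
          B₁₂ * B₃₄ * (y * y * (A₁₂ * A₃₄) * (BR * TL) * (z₁₄ * z₃₂)
            + c * (z₁₄ * e₃₂ * TL * U + A₃₂ * e₁₄ * D * U))
        separate₁ = solve 15 (λ A₁₂ A₃₄ A₃₂ B₁₂ B₃₄ z₁₄ z₃₂ y c U e₁₄ e₃₂ BR TL D →
          z₁₄ :* z₃₂ :* (y :* y) :* (A₁₂ :* B₁₂ :* (A₃₄ :* B₃₄) :* (BR :* TL))
            :+ c :* (z₁₄ :* U :* (e₃₂ :* (B₃₄ :* (B₁₂ :* TL))) :+ A₃₂ :* B₁₂ :* B₃₄ :* e₁₄ :* U :* D) :=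
          B₁₂ :* B₃₄ :* (y :* y :* (A₁₂ :* A₃₄) :* (BR :* TL) :* (z₁₄ :* z₃₂)
            :+ c :* (z₁₄ :* e₃₂ :* TL :* U :+ A₃₂ :* e₁₄ :* D :* U))) refl
        separate₂ : ∀ A₁₄ A₃₂ B₁₄ B₃₂ B₃₄ z₁₄ z₃₂ y c x f₁₂ f₃₄ g d TR BL Q →
          z₁₄ * z₃₂ * (y * y) * (- (A₁₄ * B₁₄ * (A₃₂ * B₃₂) * (TR * BL)))
            + c * (z₁₄ * A₃₂ * f₃₄ * (A₁₄ * x * z₃₂ * d * TR) + z₁₄ * A₃₂ * B₃₄ * f₁₂ * (A₁₄ * x * z₃₂ * g * Q)) ≈
          z₁₄ * z₃₂ * (A₁₄ * A₃₂) * (- (y * y * (B₁₄ * B₃₂) * (TR * BL))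
            + c * x * (f₃₄ * d * TR + B₃₄ * f₁₂ * g * Q))
        separate₂ = solve 17 (λ A₁₄ A₃₂ B₁₄ B₃₂ B₃₄ z₁₄ z₃₂ y c x f₁₂ f₃₄ g d TR BL Q →
          z₁₄ :* z₃₂ :* (y :* y) :* (:- (A₁₄ :* B₁₄ :* (A₃₂ :* B₃₂) :* (TR :* BL)))
            :+ c :* (z₁₄ :* A₃₂ :* f₃₄ :* (A₁₄ :* x :* z₃₂ :* d :* TR) :+ z₁₄ :* A₃₂ :* B₃₄ :* f₁₂ :* (A₁₄ :* x :* z₃₂ :* g :* Q)) :=
          z₁₄ :* z₃₂ :* (A₁₄ :* A₃₂) :* (:- (y :* y :* (B₁₄ :* B₃₂) :* (TR :* BL))
            :+ c :* x :* (f₃₄ :* d :* TR :+ B₃₄ :* f₁₂ :* g :* Q))) refl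
        separate : _ ≈ _
        separate = trans
          (solve 8 (λ z s t c u v w r → z :* (s :- t) :+ c :* (u :+ v :+ w :+ r) :=
            (z :* s :+ c :* (u :+ r)) :+ (z :* (:- t) :+ c :* (v :+ w))) refl _ _ _ _ _ _ _ _)
          (+-cong (separate₁ A₁₂ A₃₄ A₃₂ B₁₂ B₃₄ z₁₄ z₃₂ y c₀ U e₁₄ e₃₂ BR TL (z₃₂ * β + U))
                  (separate₂ A₁₄ A₃₂ B₁₄ B₃₂ B₃₄ z₁₄ z₃₂ y c₀ x f₁₂ f₃₄ g d TR BL (δ + d)))

-- The corner relations at the homogeneous point

module Relations {c ℓ} (R : CommutativeRing c ℓ) where

  open CommutativeRing R hiding (zero)
  open IntSolver R hiding (fromℕ)
  open SixVertex R
  open Corners R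
  open Exchange R
  open Assembly R using (Relation)
  open Refined R using (Side; front; inner; back; sides; refine; plain; zeros)
  open GeneratingFunctions R using (_^_)
  open import Data.Vec.Properties using (lookup-replicate)
  open import Relation.Binary.Reasoning.Setoid setoid

  module _ (x y : Carrier) where

    private
      r : Carrier → Carrier
      r = refine x y

      pl : Carrier → Carrier → Weights
      pl = plain x y

      sx : Carrier → Carrier → Weights
      sx = six x y

      -- `A` falls short of the plain weight by ypv, and `B` by xypv.
      A-B : ∀ p v → p * v ≈ 0# → r p * r v ≈ A x y p v × 1# ≈ B x y p v
      A-B p v pv≈0 =
        trans (sym (drop₁ pv≈0)) (solve 4 (λ x y p v → (:1 :+ y :* p) :* (:1 :+ y :* v) :- y :* (p :* v) := :A x y p v) refl x y p v) ,
        trans (sym (drop₂ pv≈0)) (solve 4 (λ x y p v → :1 :- x :* y :* (p :* v) := :B x y p v) refl x y p v)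
        where
        drop : ∀ {a b c} → c ≈ 0# → a - b * c ≈ a
        drop {a} {b} {c} c≈0 = trans (+-congˡ (-‿cong (*-congˡ c≈0))) (solve 2 (λ a b → a :- b :* :0 := a) refl a b)
        drop₁ : ∀ {a c} → c ≈ 0# → a - y * c ≈ a
        drop₁ = drop
        drop₂ : ∀ {a c} → c ≈ 0# → a - x * y * c ≈ a
        drop₂ = drop

      agree : ∀ p v → p * v ≈ 0# → pl p v ≈ʷ sx p v
      agree p v pv≈0 with e , f ← A-B p v pv≈0 = *-congˡ e , e , f , refl

      agree₀ˡ : ∀ {p} v → p ≡ 0# → pl p v ≈ʷ sx p v
      agree₀ˡ v ≡.refl = agree 0# v (zeroˡ v)

      agree₀ʳ : ∀ p {v} → v ≡ 0# → pl p v ≈ʷ sx p v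
      agree₀ʳ p ≡.refl = agree p 0# (zeroʳ p)

      lookup-zeros : ∀ {m} q → lookup (zeros x y m) q ≡ 0#
      lookup-zeros q = lookup-replicate q 0#

      ∏-zeros : ∀ m {f : Carrier → Carrier} {a} → f 0# ≈ a → ∏ f (zeros x y m) ≈ a ^ m
      ∏-zeros zero    e = refl
      ∏-zeros (suc m) e = *-cong e (∏-zeros m e)

      1^ : ∀ m → 1# ^ m ≈ 1#
      1^ zero    = refl
      1^ (suc m) = trans (*-identityˡ _) (1^ m)

      r-0ʳ : ∀ p → r p * r 0# ≈ r p
      r-0ʳ p = solve 2 (λ y p → (:1 :+ y :* p) :* (:1 :+ y :* :0) := :1 :+ y :* p) refl y p

      r-0ˡ : ∀ p → r 0# * r p ≈ r p
      r-0ˡ p = trans (*-comm _ _) (r-0ʳ p)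

      withRest : ∀ {P Q a b r r′} → r ≈ r′ → Relation P Q a b r → Relation P Q a b r′
      withRest e (t , f , g) = t , trans f (+-congˡ e) , trans g (+-congˡ e)

      -- In the bottom right corner the weight that matters is `a₁`, which carries a factor x in
      -- both families. Moved into the slope, this factor leaves a relation of the same form as in
      -- the top left corner.
      descale : ∀ {P Q a b r} → Relation P Q (x * a) (x * b) r → Relation P Q a b r
      descale (t , f , g) = x * t , trans f (+-congʳ (scale _ _)) , trans g (+-congʳ (scale _ _))
        where
        scale : ∀ a t → x * a * t ≈ a * (x * t)
        scale = solve 3 (λ x a t → x :* a :* t := a :* (x :* t)) refl x

    U : ℕ → Carrier
    U m = partition pl (zeros x y m) (zeros x y m)

    U-six : ∀ m → W x y (zeros x y m) (zeros x y m) ≈ U m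
    U-six m = sym (partition-cong {ω = pl} {ω′ = sx} (zeros x y m) (zeros x y m) (zeros x y m) (zeros x y m)
      λ i j → agree₀ˡ _ (lookup-zeros i))

    -- What an entry 1 in the top right or bottom left corner contributes; in the
    -- other two corners it is U m.
    G : ℕ → Carrier → Carrier → Carrier
    G m p v = r p ^ m * ((x * r v) ^ m * U m)

    module _ (m : ℕ) (p v : Carrier) where

      private
        os : Vec Carrier m
        os = zeros x y m

        ones-∏ : ∀ {f} → f 0# ≈ 1# → ∏ f os ≈ 1#
        ones-∏ e = trans (∏-zeros m e) (1^ m)

        unit-rest : ∀ {f g} → f 0# ≈ 1# → g 0# ≈ 1# → ∏ f os * (∏ g os * U m) ≈ U m
        unit-rest e e′ = trans (*-cong (ones-∏ e) (trans (*-congʳ (ones-∏ e′)) (*-identityˡ _))) (*-identityˡ _)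

      topLeftRelation : Relation (partition pl (p ∷ os) (v ∷ os)) (W x y (p ∷ os) (v ∷ os))
                                 (r p * r v) (A x y p v) (U m)
      topLeftRelation = withRest (unit-rest refl refl) (changeTopLeft pl sx p os v os
        (λ q → agree₀ʳ p (lookup-zeros q)) (λ q _ → agree₀ˡ _ (lookup-zeros q)))

      bottomRightRelation : Relation (partition pl (os ∷ʳ p) (os ∷ʳ v)) (W x y (os ∷ʳ p) (os ∷ʳ v))
                                     (r p * r v) (A x y p v) (U m)
      bottomRightRelation = withRest (unit-rest refl refl) (descale (changeBottomRight pl sx os p os v
        (λ q → agree₀ʳ p (lookup-zeros q)) (λ q _ → agree₀ˡ _ (lookup-zeros q))))

      topRightRelation : Relation (partition pl (p ∷ os) (os ∷ʳ v)) (W x y (p ∷ os) (os ∷ʳ v))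
                                  1# (B x y p v) (G m p v)
      topRightRelation = withRest
        (*-cong (∏-zeros m (r-0ʳ p)) (*-congʳ (∏-zeros m (*-congˡ (r-0ˡ v)))))
        (changeTopRight pl sx p os os v
          (λ q → agree₀ʳ p (lookup-zeros q)) (λ q _ → agree₀ˡ _ (lookup-zeros q)))

      bottomLeftRelation : Relation (partition pl (os ∷ʳ p) (v ∷ os)) (W x y (os ∷ʳ p) (v ∷ os))
                                    1# (B x y p v) (G m v p)
      bottomLeftRelation = withRest
        (*-cong (∏-zeros m (r-0ˡ v)) (*-congʳ (∏-zeros m (*-congˡ (r-0ʳ p)))))
        (changeBottomLeft pl sx os p v os
          (λ q → agree₀ˡ v (lookup-zeros q)) (λ p′ q → agree₀ʳ _ (lookup-zeros q)))

    module _ (m : ℕ) (p₁ p₂ p₃ p₄ : Carrier) where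

      A₁₄ A₃₂ B₁₂ B₃₄ : Carrier
      A₁₄ = A x y p₁ p₄
      A₃₂ = A x y p₃ p₂
      B₁₂ = B x y p₁ p₂
      B₃₄ = B x y p₃ p₄

      private
        os : Vec Carrier m
        os = zeros x y m

        is₋ is₊ : Vec Side (suc m)
        is₋ = front ∷ replicate m inner
        is₊ = replicate m inner ∷ʳ back

        pick : Bool → Carrier → Carrier → Weights
        pick true  = sx
        pick false = pl

        -- The flags tell which corners already have six-vertex weights. Everywhere else one of the
        -- two parameters is 0 and both families agree.
        model : (tl tr bl br : Bool) → Side → Side → Weights
        model tl tr bl br front front = pick tl p₁ p₄
        model tl tr bl br front inner = sx p₁ 0#
        model tl tr bl br front back  = pick tr p₁ p₂
        model tl tr bl br inner front = sx 0# p₄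
        model tl tr bl br inner inner = sx 0# 0#
        model tl tr bl br inner back  = sx 0# p₂
        model tl tr bl br back  front = pick bl p₃ p₄
        model tl tr bl br back  inner = sx p₃ 0#
        model tl tr bl br back  back  = pick br p₃ p₂

        lookup₋ : ∀ {a} m (Q : Side → Carrier → Set a) {p} → Q front p → Q inner 0# →
                  ∀ i → Q (lookup (front ∷ replicate m inner) i) (lookup (p ∷ zeros x y m) i)
        lookup₋ m       Q q₀ q₁ zero          = q₀
        lookup₋ (suc m) Q q₀ q₁ (suc zero)    = q₁
        lookup₋ (suc m) Q {p} q₀ q₁ (suc (suc i)) = lookup₋ m Q {p} q₀ q₁ (suc i)

        lookup₊ : ∀ {a} m (Q : Side → Carrier → Set a) {p} → Q inner 0# → Q back p →
                  ∀ i → Q (lookup (replicate m inner ∷ʳ back) i) (lookup (zeros x y m ∷ʳ p) i)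
        lookup₊ zero    Q q₁ q₂ zero    = q₂
        lookup₊ (suc m) Q q₁ q₂ zero    = q₁
        lookup₊ (suc m) Q q₁ q₂ (suc i) = lookup₊ m Q q₁ q₂ i

        side₋ : ∀ {a} (P : Side → Set a) → P front → P inner → ∀ i → P (lookup is₋ i)
        side₋ P = lookup₋ m (λ s _ → P s) {0#}

        side₊ : ∀ {a} (P : Side → Set a) → P inner → P back → ∀ i → P (lookup is₊ i)
        side₊ P = lookup₊ m (λ s _ → P s) {0#}

        ∏₋ : ∀ {f : Side → Carrier} {u w} → f front ≈ u → f inner ≈ w → ∏ f is₋ ≈ u * w ^ m
        ∏₋ e₀ e₁ = *-cong e₀ (power m e₁)
          where
          power : ∀ m {f : Side → Carrier} {w} → f inner ≈ w → ∏ f (replicate m inner) ≈ w ^ m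
          power zero    e = refl
          power (suc m) e = *-cong e (power m e)

        ∏₊ : ∀ m {f : Side → Carrier} {u w} → f inner ≈ w → f back ≈ u →
             ∏ f (replicate m inner ∷ʳ back) ≈ w ^ m * u
        ∏₊ zero    e₁ e₂ = trans (*-identityʳ _) (trans e₂ (sym (*-identityˡ _)))
        ∏₊ (suc m) e₁ e₂ = trans (*-cong e₁ (∏₊ m e₁ e₂)) (sym (*-assoc _ _ _))

        A-0ʳ : ∀ p → A x y p 0# ≈ r p
        A-0ʳ p = solve 3 (λ x y p → :A x y p :0 := :1 :+ y :* p) refl x y p
        A-0ˡ : ∀ p → A x y 0# p ≈ r p
        A-0ˡ p = solve 3 (λ x y p → :A x y :0 p := :1 :+ y :* p) refl x y p
        B-0ʳ : ∀ p → B x y p 0# ≈ 1#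
        B-0ʳ p = solve 3 (λ x y p → :B x y p :0 := :1) refl x y p
        B-0ˡ : ∀ p → B x y 0# p ≈ 1#
        B-0ˡ p = solve 3 (λ x y p → :B x y :0 p := :1) refl x y p

        ≈ʷ-sym : ∀ {v w} → v ≈ʷ w → w ≈ʷ v
        ≈ʷ-sym (a , b , c , d) = sym a , sym b , sym c , sym d

        w0ʳ : ∀ p → sx p 0# ≈ʷ pl p 0#
        w0ʳ p = ≈ʷ-sym (agree p 0# (zeroʳ p))
        w0ˡ : ∀ p → sx 0# p ≈ʷ pl 0# p
        w0ˡ p = ≈ʷ-sym (agree 0# p (zeroˡ p))

        Matches : (Side → Side → Weights) → (Carrier → Carrier → Weights) →
                  Vec Side (suc m) → Vec Carrier (suc m) → Side → Carrier → Set ℓ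
        Matches ω ω′ js vs i p = ∀ q → ω i (lookup js q) ≈ʷ ω′ p (lookup vs q)

        -- Freezing the lines through a corner leaves a lattice of order n-1 that contains only the
        -- opposite corner. The subscripts tell whether the front line (₋) or the back line (₊) of
        -- the rows and of the columns is kept.
        partition₋₋ : ∀ tr bl br → partition (model true tr bl br) is₋ is₋ ≈ W x y (p₁ ∷ os) (p₄ ∷ os)
        partition₋₋ tr bl br = partition-cong is₋ (p₁ ∷ os) is₋ (p₄ ∷ os) (lookup₋ m (Matches (model true tr bl br) sx is₋ (p₄ ∷ os))
          (lookup₋ m (λ j v → model true tr bl br front j ≈ʷ sx p₁ v) ≈ʷ-refl ≈ʷ-refl)
          (lookup₋ m (λ j v → model true tr bl br inner j ≈ʷ sx 0# v) ≈ʷ-refl ≈ʷ-refl))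

        partition₋₊ : ∀ tl bl br → partition (model tl true bl br) is₋ is₊ ≈ W x y (p₁ ∷ os) (os ∷ʳ p₂)
        partition₋₊ tl bl br = partition-cong is₋ (p₁ ∷ os) is₊ (os ∷ʳ p₂) (lookup₋ m (Matches (model tl true bl br) sx is₊ (os ∷ʳ p₂))
          (lookup₊ m (λ j v → model tl true bl br front j ≈ʷ sx p₁ v) ≈ʷ-refl ≈ʷ-refl)
          (lookup₊ m (λ j v → model tl true bl br inner j ≈ʷ sx 0# v) ≈ʷ-refl ≈ʷ-refl))

        partition₊₋ : ∀ tl tr br → partition (model tl tr false br) is₊ is₋ ≈ partition pl (os ∷ʳ p₃) (p₄ ∷ os)
        partition₊₋ tl tr br = partition-cong is₊ (os ∷ʳ p₃) is₋ (p₄ ∷ os) (lookup₊ m (Matches (model tl tr false br) pl is₋ (p₄ ∷ os))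
          (lookup₋ m (λ j v → model tl tr false br inner j ≈ʷ pl 0# v) (w0ˡ _) (w0ˡ _))
          (lookup₋ m (λ j v → model tl tr false br back j ≈ʷ pl p₃ v) ≈ʷ-refl (w0ʳ _)))

        partition₊₊ : ∀ tl tr bl → partition (model tl tr bl false) is₊ is₊ ≈ partition pl (os ∷ʳ p₃) (os ∷ʳ p₂)
        partition₊₊ tl tr bl = partition-cong is₊ (os ∷ʳ p₃) is₊ (os ∷ʳ p₂) (lookup₊ m (Matches (model tl tr bl false) pl is₊ (os ∷ʳ p₂))
          (lookup₊ m (λ j v → model tl tr bl false inner j ≈ʷ pl 0# v) (w0ˡ _) (w0ˡ _))
          (lookup₊ m (λ j v → model tl tr bl false back j ≈ʷ pl p₃ v) (w0ʳ _) ≈ʷ-refl))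

      allPlain : partition pl (p₁ ∷ (os ∷ʳ p₃)) (p₄ ∷ (os ∷ʳ p₂)) ≈ partition (model false false false false) (sides m) (sides m)
      allPlain = partition-cong (p₁ ∷ (os ∷ʳ p₃)) (sides m) (p₄ ∷ (os ∷ʳ p₂)) (sides m) λ
        { zero    zero    → ≈ʷ-refl
        ; zero    (suc j) → lookup₊ m (λ t v → pl p₁ v ≈ʷ model false false false false front t) (agree p₁ 0# (zeroʳ p₁)) ≈ʷ-refl j
        ; (suc i) zero    → lookup₊ m (λ t v → pl v p₄ ≈ʷ model false false false false t front) (agree 0# p₄ (zeroˡ p₄)) ≈ʷ-refl i
        ; (suc i) (suc j) → lookup₊ m (λ t v → pl v (lookup (os ∷ʳ p₂) j) ≈ʷ model false false false false t (lookup is₊ j))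
            (lookup₊ m (λ t v → pl 0# v ≈ʷ model false false false false inner t) (agree 0# 0# (zeroˡ 0#)) (agree 0# p₂ (zeroˡ p₂)) j)
            (lookup₊ m (λ t v → pl p₃ v ≈ʷ model false false false false back t) (agree p₃ 0# (zeroʳ p₃)) ≈ʷ-refl j) i }

      allSix : W x y (p₁ ∷ (os ∷ʳ p₃)) (p₄ ∷ (os ∷ʳ p₂)) ≈ partition (model true true true true) (sides m) (sides m)
      allSix = partition-cong (p₁ ∷ (os ∷ʳ p₃)) (sides m) (p₄ ∷ (os ∷ʳ p₂)) (sides m) λ
        { zero    zero    → ≈ʷ-refl
        ; zero    (suc j) → lookup₊ m (λ t v → sx p₁ v ≈ʷ model true true true true front t) ≈ʷ-refl ≈ʷ-refl j
        ; (suc i) zero    → lookup₊ m (λ t v → sx v p₄ ≈ʷ model true true true true t front) ≈ʷ-refl ≈ʷ-refl i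
        ; (suc i) (suc j) → lookup₊ m (λ t v → sx v (lookup (os ∷ʳ p₂) j) ≈ʷ model true true true true t (lookup is₊ j))
            (lookup₊ m (λ t v → sx 0# v ≈ʷ model true true true true inner t) ≈ʷ-refl ≈ʷ-refl j)
            (lookup₊ m (λ t v → sx p₃ v ≈ʷ model true true true true back t) ≈ʷ-refl ≈ʷ-refl j) i }

      private
        one₊ : ∀ {f} → f inner ≈ 1# → f back ≈ 1# → ∏ f is₊ ≈ 1#
        one₊ e e′ = trans (∏₊ m e e′) (trans (*-identityʳ _) (1^ m))

        one₋ : ∀ {f u} → f front ≈ u → f inner ≈ 1# → ∏ f is₋ ≈ u
        one₋ e e′ = trans (∏₋ e e′) (trans (*-congˡ (1^ m)) (*-identityʳ _))

      N₀ N₁ N₂ N₃ N₄ : Carrier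
      N₀ = partition (model false false false false) (sides m) (sides m)
      N₁ = partition (model true false false false) (sides m) (sides m)
      N₂ = partition (model true true false false) (sides m) (sides m)
      N₃ = partition (model true true true false) (sides m) (sides m)
      N₄ = partition (model true true true true) (sides m) (sides m)

      private
        Agree : (ω ω′ : Side → Side → Weights) → Side → Side → Set ℓ
        Agree ω ω′ i j = ω i j ≈ʷ ω′ i j

      rest₂ rest₃ rest₄ : Carrier
      rest₂ = (A₁₄ * r p₁ ^ m) * (((x * r p₂) ^ m * (x * (r p₃ * r p₂))) * partition pl (os ∷ʳ p₃) (p₄ ∷ os))
      rest₃ = (A₁₄ * r p₄ ^ m) * (((x * r p₃) ^ m * (x * (r p₃ * r p₂))) * W x y (p₁ ∷ os) (os ∷ʳ p₂))
      rest₄ = B₃₄ * (B₁₂ * W x y (p₁ ∷ os) (p₄ ∷ os))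

      change₁ : Relation N₀ N₁ (r p₁ * r p₄) A₁₄ (partition pl (os ∷ʳ p₃) (os ∷ʳ p₂))
      change₁ = withRest
        (trans (*-cong (one₊ (B-0ʳ p₁) refl) (trans (*-cong (one₊ (B-0ˡ p₄) refl) (partition₊₊ false false false)) (*-identityˡ _))) (*-identityˡ _))
        (changeTopLeft ω ω′ front is₊ front is₊
          (side₊ (Agree ω ω′ front) ≈ʷ-refl ≈ʷ-refl)
          λ i → λ { zero    → side₊ (λ i → Agree ω ω′ i front) ≈ʷ-refl ≈ʷ-refl i
                  ; (suc j) → side₊ (λ i → Agree ω ω′ i (lookup is₊ j))
                      (side₊ (Agree ω ω′ inner) ≈ʷ-refl ≈ʷ-refl j)
                      (side₊ (Agree ω ω′ back) ≈ʷ-refl ≈ʷ-refl j) i })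
        where
        ω  = model false false false false
        ω′ = model true false false false

      change₂ : Relation N₁ N₂ 1# B₁₂ rest₂
      change₂ = withRest
        (*-cong (∏₋ refl (A-0ʳ p₁)) (*-cong (∏₊ m (*-congˡ (A-0ˡ p₂)) refl) (partition₊₋ true false false)))
        (changeTopRight ω ω′ front is₊ is₋ back
          (side₋ (Agree ω ω′ front) ≈ʷ-refl ≈ʷ-refl)
          λ i → λ { zero    → side₊ (λ i → Agree ω ω′ i front) ≈ʷ-refl ≈ʷ-refl i
                  ; (suc j) → side₊ (λ i → Agree ω ω′ i (lookup is₊ j))
                      (side₊ (Agree ω ω′ inner) ≈ʷ-refl ≈ʷ-refl j)
                      (side₊ (Agree ω ω′ back) ≈ʷ-refl ≈ʷ-refl j) i })
        where
        ω  = model true false false false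
        ω′ = model true true false false

      change₃ : Relation N₂ N₃ 1# B₃₄ rest₃
      change₃ = withRest
        (*-cong (∏₋ refl (A-0ˡ p₄)) (*-cong (∏₊ m (*-congˡ (A-0ʳ p₃)) refl) (partition₋₊ true false false)))
        (changeBottomLeft ω ω′ is₋ back front is₊
          (side₋ (λ i → Agree ω ω′ i front) ≈ʷ-refl ≈ʷ-refl)
          λ { zero    → side₊ (Agree ω ω′ front) ≈ʷ-refl ≈ʷ-refl
            ; (suc i) → λ j → side₊ (λ i → Agree ω ω′ i (lookup is₊ j))
                (side₊ (Agree ω ω′ inner) ≈ʷ-refl ≈ʷ-refl j)
                (side₊ (Agree ω ω′ back) ≈ʷ-refl ≈ʷ-refl j) i })
        where
        ω  = model true true false false
        ω′ = model true true true false

      change₄ : Relation N₃ N₄ (r p₃ * r p₂) A₃₂ rest₄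
      change₄ = withRest
        (*-cong (one₋ refl (B-0ʳ p₃)) (*-cong (one₋ refl (B-0ˡ p₂)) (partition₋₋ true true false)))
        (descale (changeBottomRight ω ω′ is₋ back is₋ back
          (side₋ (Agree ω ω′ back) ≈ʷ-refl ≈ʷ-refl)
          λ i → λ { zero    → side₋ (λ i → Agree ω ω′ i front) ≈ʷ-refl ≈ʷ-refl i
                  ; (suc j) → side₋ (λ i → Agree ω ω′ i (lookup is₊ j))
                      (side₊ (Agree ω ω′ front) ≈ʷ-refl ≈ʷ-refl j)
                      (side₊ (Agree ω ω′ inner) ≈ʷ-refl ≈ʷ-refl j) i }))
        where
        ω  = model true true true false
        ω′ = model true true true true

-- The two sides of the theorem in the parameters p

module Sides {c ℓ} (R : CommutativeRing c ℓ) where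

  open CommutativeRing R hiding (zero)
  open IntSolver R hiding (fromℕ)
  open Exchange R using (A; B; :A; :B)
  open Assembly R
  open GeneratingFunctions R using (_^_)
  open import Algebra.Properties.CommutativeSemiring.Exp commutativeSemiring using (^-distrib-*; ^-congˡ)
  open import Relation.Binary.Reasoning.Setoid setoid

  -- The two sides of the theorem, with N, D, D′, Q, Q′, U for the values of
  -- the six generating functions.
  left : (y z₁ z₂ z₃ z₄ N U : Carrier) → Carrier
  left y z₁ z₂ z₃ z₄ N U = y * (z₄ - z₂) * (z₁ - z₃) * N * U

  right : (m : ℕ) (x y z₁ z₂ z₃ z₄ D D′ Q Q′ U : Carrier) → Carrier
  right m x y z₁ z₂ z₃ z₄ D D′ Q Q′ U =
    ((z₁ - 1#) * (z₂ - 1#) - y * z₁ * z₂) * ((z₃ - 1#) * (z₄ - 1#) - y * z₃ * z₄) * D * D′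
    - (x * (z₄ - 1#) * (z₁ - 1#) - y) * (x * (z₂ - 1#) * (z₃ - 1#) - y)
        * z₁ * z₂ * z₃ * z₄ * Q * Q′
    - (z₂ - 1#) * (z₃ - 1#) * ((z₄ - 1#) * (z₁ - 1#) - y * z₄ * z₁) * D * U
    + (z₃ - 1#) * (z₄ - 1#) * (x * (z₁ - 1#) * (z₂ - 1#) - y)
        * z₁ * z₂ * (x * z₃ * z₄) ^ suc m * Q * U
    - (z₄ - 1#) * (z₁ - 1#) * ((z₂ - 1#) * (z₃ - 1#) - y * z₂ * z₃) * D′ * U
    + (z₁ - 1#) * (z₂ - 1#) * (x * (z₃ - 1#) * (z₄ - 1#) - y)
        * z₃ * z₄ * (x * z₁ * z₂) ^ suc m * Q′ * U
    + (z₁ - 1#) * (z₂ - 1#) * (z₃ - 1#) * (z₄ - 1#)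
        * (1# - (x ^ 2 * z₁ * z₂ * z₃ * z₄) ^ suc m) * U ^ 2

  power-product : ∀ m x z₁ z₂ z₃ z₄ → (x ^ 2 * z₁ * z₂ * z₃ * z₄) ^ m ≈ (x * z₁ * z₂) ^ m * (x * z₃ * z₄) ^ m
  power-product m x z₁ z₂ z₃ z₄ = trans
    (^-congˡ m (solve 5 (λ x z₁ z₂ z₃ z₄ → x :* (x :* :1) :* z₁ :* z₂ :* z₃ :* z₄ :=
      (x :* z₁ :* z₂) :* (x :* z₃ :* z₄)) refl x z₁ z₂ z₃ z₄))
    (^-distrib-* (x * z₁ * z₂) (x * z₃ * z₄) m)

  module _ (x y p₁ p₂ p₃ p₄ : Carrier) where

    private
      z₁ z₂ z₃ z₄ : Carrier
      z₁ = 1# + y * p₁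
      z₂ = 1# + y * p₂
      z₃ = 1# + y * p₃
      z₄ = 1# + y * p₄

      :r : ∀ {n} (y p : Polynomial n) → Polynomial n
      :r y p = :1 :+ y :* p

    left≈c₀ : ∀ N U → left y z₁ z₂ z₃ z₄ N U ≈ c₀ x y p₁ p₂ p₃ p₄ * N * U
    left≈c₀ N U = *-congʳ (*-congʳ (solve 5 (λ y p₁ p₂ p₃ p₄ →
      y :* (:r y p₄ :- :r y p₂) :* (:r y p₁ :- :r y p₃) := y :* (y :* (p₄ :- p₂)) :* (y :* (p₁ :- p₃))) refl y p₁ p₂ p₃ p₄))

    module _ (m : ℕ) (D D′ Q Q′ U : Carrier) where

      private
        E₁₂ E₃₄ g d : Carrier
        E₁₂ = (x * z₁ * z₂) ^ m
        E₃₄ = (x * z₃ * z₄) ^ m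
        g = E₁₂ * U
        d = E₃₄ * U

        z₁₄* z₃₂* : Carrier
        z₁₄* = z₁₄ x y p₁ p₂ p₃ p₄
        z₃₂* = z₃₂ x y p₁ p₂ p₃ p₄

        term₁ : ((z₁ - 1#) * (z₂ - 1#) - y * z₁ * z₂) * ((z₃ - 1#) * (z₄ - 1#) - y * z₃ * z₄) * D * D′ ≈
                y * y * (A x y p₁ p₂ * A x y p₃ p₄) * D * D′
        term₁ = *-congʳ (*-congʳ (solve 6 (λ x y p₁ p₂ p₃ p₄ →
          ((:r y p₁ :- :1) :* (:r y p₂ :- :1) :- y :* :r y p₁ :* :r y p₂) :*
          ((:r y p₃ :- :1) :* (:r y p₄ :- :1) :- y :* :r y p₃ :* :r y p₄) :=
          y :* y :* (:A x y p₁ p₂ :* :A x y p₃ p₄)) refl x y p₁ p₂ p₃ p₄))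

        term₂ : (x * (z₄ - 1#) * (z₁ - 1#) - y) * (x * (z₂ - 1#) * (z₃ - 1#) - y) * z₁ * z₂ * z₃ * z₄ * Q * Q′ ≈
                z₁₄* * z₃₂* * (y * y * (B x y p₁ p₄ * B x y p₃ p₂) * Q * Q′)
        term₂ = solve 8 (λ x y p₁ p₂ p₃ p₄ Q Q′ →
          (x :* (:r y p₄ :- :1) :* (:r y p₁ :- :1) :- y) :* (x :* (:r y p₂ :- :1) :* (:r y p₃ :- :1) :- y)
            :* :r y p₁ :* :r y p₂ :* :r y p₃ :* :r y p₄ :* Q :* Q′ :=
          (:r y p₁ :* :r y p₄) :* (:r y p₃ :* :r y p₂) :* (y :* y :* (:B x y p₁ p₄ :* :B x y p₃ p₂) :* Q :* Q′))
          refl x y p₁ p₂ p₃ p₄ Q Q′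

        term₃ : ∀ q₁ q₂ q₃ q₄ D → let w₁ = 1# + y * q₁ ; w₂ = 1# + y * q₂ ; w₃ = 1# + y * q₃ ; w₄ = 1# + y * q₄ in
          (w₂ - 1#) * (w₃ - 1#) * ((w₄ - 1#) * (w₁ - 1#) - y * w₄ * w₁) * D * U ≈
          - (y * y * y * (q₂ * q₃) * A x y q₁ q₄ * D * U)
        term₃ q₁ q₂ q₃ q₄ D = solve 8 (λ x y p₁ p₂ p₃ p₄ D U →
          (:r y p₂ :- :1) :* (:r y p₃ :- :1) :* ((:r y p₄ :- :1) :* (:r y p₁ :- :1) :- y :* :r y p₄ :* :r y p₁) :* D :* U :=
          :- (y :* y :* y :* (p₂ :* p₃) :* :A x y p₁ p₄ :* D :* U)) refl x y q₁ q₂ q₃ q₄ D U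

        term₄ : ∀ q₁ q₂ q₃ q₄ e Q → let w₁ = 1# + y * q₁ ; w₂ = 1# + y * q₂ ; w₃ = 1# + y * q₃ ; w₄ = 1# + y * q₄ in
          (w₃ - 1#) * (w₄ - 1#) * (x * (w₁ - 1#) * (w₂ - 1#) - y) * w₁ * w₂ * (x * w₃ * w₄ * e) * Q * U ≈
          - (w₁ * w₄ * (w₃ * w₂) * (x * (y * y * y * (q₃ * q₄)) * B x y q₁ q₂ * (e * U) * Q))
        term₄ q₁ q₂ q₃ q₄ e Q = solve 9 (λ x y p₁ p₂ p₃ p₄ e Q U →
          (:r y p₃ :- :1) :* (:r y p₄ :- :1) :* (x :* (:r y p₁ :- :1) :* (:r y p₂ :- :1) :- y)
            :* :r y p₁ :* :r y p₂ :* (x :* :r y p₃ :* :r y p₄ :* e) :* Q :* U :=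
          :- (:r y p₁ :* :r y p₄ :* (:r y p₃ :* :r y p₂) :* (x :* (y :* y :* y :* (p₃ :* p₄)) :* :B x y p₁ p₂ :* (e :* U) :* Q)))
          refl x y q₁ q₂ q₃ q₄ e Q U

        term₇ : (z₁ - 1#) * (z₂ - 1#) * (z₃ - 1#) * (z₄ - 1#) * (1# - (x ^ 2 * z₁ * z₂ * z₃ * z₄) ^ suc m) * U ^ 2 ≈
                y * y * y * y * (p₁ * p₂ * (p₃ * p₄)) * (U * U)
                - z₁₄* * z₃₂* * (x * x * (y * y * y * y * (p₁ * p₂ * (p₃ * p₄))) * g * d)
        term₇ = trans (*-congʳ (*-congˡ (+-congˡ (-‿cong (*-congˡ (power-product m x z₁ z₂ z₃ z₄))))))
          (solve 9 (λ x y p₁ p₂ p₃ p₄ e f U →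
            (:r y p₁ :- :1) :* (:r y p₂ :- :1) :* (:r y p₃ :- :1) :* (:r y p₄ :- :1)
              :* (:1 :- (x :* (x :* :1)) :* :r y p₁ :* :r y p₂ :* :r y p₃ :* :r y p₄ :* (e :* f)) :* (U :* (U :* :1)) :=
            y :* y :* y :* y :* (p₁ :* p₂ :* (p₃ :* p₄)) :* (U :* U)
              :- (:r y p₁ :* :r y p₄) :* (:r y p₃ :* :r y p₂) :*
                 (x :* x :* (y :* y :* y :* y :* (p₁ :* p₂ :* (p₃ :* p₄))) :* (e :* U) :* (f :* U)))
            refl x y p₁ p₂ p₃ p₄ E₁₂ E₃₄ U)

      right≈canonical : right m x y z₁ z₂ z₃ z₄ D D′ Q Q′ U ≈ canonical x y p₁ p₂ p₃ p₄ D D′ Q Q′ U g d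
      right≈canonical = trans
        (+-cong (+-cong (+-cong (+-cong (+-cong (+-cong term₁ (-‿cong term₂)) (-‿cong (term₃ p₁ p₂ p₃ p₄ D)))
          (term₄ p₁ p₂ p₃ p₄ E₃₄ Q)) (-‿cong term₅)) term₆) term₇)
        (solve 9 (λ a b c e f h k l z →
          a :- z :* b :- (:- c) :+ (:- (z :* e)) :- (:- f) :+ (:- (z :* h)) :+ (k :- z :* l) :=
          a :+ c :+ f :+ k :- z :* (b :+ e :+ h :+ l)) refl _ _ _ _ _ _ _ _ _)
        where
        -- The half-turn of the square exchanges 1 with 3 and 2 with 4.
        term₅ : (z₄ - 1#) * (z₁ - 1#) * ((z₂ - 1#) * (z₃ - 1#) - y * z₂ * z₃) * D′ * U ≈
                - (y * y * y * (p₁ * p₄) * A x y p₃ p₂ * D′ * U)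
        term₅ = trans (term₃ p₃ p₄ p₁ p₂ D′) (-‿cong (*-congʳ (*-congʳ (*-congʳ (*-congˡ (*-comm p₄ p₁))))))
        term₆ : (z₁ - 1#) * (z₂ - 1#) * (x * (z₃ - 1#) * (z₄ - 1#) - y) * z₃ * z₄ * (x * z₁ * z₂) ^ suc m * Q′ * U ≈
                - (z₁₄* * z₃₂* * (x * (y * y * y * (p₁ * p₂)) * B x y p₃ p₄ * g * Q′))
        term₆ = trans (term₄ p₃ p₄ p₁ p₂ E₁₂ Q′) (-‿cong (*-congʳ (*-comm _ _)))

-- The theorem over a field, away from a hypersurface

module Final {c ℓ} (K : CommutativeRing c ℓ) (F : IsField₀ K) where

  open CommutativeRing K hiding (zero)
  open IntSolver K hiding (fromℕ)
  open SixVertex K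
  open Exchange K
  open Poly K F using (x*y≉0; *-cancelˡ)
  open Star K F using (_⇝_; W-⇝; ⇝-∷; ∷⇝∷ʳ)
  open Everywhere K F using (bilinear)
  open Refined K using (plain; zeros; Zquad-plain; Zadj-plain; Z̃adj-plain; Z-plain)
  open Assembly K using (Relation; Ω; canonical; assembled; z₁₄; z₃₂; c₀)
  open Relations K using (U; G; N₀; N₃; rest₄; U-six; topLeftRelation; bottomRightRelation; topRightRelation; bottomLeftRelation; rest₂; rest₃; change₁; change₂; change₃; change₄; allPlain; allSix)
  open Sides K
  open GeneratingFunctions K
  open import Algebra.Properties.Ring ring using (+-cancelʳ)
  open import Algebra.Properties.CommutativeSemiring.Exp commutativeSemiring using (^-distrib-*; ^-congˡ)
  open import Data.Vec.Relation.Unary.All using (All; []; _∷_)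
  open import Relation.Binary.Reasoning.Setoid setoid

  module _ (m : ℕ) (x y p₁ p₂ p₃ p₄ : Carrier) where

    private
      z₁ z₂ z₃ z₄ : Carrier
      z₁ = 1# + y * p₁
      z₂ = 1# + y * p₂
      z₃ = 1# + y * p₃
      z₄ = 1# + y * p₄

      A₁₂ A₃₄ A₁₄ A₃₂ B₁₂ B₃₄ B₁₄ B₃₂ : Carrier
      A₁₂ = A x y p₁ p₂
      A₃₄ = A x y p₃ p₄
      A₁₄ = A x y p₁ p₄
      A₃₂ = A x y p₃ p₂
      B₁₂ = B x y p₁ p₂
      B₃₄ = B x y p₃ p₄
      B₁₄ = B x y p₁ p₄
      B₃₂ = B x y p₃ p₂

      os : Vec Carrier m
      os = zeros x y m

      slope : Carrier → Carrier
      slope p = 1# + (y - 1#) * p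

    module _ (A₁₄≉0 : A₁₄ ≉ 0#) (A₃₂≉0 : A₃₂ ≉ 0#) (B₁₂≉0 : B₁₂ ≉ 0#) (B₃₄≉0 : B₃₄ ≉ 0#)
             (slope₂≉0 : slope p₂ ≉ 0#) (slope₃≉0 : slope p₃ ≉ 0#) (slope₄≉0 : slope p₄ ≉ 0#) where

      private
        u : Carrier
        u = Z m x y

        g d : Carrier
        g = (x * z₁ * z₂) ^ m * u
        d = (x * z₃ * z₄) ^ m * u

        eU : U x y m ≈ u
        eU = sym (Z-plain x y m)

        eG : ∀ p v → G x y m p v ≈ (x * (1# + y * p) * (1# + y * v)) ^ m * u
        eG p v = begin
          r ^ m * ((x * t) ^ m * U x y m)   ≈⟨ *-assoc _ _ _ ⟨
          r ^ m * (x * t) ^ m * U x y m     ≈⟨ *-cong (^-distrib-* r (x * t) m) (sym eU) ⟨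
          (r * (x * t)) ^ m * u             ≈⟨ *-congʳ (^-congˡ m (solve 3 (λ x r t → r :* (x :* t) := x :* r :* t) refl x r t)) ⟩
          (x * r * t) ^ m * u               ∎
          where
          r = 1# + y * p
          t = 1# + y * v

        eG₄₃ : G x y m p₄ p₃ ≈ d
        eG₄₃ = trans (eG p₄ p₃) (*-congʳ (^-congˡ m (solve 3 (λ x r t → x :* r :* t := x :* t :* r) refl x z₄ z₃)))

        -- `Zadj (suc m) x y z₄ z₁` has z₄ on the top row and z₁ on the left column, so p₄ is the
        -- row parameter. In the bilinear identity the row parameter is p₁, which is why `eTL`
        -- transposes.
        α-relation = topLeftRelation x y m p₄ p₁
        β-relation = topLeftRelation x y m p₂ p₃
        γ-relation = topRightRelation x y m p₁ p₂
        δ-relation = topRightRelation x y m p₃ p₄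
        β′-relation = bottomRightRelation x y m p₃ p₂
        δ′-relation = bottomLeftRelation x y m p₃ p₄

        α β γ δ β′ δ′ : Carrier
        α = proj₁ α-relation
        β = proj₁ β-relation
        γ = proj₁ γ-relation
        δ = proj₁ δ-relation
        β′ = proj₁ β′-relation
        δ′ = proj₁ δ′-relation

        -- Moving p past an inner parameter 0 costs the factor `cross x y p 0#`, which is `slope p`.
        cross-0 : ∀ {p} → slope p ≉ 0# → cross x y p 0# ≉ 0#
        cross-0 {p} h e = h (trans (solve 3 (λ x y p → :1 :+ (y :- :1) :* p := :cross x y p :0) refl x y p) e)

        all-cross : ∀ {p} → slope p ≉ 0# → ∀ k → All (λ v → cross x y p v ≉ 0#) (zeros x y k)
        all-cross h zero    = []
        all-cross h (suc k) = cross-0 h ∷ all-cross h k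

        move : ∀ {p} → slope p ≉ 0# → _⇝_ x y (p ∷ os) (os ∷ʳ p)
        move h = ∷⇝∷ʳ x y os (all-cross h m)

        moveRow : ∀ {n p} → slope p ≉ 0# → (V : Vec Carrier n) → W x y (p ∷ os) V ≈ W x y (os ∷ʳ p) V
        moveRow {p = p} h V = trans (W-transpose x y (p ∷ os) V) (trans (W-⇝ x y V (move h)) (W-transpose x y V (os ∷ʳ p)))

        moveColumn : ∀ {n p} → slope p ≉ 0# → (P : Vec Carrier n) → W x y P (p ∷ os) ≈ W x y P (os ∷ʳ p)
        moveColumn h P = W-⇝ x y P (move h)

        eTL : W x y (p₁ ∷ os) (p₄ ∷ os) ≈ A₁₄ * α + u
        eTL = trans (W-transpose x y (p₁ ∷ os) (p₄ ∷ os)) (trans (proj₂ (proj₂ α-relation)) (+-cong (*-congʳ (A-comm x y p₄ p₁)) eU))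

        eBR : W x y (p₃ ∷ os) (p₂ ∷ os) ≈ A₃₂ * β + u
        eBR = trans (W-transpose x y (p₃ ∷ os) (p₂ ∷ os)) (trans (proj₂ (proj₂ β-relation)) (+-cong (*-congʳ (A-comm x y p₂ p₃)) eU))

        eTR : W x y (p₁ ∷ os) (os ∷ʳ p₂) ≈ B₁₂ * γ + g
        eTR = trans (proj₂ (proj₂ γ-relation)) (+-congˡ (eG p₁ p₂))

        eBL : W x y (p₃ ∷ os) (p₄ ∷ os) ≈ B₃₄ * δ + d
        eBL = trans (moveColumn slope₄≉0 (p₃ ∷ os)) (trans (proj₂ (proj₂ δ-relation)) (+-congˡ (eG p₃ p₄)))

        -- The symmetry of `W` identifies the bottom right function with the top left one, and
        -- cancelling `A₃₂` gives equal slopes; the corresponding plain functions therefore agree as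
        -- well.
        β′≈β : β′ ≈ β
        β′≈β = *-cancelˡ A₃₂≉0 (+-cancelʳ u _ _ (begin
          A₃₂ * β′ + u                 ≈⟨ trans (proj₂ (proj₂ β′-relation)) (+-congˡ eU) ⟨
          W x y (os ∷ʳ p₃) (os ∷ʳ p₂)  ≈⟨ trans (moveColumn slope₂≉0 (p₃ ∷ os)) (moveRow slope₃≉0 (os ∷ʳ p₂)) ⟨
          W x y (p₃ ∷ os) (p₂ ∷ os)    ≈⟨ eBR ⟩
          A₃₂ * β + u                  ∎))

        δ′≈δ : δ′ ≈ δ
        δ′≈δ = *-cancelˡ B₃₄≉0 (+-cancelʳ d _ _ (begin
          B₃₄ * δ′ + d                 ≈⟨ trans (proj₂ (proj₂ δ′-relation)) (+-congˡ eG₄₃) ⟨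
          W x y (os ∷ʳ p₃) (p₄ ∷ os)   ≈⟨ moveRow slope₃≉0 (p₄ ∷ os) ⟨
          W x y (p₃ ∷ os) (p₄ ∷ os)    ≈⟨ eBL ⟩
          B₃₄ * δ + d                  ∎))

        eR₁ : partition (plain x y) (os ∷ʳ p₃) (os ∷ʳ p₂) ≈ z₃₂ x y p₁ p₂ p₃ p₄ * β + u
        eR₁ = trans (proj₁ (proj₂ β′-relation)) (+-cong (*-congˡ β′≈β) eU)

        eQ : partition (plain x y) (os ∷ʳ p₃) (p₄ ∷ os) ≈ δ + d
        eQ = trans (proj₁ (proj₂ δ′-relation)) (+-cong (trans (*-identityˡ _) δ′≈δ) eG₄₃)

        eY₂ : u * rest₂ x y m p₁ p₂ p₃ p₄ ≈ A₁₄ * x * z₃₂ x y p₁ p₂ p₃ p₄ * g * (δ + d)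
        eY₂ = begin
          u * ((A₁₄ * z₁ ^ m) * (((x * z₂) ^ m * (x * (z₃ * z₂))) * partition (plain x y) (os ∷ʳ p₃) (p₄ ∷ os)))
            ≈⟨ *-cong (sym eU) (*-congˡ (*-congˡ eQ)) ⟩
          U x y m * ((A₁₄ * z₁ ^ m) * (((x * z₂) ^ m * (x * (z₃ * z₂))) * (δ + d)))
            ≈⟨ solve 7 (λ U A e f x z q → U :* ((A :* e) :* ((f :* (x :* z)) :* q)) := A :* x :* z :* (e :* (f :* U)) :* q) refl
                 (U x y m) A₁₄ (z₁ ^ m) ((x * z₂) ^ m) x (z₃ * z₂) (δ + d) ⟩
          A₁₄ * x * (z₃ * z₂) * G x y m p₁ p₂ * (δ + d)
            ≈⟨ *-congʳ (*-congˡ (eG p₁ p₂)) ⟩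
          A₁₄ * x * (z₃ * z₂) * g * (δ + d) ∎

        eY₃ : u * rest₃ x y m p₁ p₂ p₃ p₄ ≈ A₁₄ * x * z₃₂ x y p₁ p₂ p₃ p₄ * d * (B₁₂ * γ + g)
        eY₃ = begin
          u * ((A₁₄ * z₄ ^ m) * (((x * z₃) ^ m * (x * (z₃ * z₂))) * W x y (p₁ ∷ os) (os ∷ʳ p₂)))
            ≈⟨ *-cong (sym eU) (*-congˡ (*-congˡ eTR)) ⟩
          U x y m * ((A₁₄ * z₄ ^ m) * (((x * z₃) ^ m * (x * (z₃ * z₂))) * (B₁₂ * γ + g)))
            ≈⟨ solve 7 (λ U A e f x z q → U :* ((A :* e) :* ((f :* (x :* z)) :* q)) := A :* x :* z :* (e :* (f :* U)) :* q) refl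
                 (U x y m) A₁₄ (z₄ ^ m) ((x * z₃) ^ m) x (z₃ * z₂) (B₁₂ * γ + g) ⟩
          A₁₄ * x * (z₃ * z₂) * G x y m p₄ p₃ * (B₁₂ * γ + g)
            ≈⟨ *-congʳ (*-congˡ eG₄₃) ⟩
          A₁₄ * x * (z₃ * z₂) * d * (B₁₂ * γ + g) ∎

        N₄ : Carrier
        N₄ = W x y (p₁ ∷ (os ∷ʳ p₃)) (p₄ ∷ (os ∷ʳ p₂))

        eN₄ : N₄ ≈ W x y (p₁ ∷ p₃ ∷ os) (p₄ ∷ p₂ ∷ os)
        eN₄ = sym (trans (W-⇝ x y (p₁ ∷ p₃ ∷ os) (⇝-∷ x y (move slope₂≉0)))
          (trans (W-transpose x y (p₁ ∷ p₃ ∷ os) (p₄ ∷ (os ∷ʳ p₂)))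
          (trans (W-⇝ x y (p₄ ∷ (os ∷ʳ p₂)) (⇝-∷ x y (move slope₃≉0)))
                 (W-transpose x y (p₄ ∷ (os ∷ʳ p₂)) (p₁ ∷ (os ∷ʳ p₃))))))

        eBilinear : y * (p₁ - p₃) * (p₄ - p₂) * (N₄ * u) ≈
          A₁₂ * B₁₂ * (A₃₄ * B₃₄) * ((A₃₂ * β + u) * (A₁₄ * α + u))
          - A₁₄ * B₁₄ * (A₃₂ * B₃₂) * ((B₁₂ * γ + g) * (B₃₄ * δ + d))
        eBilinear = trans (*-congˡ (*-cong eN₄ (sym (trans (U-six x y m) eU))))
          -- The distinguished rows are p₁ and p₃, the distinguished columns p₄ and p₂, and all
          -- other parameters are 0.
          (trans (bilinear x y p₁ p₃ p₄ p₂ os os)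
            (+-cong (*-congˡ (*-cong eBR eTL))
                    (-‿cong (*-congˡ (*-cong (trans (moveColumn slope₂≉0 (p₁ ∷ os)) eTR) eBL)))))

        canonical-cong : ∀ {D D̂ D′ D̂′ Q Q̂ Q′ Q̂′} → D ≈ D̂ → D′ ≈ D̂′ → Q ≈ Q̂ → Q′ ≈ Q̂′ →
          canonical x y p₁ p₂ p₃ p₄ D D′ Q Q′ u g d ≈ canonical x y p₁ p₂ p₃ p₄ D̂ D̂′ Q̂ Q̂′ u g d
        canonical-cong e₁ e₂ e₃ e₄ = +-cong
          (+-congʳ (+-cong (+-cong (*-cong (*-congˡ e₁) e₂) (*-congʳ (*-congˡ e₁))) (*-congʳ (*-congˡ e₂))))
          (-‿cong (*-congˡ (+-congʳ (+-cong (+-cong (*-cong (*-congˡ e₃) e₄) (*-congˡ e₃)) (*-congˡ e₄)))))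

        eD : Zadj (suc m) x y z₄ z₁ ≈ z₁₄ x y p₁ p₂ p₃ p₄ * α + u
        eD = trans (Zadj-plain x y refl refl m) (trans (proj₁ (proj₂ α-relation)) (+-cong (*-congʳ (*-comm _ _)) eU))

        eD′ : Zadj (suc m) x y z₂ z₃ ≈ z₃₂ x y p₁ p₂ p₃ p₄ * β + u
        eD′ = trans (Zadj-plain x y refl refl m) (trans (proj₁ (proj₂ β-relation)) (+-cong (*-congʳ (*-comm _ _)) eU))

        eQ₁₂ : Z̃adj (suc m) x y z₁ z₂ ≈ γ + g
        eQ₁₂ = trans (Z̃adj-plain x y refl refl m) (trans (proj₁ (proj₂ γ-relation)) (+-cong (*-identityˡ _) (eG p₁ p₂)))

        eQ₃₄ : Z̃adj (suc m) x y z₃ z₄ ≈ δ + d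
        eQ₃₄ = trans (Z̃adj-plain x y refl refl m) (trans (proj₁ (proj₂ δ-relation)) (+-cong (*-identityˡ _) (eG p₃ p₄)))

        eN : Zquad (suc (suc m)) x y z₁ z₂ z₃ z₄ ≈ N₀ x y m p₁ p₂ p₃ p₄
        eN = trans (Zquad-plain x y refl refl refl refl m) (allPlain x y m p₁ p₂ p₃ p₄)

        h₄ : Relation (N₃ x y m p₁ p₂ p₃ p₄) N₄ (z₃₂ x y p₁ p₂ p₃ p₄) A₃₂ (rest₄ x y m p₁ p₂ p₃ p₄)
        h₄ = let r = change₄ x y m p₁ p₂ p₃ p₄ in
          proj₁ r , proj₁ (proj₂ r) , trans (allSix x y m p₁ p₂ p₃ p₄) (proj₂ (proj₂ r))

      generic : left y z₁ z₂ z₃ z₄ (Zquad (suc (suc m)) x y z₁ z₂ z₃ z₄) u ≈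
                right m x y z₁ z₂ z₃ z₄ (Zadj (suc m) x y z₄ z₁) (Zadj (suc m) x y z₂ z₃)
                  (Z̃adj (suc m) x y z₁ z₂) (Z̃adj (suc m) x y z₃ z₄) u
      generic = *-cancelˡ (x*y≉0 (x*y≉0 A₁₄≉0 A₃₂≉0) (x*y≉0 B₁₂≉0 B₃₄≉0)) (begin
        Ω x y p₁ p₂ p₃ p₄ * left y z₁ z₂ z₃ z₄ (Zquad (suc (suc m)) x y z₁ z₂ z₃ z₄) u
          ≈⟨ *-congˡ (trans (left≈c₀ x y p₁ p₂ p₃ p₄ (Zquad (suc (suc m)) x y z₁ z₂ z₃ z₄) u) (*-congʳ (*-congˡ eN))) ⟩
        Ω x y p₁ p₂ p₃ p₄ * (c₀ x y p₁ p₂ p₃ p₄ * N₀ x y m p₁ p₂ p₃ p₄ * u)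
          ≈⟨ assembled x y p₁ p₂ p₃ p₄ (change₁ x y m p₁ p₂ p₃ p₄) (change₂ x y m p₁ p₂ p₃ p₄) (change₃ x y m p₁ p₂ p₃ p₄)
               h₄ eR₁ (*-congˡ (*-congˡ eTL)) eY₂ eY₃ eBilinear ⟩
        Ω x y p₁ p₂ p₃ p₄ * canonical x y p₁ p₂ p₃ p₄ (z₁₄ x y p₁ p₂ p₃ p₄ * α + u) (z₃₂ x y p₁ p₂ p₃ p₄ * β + u) (γ + g) (δ + d) u g d
          ≈⟨ *-congˡ (trans (right≈canonical x y p₁ p₂ p₃ p₄ m (Zadj (suc m) x y z₄ z₁) (Zadj (suc m) x y z₂ z₃)
                 (Z̃adj (suc m) x y z₁ z₂) (Z̃adj (suc m) x y z₃ z₄) u) (canonical-cong eD eD′ eQ₁₂ eQ₃₄)) ⟨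
        Ω x y p₁ p₂ p₃ p₄ * right m x y z₁ z₂ z₃ z₄ (Zadj (suc m) x y z₄ z₁) (Zadj (suc m) x y z₂ z₃)
          (Z̃adj (suc m) x y z₁ z₂) (Z̃adj (suc m) x y z₃ z₄) u ∎)

-- The theorem as a term, and its transfer from ℚ to every commutative ring

open import Data.List.Base as List using (List; []; _∷_)
open import Data.Rational.Base using (1ℚ)
import Data.Rational.Properties as ℚ
open RationalField using (ℚ-isField₀)
open Term

private
  infixr 8 _^ᵗ_
  infixl 6 _⊖_

  _^ᵗ_ : ∀ {n} → Term n → ℕ → Term n
  t ^ᵗ zero  = 𝟙
  t ^ᵗ suc n = t ∙ t ^ᵗ n

  _⊖_ : ∀ {n} → Term n → Term n → Term n
  s ⊖ t = s ∔ neg t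

  x y z₁ z₂ z₃ z₄ : Term 6
  x  = var zero
  y  = var (suc zero)
  z₁ = var (suc (suc zero))
  z₂ = var (suc (suc (suc zero)))
  z₃ = var (suc (suc (suc (suc zero))))
  z₄ = var (suc (suc (suc (suc (suc zero)))))

  -- The theorem is repeated in syntax because only terms can be carried from ℚ to other rings. The
  -- index is one less than the order.
  Zquadᵗ : ∀ n → (t₁ t₂ t₃ t₄ : Term 6) → Term 6
  Zquadᵗ n t₁ t₂ t₃ t₄ = List.foldr _∔_ 𝟘 (List.map
    (λ A → x ^ᵗ ν A ∙ y ^ᵗ μ A ∙ t₁ ^ᵗ ρT A ∙ t₂ ^ᵗ ρR A ∙ t₃ ^ᵗ ρB A ∙ t₄ ^ᵗ ρL A) (ASM (suc n)))

  Zᵗ : ℕ → Term 6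
  Zᵗ zero    = 𝟙
  Zᵗ (suc n) = Zquadᵗ n 𝟙 𝟙 𝟙 𝟙

  leftᵗ rightᵗ differenceᵗ : ℕ → Term 6
  leftᵗ m = y ∙ (z₄ ⊖ z₂) ∙ (z₁ ⊖ z₃) ∙ Zquadᵗ (suc m) z₁ z₂ z₃ z₄ ∙ Zᵗ m
  rightᵗ m =
    ((z₁ ⊖ 𝟙) ∙ (z₂ ⊖ 𝟙) ⊖ y ∙ z₁ ∙ z₂) ∙ ((z₃ ⊖ 𝟙) ∙ (z₄ ⊖ 𝟙) ⊖ y ∙ z₃ ∙ z₄) ∙ D ∙ D′
    ⊖ (x ∙ (z₄ ⊖ 𝟙) ∙ (z₁ ⊖ 𝟙) ⊖ y) ∙ (x ∙ (z₂ ⊖ 𝟙) ∙ (z₃ ⊖ 𝟙) ⊖ y)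
        ∙ z₁ ∙ z₂ ∙ z₃ ∙ z₄ ∙ Q ∙ Q′
    ⊖ (z₂ ⊖ 𝟙) ∙ (z₃ ⊖ 𝟙) ∙ ((z₄ ⊖ 𝟙) ∙ (z₁ ⊖ 𝟙) ⊖ y ∙ z₄ ∙ z₁) ∙ D ∙ U
    ∔ (z₃ ⊖ 𝟙) ∙ (z₄ ⊖ 𝟙) ∙ (x ∙ (z₁ ⊖ 𝟙) ∙ (z₂ ⊖ 𝟙) ⊖ y)
        ∙ z₁ ∙ z₂ ∙ (x ∙ z₃ ∙ z₄) ^ᵗ suc m ∙ Q ∙ U
    ⊖ (z₄ ⊖ 𝟙) ∙ (z₁ ⊖ 𝟙) ∙ ((z₂ ⊖ 𝟙) ∙ (z₃ ⊖ 𝟙) ⊖ y ∙ z₂ ∙ z₃) ∙ D′ ∙ U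
    ∔ (z₁ ⊖ 𝟙) ∙ (z₂ ⊖ 𝟙) ∙ (x ∙ (z₃ ⊖ 𝟙) ∙ (z₄ ⊖ 𝟙) ⊖ y)
        ∙ z₃ ∙ z₄ ∙ (x ∙ z₁ ∙ z₂) ^ᵗ suc m ∙ Q′ ∙ U
    ∔ (z₁ ⊖ 𝟙) ∙ (z₂ ⊖ 𝟙) ∙ (z₃ ⊖ 𝟙) ∙ (z₄ ⊖ 𝟙)
        ∙ (𝟙 ⊖ (x ^ᵗ 2 ∙ z₁ ∙ z₂ ∙ z₃ ∙ z₄) ^ᵗ suc m) ∙ U ^ᵗ 2
    where
    D D′ Q Q′ U : Term 6
    D  = Zquadᵗ m z₄ 𝟙 𝟙 z₁
    D′ = Zquadᵗ m z₂ 𝟙 𝟙 z₃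
    Q  = Zquadᵗ m z₁ z₂ 𝟙 𝟙
    Q′ = Zquadᵗ m z₃ z₄ 𝟙 𝟙
    U  = Zᵗ m
  differenceᵗ m = leftᵗ m ⊖ rightᵗ m

  -- Its factors are y and the multiples by y of the quantities that
  -- Final.generic requires to be nonzero.
  nondegenerateᵗ : Term 6
  nondegenerateᵗ = a z₁ z₄ ∙ a z₃ z₂ ∙ b z₁ z₂ ∙ b z₃ z₄ ∙ s z₂ ∙ s z₃ ∙ s z₄ ∙ y
    where
    a b : Term 6 → Term 6 → Term 6
    a t u = y ∙ t ∙ u ⊖ (t ⊖ 𝟙) ∙ (u ⊖ 𝟙)
    b t u = y ⊖ x ∙ (t ⊖ 𝟙) ∙ (u ⊖ 𝟙)
    s : Term 6 → Term 6
    s t = y ∔ (y ⊖ 𝟙) ∙ (t ⊖ 𝟙)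

module _ {c ℓ} (R : CommutativeRing c ℓ) where

  open CommutativeRing R hiding (zero)
  open GeneratingFunctions R
  open Evaluation R
  open Sides R

  environment : (x y z₁ z₂ z₃ z₄ : Carrier) → Fin 6 → Carrier
  environment x y z₁ z₂ z₃ z₄ zero                                   = x
  environment x y z₁ z₂ z₃ z₄ (suc zero)                             = y
  environment x y z₁ z₂ z₃ z₄ (suc (suc zero))                       = z₁
  environment x y z₁ z₂ z₃ z₄ (suc (suc (suc zero)))                 = z₂
  environment x y z₁ z₂ z₃ z₄ (suc (suc (suc (suc zero))))           = z₃
  environment x y z₁ z₂ z₃ z₄ (suc (suc (suc (suc (suc zero)))))     = z₄

  private
    module _ (ρ : Fin 6 → Carrier) where

      ⟦^⟧ : ∀ t n → ⟦ t ^ᵗ n ⟧ ρ ≡ ⟦ t ⟧ ρ ^ n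
      ⟦^⟧ t zero    = ≡.refl
      ⟦^⟧ t (suc n) = ≡.cong (⟦ t ⟧ ρ *_) (⟦^⟧ t n)

      ⟦foldr⟧ : ∀ {X : Set} (f : X → Term 6) {g : X → Carrier} → (∀ a → ⟦ f a ⟧ ρ ≡ g a) → ∀ as →
                ⟦ List.foldr _∔_ 𝟘 (List.map f as) ⟧ ρ ≡ List.foldr _+_ 0# (List.map g as)
      ⟦foldr⟧ f e []       = ≡.refl
      ⟦foldr⟧ f e (a ∷ as) = ≡.cong₂ _+_ (e a) (⟦foldr⟧ f e as)

      ⟦Zquad⟧ : ∀ n t₁ t₂ t₃ t₄ → ⟦ Zquadᵗ n t₁ t₂ t₃ t₄ ⟧ ρ ≡
                Zquad (suc n) (⟦ x ⟧ ρ) (⟦ y ⟧ ρ) (⟦ t₁ ⟧ ρ) (⟦ t₂ ⟧ ρ) (⟦ t₃ ⟧ ρ) (⟦ t₄ ⟧ ρ)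
      ⟦Zquad⟧ n t₁ t₂ t₃ t₄ = ⟦foldr⟧ _ (λ A → ≡.cong₂ _*_ (≡.cong₂ _*_ (≡.cong₂ _*_ (≡.cong₂ _*_ (≡.cong₂ _*_
        (⟦^⟧ x (ν A)) (⟦^⟧ y (μ A))) (⟦^⟧ t₁ (ρT A))) (⟦^⟧ t₂ (ρR A))) (⟦^⟧ t₃ (ρB A))) (⟦^⟧ t₄ (ρL A))) (ASM (suc n))

      ⟦Z⟧ : ∀ n → ⟦ Zᵗ n ⟧ ρ ≡ Z n (⟦ x ⟧ ρ) (⟦ y ⟧ ρ)
      ⟦Z⟧ zero    = ≡.refl
      ⟦Z⟧ (suc n) = ⟦Zquad⟧ n 𝟙 𝟙 𝟙 𝟙

  Difference : ℕ → (x y z₁ z₂ z₃ z₄ : Carrier) → Carrier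
  Difference m x y z₁ z₂ z₃ z₄ =
    left y z₁ z₂ z₃ z₄ (Zquad (suc (suc m)) x y z₁ z₂ z₃ z₄) (Z m x y)
    - right m x y z₁ z₂ z₃ z₄ (Zadj (suc m) x y z₄ z₁) (Zadj (suc m) x y z₂ z₃)
        (Z̃adj (suc m) x y z₁ z₂) (Z̃adj (suc m) x y z₃ z₄) (Z m x y)

  ⟦difference⟧ : ∀ m ρ → ⟦ differenceᵗ m ⟧ ρ ≡
    Difference m (⟦ x ⟧ ρ) (⟦ y ⟧ ρ) (⟦ z₁ ⟧ ρ) (⟦ z₂ ⟧ ρ) (⟦ z₃ ⟧ ρ) (⟦ z₄ ⟧ ρ)
  ⟦difference⟧ m ρ = expand
    (⟦Zquad⟧ ρ (suc m) z₁ z₂ z₃ z₄) (⟦Z⟧ ρ m)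
    (⟦Zquad⟧ ρ m z₄ 𝟙 𝟙 z₁) (⟦Zquad⟧ ρ m z₂ 𝟙 𝟙 z₃) (⟦Zquad⟧ ρ m z₁ z₂ 𝟙 𝟙) (⟦Zquad⟧ ρ m z₃ z₄ 𝟙 𝟙)
    (⟦^⟧ ρ (x ∙ z₃ ∙ z₄) (suc m)) (⟦^⟧ ρ (x ∙ z₁ ∙ z₂) (suc m)) (⟦^⟧ ρ (x ^ᵗ 2 ∙ z₁ ∙ z₂ ∙ z₃ ∙ z₄) (suc m))
    where
    -- Apart from six generating functions and three powers with variable exponent, the term
    -- evaluates definitionally; these nine values become arguments.
    combine : (x y z₁ z₂ z₃ z₄ N U D D′ Q Q′ e₃₄ e₁₂ e : Carrier) → Carrier
    combine x y z₁ z₂ z₃ z₄ N U D D′ Q Q′ e₃₄ e₁₂ e = left y z₁ z₂ z₃ z₄ N U - (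
      ((z₁ - 1#) * (z₂ - 1#) - y * z₁ * z₂) * ((z₃ - 1#) * (z₄ - 1#) - y * z₃ * z₄) * D * D′
      - (x * (z₄ - 1#) * (z₁ - 1#) - y) * (x * (z₂ - 1#) * (z₃ - 1#) - y) * z₁ * z₂ * z₃ * z₄ * Q * Q′
      - (z₂ - 1#) * (z₃ - 1#) * ((z₄ - 1#) * (z₁ - 1#) - y * z₄ * z₁) * D * U
      + (z₃ - 1#) * (z₄ - 1#) * (x * (z₁ - 1#) * (z₂ - 1#) - y) * z₁ * z₂ * e₃₄ * Q * U
      - (z₄ - 1#) * (z₁ - 1#) * ((z₂ - 1#) * (z₃ - 1#) - y * z₂ * z₃) * D′ * U
      + (z₁ - 1#) * (z₂ - 1#) * (x * (z₃ - 1#) * (z₄ - 1#) - y) * z₃ * z₄ * e₁₂ * Q′ * U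
      + (z₁ - 1#) * (z₂ - 1#) * (z₃ - 1#) * (z₄ - 1#) * (1# - e) * U ^ 2)
    expand : ∀ {N N̂ U Û D D̂ D′ D̂′ Q Q̂ Q′ Q̂′ e₃₄ ê₃₄ e₁₂ ê₁₂ e ê} → N ≡ N̂ → U ≡ Û → D ≡ D̂ → D′ ≡ D̂′ →
      Q ≡ Q̂ → Q′ ≡ Q̂′ → e₃₄ ≡ ê₃₄ → e₁₂ ≡ ê₁₂ → e ≡ ê →
      combine (⟦ x ⟧ ρ) (⟦ y ⟧ ρ) (⟦ z₁ ⟧ ρ) (⟦ z₂ ⟧ ρ) (⟦ z₃ ⟧ ρ) (⟦ z₄ ⟧ ρ) N U D D′ Q Q′ e₃₄ e₁₂ e ≡
      combine (⟦ x ⟧ ρ) (⟦ y ⟧ ρ) (⟦ z₁ ⟧ ρ) (⟦ z₂ ⟧ ρ) (⟦ z₃ ⟧ ρ) (⟦ z₄ ⟧ ρ) N̂ Û D̂ D̂′ Q̂ Q̂′ ê₃₄ ê₁₂ ê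
    expand ≡.refl ≡.refl ≡.refl ≡.refl ≡.refl ≡.refl ≡.refl ≡.refl ≡.refl = ≡.refl

module _ {c ℓ} (K : CommutativeRing c ℓ) (F : IsField₀ K) where

  open CommutativeRing K hiding (zero)
  open Evaluation K
  open IntSolver K
  open Exchange K
  open Poly K F

  private
    factors≉0 : ∀ {a b} → a * b ≉ 0# → a ≉ 0# × b ≉ 0#
    factors≉0 ab≉0 = (λ e → ab≉0 (trans (*-congʳ e) (zeroˡ _))) , (λ e → ab≉0 (trans (*-congˡ e) (zeroʳ _)))

    multiple≉0 : ∀ {a b} → a ≉ 0# → ∀ r → a ≈ r * b → b ≉ 0#
    multiple≉0 a≉0 r e b≈0 = a≉0 (trans e (trans (*-congˡ b≈0) (zeroʳ r)))

    :r : ∀ {n} (y p : Polynomial n) → Polynomial n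
    :r y p = :1 :+ y :* p

    point : (x y p₁ p₂ p₃ p₄ : Carrier) → Fin 6 → Carrier
    point x y p₁ p₂ p₃ p₄ = environment K x y (1# + y * p₁) (1# + y * p₂) (1# + y * p₃) (1# + y * p₄)

    difference≈0 : ∀ m x y p₁ p₂ p₃ p₄ → ⟦ nondegenerateᵗ ⟧ (point x y p₁ p₂ p₃ p₄) ≉ 0# →
                   ⟦ differenceᵗ m ⟧ (point x y p₁ p₂ p₃ p₄) ≈ 0#
    difference≈0 m x y p₁ p₂ p₃ p₄ nondegenerate =
      let h₇ , _  = factors≉0 nondegenerate
          h₆ , s₄ = factors≉0 h₇
          h₅ , s₃ = factors≉0 h₆
          h₄ , s₂ = factors≉0 h₅
          h₃ , b₃₄ = factors≉0 h₄
          h₂ , b₁₂ = factors≉0 h₃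
          a₁₄ , a₃₂ = factors≉0 h₂
      in trans (reflexive (⟦difference⟧ K m (point x y p₁ p₂ p₃ p₄)))
           (trans (+-congʳ (Final.generic K F m x y p₁ p₂ p₃ p₄
             (multiple≉0 a₁₄ y (yA p₁ p₄)) (multiple≉0 a₃₂ y (yA p₃ p₂))
             (multiple≉0 b₁₂ y (yB p₁ p₂)) (multiple≉0 b₃₄ y (yB p₃ p₄))
             (multiple≉0 s₂ y (yS p₂)) (multiple≉0 s₃ y (yS p₃)) (multiple≉0 s₄ y (yS p₄))))
             (-‿inverseʳ _))
      where
      yA : ∀ p q → _ ≈ y * A x y p q
      yA p q = solve 4 (λ x y p q → y :* :r y p :* :r y q :- (:r y p :- :1) :* (:r y q :- :1) := y :* :A x y p q) refl x y p q
      yB : ∀ p q → _ ≈ y * B x y p q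
      yB p q = solve 4 (λ x y p q → y :- x :* (:r y p :- :1) :* (:r y q :- :1) := y :* :B x y p q) refl x y p q
      yS : ∀ p → _ ≈ y * (1# + (y - 1#) * p)
      yS p = solve 2 (λ y p → y :+ (y :- :1) :* (:r y p :- :1) := y :* (:1 :+ (y :- :1) :* p)) refl y p

  ⟦difference⟧≈0 : ∀ m ρ → ⟦ nondegenerateᵗ ⟧ ρ ≉ 0# → ⟦ differenceᵗ m ⟧ ρ ≈ 0#
  ⟦difference⟧≈0 m ρ nondegenerate = trans (⟦⟧-cong (differenceᵗ m) ρ≈σ)
    (difference≈0 m _ _ _ _ _ _ λ e → nondegenerate (trans (⟦⟧-cong nondegenerateᵗ ρ≈σ) e))
    where
    y≉0 : ρ (suc zero) ≉ 0#
    y≉0 = proj₂ (factors≉0 nondegenerate)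
    -- The inverse of z = 1 + yp. This is the reason for the factor y in `nondegenerateᵗ`.
    p : Fin 6 → Carrier
    p i = (ρ i - 1#) * inv (ρ (suc zero))
    z≈ : ∀ i → ρ i ≈ 1# + ρ (suc zero) * p i
    z≈ i = trans (solve 1 (λ z → z := :1 :+ :1 :* (z :- :1)) refl (ρ i))
      (+-congˡ (trans (*-congʳ (sym (inverseʳ _ y≉0)))
        (solve 3 (λ y j w → y :* j :* w := y :* (w :* j)) refl _ _ _)))
    σ : Fin 6 → Carrier
    σ = point (ρ zero) (ρ (suc zero)) (p (suc (suc zero))) (p (suc (suc (suc zero))))
          (p (suc (suc (suc (suc zero))))) (p (suc (suc (suc (suc (suc zero))))))
    ρ≈σ : ∀ i → ρ i ≈ σ i
    ρ≈σ zero                               = refl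
    ρ≈σ (suc zero)                         = refl
    ρ≈σ (suc (suc zero))                   = z≈ _
    ρ≈σ (suc (suc (suc zero)))             = z≈ _
    ρ≈σ (suc (suc (suc (suc zero))))       = z≈ _
    ρ≈σ (suc (suc (suc (suc (suc zero))))) = z≈ _

  -- Where all variables are 1, every factor is 1. This point is the base point of the transfer.
  ⟦nondegenerate⟧≉0 : ⟦ nondegenerateᵗ ⟧ (λ _ → 1#) ≉ 0#
  ⟦nondegenerate⟧≉0 e = 1≉0 (trans (solve 0 (:1 := a :* a :* b :* b :* s :* s :* s :* :1) refl) e)
    where
    a b s : Polynomial 0
    a = :1 :* :1 :* :1 :- (:1 :- :1) :* (:1 :- :1)
    b = :1 :- :1 :* (:1 :- :1) :* (:1 :- :1)
    s = :1 :+ (:1 :- :1) :* (:1 :- :1)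

theorem1 : ∀ {c ℓ} (R : CommutativeRing c ℓ) →
    let open CommutativeRing R
        open GeneratingFunctions R
    in
    (m : ℕ) (x y z₁ z₂ z₃ z₄ : Carrier) →
    let n-2 = m
        n-1 = suc m
        n   = suc (suc m)
    in
    y * (z₄ - z₂) * (z₁ - z₃) * Zquad n x y z₁ z₂ z₃ z₄ * Z n-2 x y
    ≈
      ((z₁ - 1#) * (z₂ - 1#) - y * z₁ * z₂) * ((z₃ - 1#) * (z₄ - 1#) - y * z₃ * z₄)
        * Zadj n-1 x y z₄ z₁ * Zadj n-1 x y z₂ z₃
    - (x * (z₄ - 1#) * (z₁ - 1#) - y) * (x * (z₂ - 1#) * (z₃ - 1#) - y)
        * z₁ * z₂ * z₃ * z₄ * Z̃adj n-1 x y z₁ z₂ * Z̃adj n-1 x y z₃ z₄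
    - (z₂ - 1#) * (z₃ - 1#) * ((z₄ - 1#) * (z₁ - 1#) - y * z₄ * z₁)
        * Zadj n-1 x y z₄ z₁ * Z n-2 x y
    + (z₃ - 1#) * (z₄ - 1#) * (x * (z₁ - 1#) * (z₂ - 1#) - y)
        * z₁ * z₂ * (x * z₃ * z₄) ^ n-1 * Z̃adj n-1 x y z₁ z₂ * Z n-2 x y
    - (z₄ - 1#) * (z₁ - 1#) * ((z₂ - 1#) * (z₃ - 1#) - y * z₂ * z₃)
        * Zadj n-1 x y z₂ z₃ * Z n-2 x y
    + (z₁ - 1#) * (z₂ - 1#) * (x * (z₃ - 1#) * (z₄ - 1#) - y)
        * z₃ * z₄ * (x * z₁ * z₂) ^ n-1 * Z̃adj n-1 x y z₃ z₄ * Z n-2 x y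
    + (z₁ - 1#) * (z₂ - 1#) * (z₃ - 1#) * (z₄ - 1#)
        * (1# - (x ^ 2 * z₁ * z₂ * z₃ * z₄) ^ n-1) * Z n-2 x y ^ 2
theorem1 R m x y z₁ z₂ z₃ z₄ = x-y≈0⇒x≈y _ _ (trans
  (reflexive (≡.sym (⟦difference⟧ R m (environment R x y z₁ z₂ z₃ z₄))))
  (transferGeneric ℚ.+-*-commutativeRing ℚ-isField₀ R nondegenerateᵗ (differenceᵗ m) (λ _ → 1ℚ)
    (⟦nondegenerate⟧≉0 ℚ.+-*-commutativeRing ℚ-isField₀)
    (⟦difference⟧≈0 ℚ.+-*-commutativeRing ℚ-isField₀ m)
    (environment R x y z₁ z₂ z₃ z₄)))
  where
  open CommutativeRing R
  open IntSolver R
  x-y≈0⇒x≈y : ∀ a b → a - b ≈ 0# → a ≈ b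
  x-y≈0⇒x≈y a b e = trans (solve 2 (λ a b → a := (a :- b) :+ b) refl a b) (trans (+-congʳ e) (+-identityˡ b))
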